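{- Let $\mathsf{M}$ be a matroid of corank $2$ without coloops, of cardinality $n$ (so $\mathsf{M}$ has rank $n-2$). For each $r$, let $\lambda_r$ denote the number of stressed subsets of rank $r$ and size $r+1$ in $\mathsf{M}$. Then \[ P_{\mathsf{M}}(t) = P_{\mathsf{U}_{n-2,n}}(t)-\sum_{r}\lambda_r\left((n-r-2)P_{\mathsf{U}_{n-2,n-1}}(t)-\sum_{a=2}^{n-r-1}P_{\mathsf{U}_{n-a-1,n-a}}(t)\left(P_{\mathsf{U}_{a-1,a}}(t)+t\,P_{\mathsf{U}_{a-2,a-1}}(t)\right)\right), \] \[ Z_{\mathsf{M}}(t) = Z_{\mathsf{U}_{n-2,n}}(t)-\sum_{r}\lambda_r\left((n-r-2)Z_{\mathsf{U}_{n-2,n-1}}(t)-\sum_{a=2}^{n-r-1}Z_{\mathsf{U}_{a-1,a}}(t)\,Z_{\mathsf{U}_{n-a-1,n-a}}(t)\right). \]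
   Context: $\mathsf{U}_{k,n}$ is the uniform matroid of rank $k$ on $n$ elements. A subset $A$ of the ground set of $\mathsf{M}$ is stressed if both $\mathsf{M}|_A$ and $\mathsf{M}/A$ are uniform matroids. Kazhdan–Lusztig and $Z$-polynomials: there is a unique way to assign to each loopless matroid $\mathsf{M}$ a polynomial $P_{\mathsf{M}}(t)\in\mathbb{Z}[t]$ such that: (i) if $\operatorname{rk}(\mathsf{M})=0$ then $P_{\mathsf{M}}(t)=1$; (ii) if $\operatorname{rk}(\mathsf{M})>0$ then $\deg P_{\mathsf{M}}<\frac12\operatorname{rk}(\mathsf{M})$; (iii) for every loopless $\mathsf{M}$, the polynomial $Z_{\mathsf{M}}(t)=\sum_{F}t^{\operatorname{rk}(F)}P_{\mathsf{M}/F}(t)$, summed over all flats $F$ of $\mathsf{M}$, is palindromic, i.e. $t^{\operatorname{rk}(\mathsf{M})}Z_{\mathsf{M}}(t^{ -1})=Z_{\mathsf{M}}(t)$. $P_{\mathsf{M}}$ is the Kazhdan–Lusztig polynomial and $Z_{\mathsf{M}}$ the $Z$-polynomial of $\mathsf{M}$. Convention: for matroids with loops, $P_{\mathsf{M}}=Z_{\mathsf{M}}=0$; in particular $P_{\mathsf{U}_{0,1}}=Z_{\mathsf{U}_{0,1}}=0$. -}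

module Defs where

open import Data.Bool.Base using (if_then_else_)
open import Data.Fin.Base using (Fin; zero; suc)
import Data.Fin.Properties as Fin
open import Data.Fin.Subset
  using (Subset; inside; outside; _∈_; _∉_; _⊆_; ⊥; ⊤; ⁅_⁆; ∁; _∩_; _∪_; ∣_∣; Nonempty)
open import Data.Fin.Subset.Properties
open import Data.Integer.Base as ℤ using (ℤ; 0ℤ; 1ℤ; -1ℤ)
import Data.Integer.Properties as ℤ
open import Data.List.Base as List using (List; []; _∷_; _++_; filter; length; applyUpTo)
import Data.List.Properties as List
open import Data.List.Relation.Unary.All as All using (All; []; _∷_)
import Data.List.Relation.Unary.All.Properties as All
open import Data.Nat.Base hiding (_/_)
open import Data.Nat.Properties
open import Data.Product.Base using (Σ; ∃-syntax; _×_; _,_; proj₁; proj₂)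
open import Data.Sum.Base using (inj₁; inj₂)
open import Data.Vec.Base as Vec using ([]; _∷_; here; there)
open import Data.Vec.Properties using (cast-is-id)
open import Function.Base using (_∘_)
open import Relation.Binary.Definitions using (tri<; tri≈; tri>)
open import Relation.Binary.PropositionalEquality
  using (_≡_; _≢_; refl; sym; trans; cong; cong₂; subst; subst₂; module ≡-Reasoning)
open import Relation.Nullary
open import Relation.Nullary.Decidable using (decidable-stable; dec-true; dec-false; map′)

------------------------------------------------------------------------
-- The polynomial ring ℤ[t]

-- Coefficient lists, constant term first.  Trailing zeros are allowed, so
-- equality of polynomials is _≈_, not _≡_.
Poly : Set
Poly = List ℤ

coeff : Poly → ℕ → ℤ
coeff []      _       = 0ℤ
coeff (a ∷ p) zero    = a
coeff (a ∷ p) (suc i) = coeff p i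

infix  4 _≈_
infixl 6 _⊕_ _⊖_
infixl 7 _⊗_
infixr 8 _·_ t^_·_

_≈_ : Poly → Poly → Set
p ≈ q = ∀ i → coeff p i ≡ coeff q i

0ₚ 1ₚ : Poly
0ₚ = []
1ₚ = 1ℤ ∷ []

_⊕_ : Poly → Poly → Poly
[]      ⊕ q       = q
(a ∷ p) ⊕ []      = a ∷ p
(a ∷ p) ⊕ (b ∷ q) = a ℤ.+ b ∷ p ⊕ q

_·_ : ℤ → Poly → Poly
c · p = List.map (c ℤ.*_) p

_⊖_ : Poly → Poly → Poly
p ⊖ q = p ⊕ -1ℤ · q

_⊗_ : Poly → Poly → Poly
[]      ⊗ q = []
(a ∷ p) ⊗ q = a · q ⊕ (0ℤ ∷ p ⊗ q)

t^_·_ : ℕ → Poly → Poly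
t^ zero  · p = p
t^ suc k · p = 0ℤ ∷ t^ k · p

∑ : ∀ {a} {A : Set a} → List A → (A → Poly) → Poly
∑ xs f = List.foldr (λ x q → f x ⊕ q) 0ₚ xs

infix 5 ∑
infix 5 _⋯_
syntax ∑ xs (λ x → p) = ∑[ x ∈ xs ] p

-- The integers lo, lo + 1, …, hi; empty when hi < lo.
_⋯_ : ℕ → ℕ → List ℕ
lo ⋯ hi = applyUpTo (λ i → lo + i) (suc hi ∸ lo)

-- t^d p(t⁻¹) = p(t), as an identity of Laurent polynomials.
Palindromic : ℕ → Poly → Set
Palindromic d p = (∀ i → i ≤ d → coeff p (d ∸ i) ≡ coeff p i)
                × (∀ i → d < i → coeff p i ≡ 0ℤ)

------------------------------------------------------------------------
-- Subsets

subsets : ∀ n → List (Subset n)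
subsets zero    = [] ∷ []
subsets (suc n) = List.map (outside ∷_) (subsets n) ++ List.map (inside ∷_) (subsets n)

-- The order-preserving bijection Fin ∣ A ∣ → A, applied to subsets.
embed : ∀ {n} (A : Subset n) → Subset ∣ A ∣ → Subset n
embed []            B       = []
embed (inside  ∷ A) (b ∷ B) = b ∷ embed A B
embed (outside ∷ A) B       = outside ∷ embed A B

allSubset? : ∀ {n} {P : Subset n → Set} → (∀ B → Dec (P B)) → Dec (∀ B → P B)
allSubset? P? = map′
  (λ ¬∃ B → decidable-stable (P? B) (λ ¬p → ¬∃ (B , ¬p)))
  (λ all (B , ¬p) → ¬p (all B))
  (¬? (anySubset? (¬? ∘ P?)))

embed-∪ : ∀ {n} (A : Subset n) B C → embed A (B ∪ C) ≡ embed A B ∪ embed A C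
embed-∪ []            B       C       = refl
embed-∪ (inside  ∷ A) (b ∷ B) (c ∷ C) = cong (_ ∷_) (embed-∪ A B C)
embed-∪ (outside ∷ A) B       C       = cong (_ ∷_) (embed-∪ A B C)

embed-∩ : ∀ {n} (A : Subset n) B C → embed A (B ∩ C) ≡ embed A B ∩ embed A C
embed-∩ []            B       C       = refl
embed-∩ (inside  ∷ A) (b ∷ B) (c ∷ C) = cong (_ ∷_) (embed-∩ A B C)
embed-∩ (outside ∷ A) B       C       = cong (_ ∷_) (embed-∩ A B C)

∣embed∣ : ∀ {n} (A : Subset n) B → ∣ embed A B ∣ ≡ ∣ B ∣
∣embed∣ []            []            = refl
∣embed∣ (inside  ∷ A) (inside  ∷ B) = cong suc (∣embed∣ A B)
∣embed∣ (inside  ∷ A) (outside ∷ B) = ∣embed∣ A B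
∣embed∣ (outside ∷ A) B             = ∣embed∣ A B

embed-⊆ : ∀ {n} (A : Subset n) {B C} → B ⊆ C → embed A B ⊆ embed A C
embed-⊆ (inside  ∷ A) {b ∷ B} {c ∷ C} B⊆C here with B⊆C here
... | here = here
embed-⊆ (inside  ∷ A) {b ∷ B} {c ∷ C} B⊆C (there x) = there (embed-⊆ A (drop-∷-⊆ B⊆C) x)
embed-⊆ (outside ∷ A) B⊆C (there x) = there (embed-⊆ A B⊆C x)

embed-∁∪ : ∀ {n} (A : Subset n) → embed (∁ A) ⊤ ∪ A ≡ ⊤
embed-∁∪ []            = refl
embed-∁∪ (inside  ∷ A) = cong (_ ∷_) (embed-∁∪ A)
embed-∁∪ (outside ∷ A) = cong (_ ∷_) (embed-∁∪ A)

∪-monoˡ-⊆ : ∀ {n} {B C : Subset n} (A : Subset n) → B ⊆ C → B ∪ A ⊆ C ∪ A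
∪-monoˡ-⊆ {B = B} {C} A B⊆C x∈ with x∈p∪q⁻ B A x∈
... | inj₁ x∈B = x∈p∪q⁺ (inj₁ (B⊆C x∈B))
... | inj₂ x∈A = x∈p∪q⁺ (inj₂ x∈A)

∣∪∣+∣∩∣ : ∀ {n} (A B : Subset n) → ∣ A ∪ B ∣ + ∣ A ∩ B ∣ ≡ ∣ A ∣ + ∣ B ∣
∣∪∣+∣∩∣ []            []            = refl
∣∪∣+∣∩∣ (inside  ∷ A) (inside  ∷ B) = cong suc (trans (+-suc _ _) (trans (cong suc (∣∪∣+∣∩∣ A B)) (sym (+-suc _ _))))
∣∪∣+∣∩∣ (inside  ∷ A) (outside ∷ B) = cong suc (∣∪∣+∣∩∣ A B)
∣∪∣+∣∩∣ (outside ∷ A) (inside  ∷ B) = trans (cong suc (∣∪∣+∣∩∣ A B)) (sym (+-suc _ _))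
∣∪∣+∣∩∣ (outside ∷ A) (outside ∷ B) = ∣∪∣+∣∩∣ A B

------------------------------------------------------------------------
-- Matroids on Fin n, given by their rank function

record Matroid (n : ℕ) : Set where
  field
    rk        : Subset n → ℕ
    rk-bound  : ∀ A → rk A ≤ ∣ A ∣
    rk-mono   : ∀ {A B} → A ⊆ B → rk A ≤ rk B
    rk-submod : ∀ A B → rk (A ∪ B) + rk (A ∩ B) ≤ rk A + rk B

  rank : ℕ
  rank = rk ⊤

open Matroid public

-- Equality of matroids: the same rank function on the same ground set, where
-- Fin m and Fin n are identified whenever m ≡ n.
infix 4 _≈ᴹ_
_≈ᴹ_ : ∀ {m n} → Matroid m → Matroid n → Set
_≈ᴹ_ {m} {n} M N = Σ (m ≡ n) λ eq → ∀ B → rk M B ≡ rk N (Vec.cast eq B)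

module _ {n : ℕ} (M : Matroid n) where

  IsBasis : Subset n → Set
  IsBasis B = rk M B ≡ ∣ B ∣ × rk M B ≡ rank M

  IsLoop : Fin n → Set
  IsLoop e = rk M ⁅ e ⁆ ≡ 0

  IsColoop : Fin n → Set
  IsColoop e = ∀ B → IsBasis B → e ∈ B

  Loopless : Set
  Loopless = ∀ e → ¬ IsLoop e

  loopless? : Dec Loopless
  loopless? = Fin.all? λ e → ¬? (rk M ⁅ e ⁆ ≟ 0)

  IsFlat : Subset n → Set
  IsFlat F = ∀ e → e ∉ F → rk M F < rk M (F ∪ ⁅ e ⁆)

  flat? : ∀ F → Dec (IsFlat F)
  flat? F = Fin.all? λ e → ¬? (e ∈? F) →-dec (rk M F <? rk M (F ∪ ⁅ e ⁆))

  flats : List (Subset n)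
  flats = filter flat? (subsets n)

infixl 9 _∥_ _/_

_∥_ : ∀ {n} → Matroid n → (A : Subset n) → Matroid ∣ A ∣
M ∥ A = record
  { rk        = λ B → rk M (embed A B)
  ; rk-bound  = λ B → subst (rk M (embed A B) ≤_) (∣embed∣ A B) (rk-bound M (embed A B))
  ; rk-mono   = λ B⊆C → rk-mono M (embed-⊆ A B⊆C)
  ; rk-submod = λ B C → subst (_≤ rk M (embed A B) + rk M (embed A C))
      (sym (cong₂ (λ X Y → rk M X + rk M Y) (embed-∪ A B C) (embed-∩ A B C)))
      (rk-submod M (embed A B) (embed A C))
  }

private
  ∸-submod : ∀ {a x y u v} → a ≤ x → a ≤ y → a ≤ u → a ≤ v →
             x + y ≤ u + v → (x ∸ a) + (y ∸ a) ≤ (u ∸ a) + (v ∸ a)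
  ∸-submod {a} {x} {y} {u} {v} ax ay au av h =
    +-cancelʳ-≤ (a + a) _ _ (subst₂ _≤_ (sym (eq ax ay)) (sym (eq au av)) h)
    where
    open import Algebra.Properties.CommutativeSemigroup +-commutativeSemigroup using (interchange)
    eq : ∀ {p q} → a ≤ p → a ≤ q → (p ∸ a) + (q ∸ a) + (a + a) ≡ p + q
    eq {p} {q} ap aq = trans (interchange (p ∸ a) (q ∸ a) a a) (cong₂ _+_ (m∸n+n≡m ap) (m∸n+n≡m aq))

  ⊓-concave : ∀ k {a b c d} → a ≤ b → a ≤ c → d + a ≡ b + c →
              k ⊓ d + k ⊓ a ≤ k ⊓ b + k ⊓ c
  ⊓-concave k {a} {b} {c} {d} a≤b a≤c eq with ≤-total k b | ≤-total k c
  ... | inj₁ k≤b | _ = subst (λ z → _ ≤ z + _) (sym (m≤n⇒m⊓n≡m k≤b))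
                         (+-mono-≤ (m⊓n≤m k d) (⊓-monoʳ-≤ k a≤c))
  ... | inj₂ _ | inj₁ k≤c = subst (λ z → _ ≤ _ + z) (sym (m≤n⇒m⊓n≡m k≤c))
                         (subst (_≤ k ⊓ b + k) (+-comm (k ⊓ a) _)
                           (+-mono-≤ (⊓-monoʳ-≤ k a≤b) (m⊓n≤m k d)))
  ... | inj₂ b≤k | inj₂ c≤k = begin
    k ⊓ d + k ⊓ a ≤⟨ +-mono-≤ (m⊓n≤n k d) (m⊓n≤n k a) ⟩
    d + a         ≡⟨ eq ⟩
    b + c         ≡⟨ sym (cong₂ _+_ (m≥n⇒m⊓n≡n b≤k) (m≥n⇒m⊓n≡n c≤k)) ⟩
    k ⊓ b + k ⊓ c ∎
    where open ≤-Reasoning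

_/_ : ∀ {n} → Matroid n → (A : Subset n) → Matroid ∣ ∁ A ∣
M / A = record
  { rk        = r
  ; rk-bound  = λ B → ≤-trans (∸-monoˡ-≤ (rk M A) (≤-trans (m≤m+n _ _) (rk-submod M (e B) A)))
                        (subst (_≤ ∣ B ∣) (sym (m+n∸n≡m _ (rk M A)))
                          (subst (rk M (e B) ≤_) (∣embed∣ (∁ A) B) (rk-bound M (e B))))
  ; rk-mono   = λ B⊆C → ∸-monoˡ-≤ (rk M A) (rk-mono M (∪-monoˡ-⊆ A (embed-⊆ (∁ A) B⊆C)))
  ; rk-submod = λ B C → ∸-submod (A≤ _) (A≤ _) (A≤ B) (A≤ C)
      (subst (_≤ rk M (e B ∪ A) + rk M (e C ∪ A))
        (sym (cong₂ (λ X Y → rk M X + rk M Y) (∪-eq B C) (∩-eq B C)))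
        (rk-submod M (e B ∪ A) (e C ∪ A)))
  }
  where
  open ≡-Reasoning
  e : Subset ∣ ∁ A ∣ → Subset _
  e = embed (∁ A)
  r : Subset ∣ ∁ A ∣ → ℕ
  r B = rk M (e B ∪ A) ∸ rk M A
  A≤ : ∀ B → rk M A ≤ rk M (e B ∪ A)
  A≤ B = rk-mono M (q⊆p∪q (e B) A)
  ∪-eq : ∀ B C → e (B ∪ C) ∪ A ≡ (e B ∪ A) ∪ (e C ∪ A)
  ∪-eq B C = begin
    e (B ∪ C) ∪ A         ≡⟨ cong (_∪ A) (embed-∪ (∁ A) B C) ⟩
    (e B ∪ e C) ∪ A       ≡⟨ cong ((e B ∪ e C) ∪_) (sym (∪-idem A)) ⟩
    (e B ∪ e C) ∪ (A ∪ A) ≡⟨ interchange (e B) (e C) A A ⟩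
    (e B ∪ A) ∪ (e C ∪ A) ∎
    where
    open import Algebra.Bundles using (CommutativeMonoid)
    open import Algebra.Properties.CommutativeSemigroup
      (CommutativeMonoid.commutativeSemigroup (∪-commutativeMonoid _)) using (interchange)
  ∩-eq : ∀ B C → e (B ∩ C) ∪ A ≡ (e B ∪ A) ∩ (e C ∪ A)
  ∩-eq B C = trans (cong (_∪ A) (embed-∩ (∁ A) B C)) (∪-distribʳ-∩ A (e B) (e C))

-- Has rank k when k ≤ n; for k > n it is U n n.
U : ∀ k n → Matroid n
U k n = record
  { rk        = λ B → k ⊓ ∣ B ∣
  ; rk-bound  = λ B → m⊓n≤n k ∣ B ∣
  ; rk-mono   = λ B⊆C → ⊓-monoʳ-≤ k (p⊆q⇒∣p∣≤∣q∣ B⊆C)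
  ; rk-submod = λ B C → ⊓-concave k (∣p∩q∣≤∣p∣ B C) (∣p∩q∣≤∣q∣ B C) (∣∪∣+∣∩∣ B C)
  }

-- Every permutation of Fin n is an automorphism of U k n, so being isomorphic
-- to U k n is the same as having its rank function.
IsUniform : ∀ {n} → Matroid n → Set
IsUniform {n} M = ∃[ k ] k ≤ n × (∀ B → rk M B ≡ rk (U k n) B)

rank≤n : ∀ {n} (M : Matroid n) → rank M ≤ n
rank≤n {n} M = subst (rank M ≤_) (∣⊤∣≡n n) (rk-bound M ⊤)

uniform? : ∀ {n} (M : Matroid n) → Dec (IsUniform M)
uniform? {n} M = map′
  (λ h → rank M , rank≤n M , h)
  (λ (k , k≤n , h) B → subst (λ j → rk M B ≡ j ⊓ ∣ B ∣)
    (sym (trans (h ⊤) (trans (cong (k ⊓_) (∣⊤∣≡n n)) (m≤n⇒m⊓n≡m k≤n)))) (h B))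
  (allSubset? λ B → rk M B ≟ rank M ⊓ ∣ B ∣)

IsStressed : ∀ {n} → Matroid n → Subset n → Set
IsStressed M A = IsUniform (M ∥ A) × IsUniform (M / A)

stressed? : ∀ {n} (M : Matroid n) A → Dec (IsStressed M A)
stressed? M A = uniform? (M ∥ A) ×-dec uniform? (M / A)

-- The number of stressed subsets of rank r and size s.
#stressed : ∀ {n} → Matroid n → (r s : ℕ) → ℕ
#stressed {n} M r s =
  length (filter (λ A → stressed? M A ×-dec (rk M A ≟ r) ×-dec (∣ A ∣ ≟ s)) (subsets n))

------------------------------------------------------------------------
-- Kazhdan–Lusztig and Z-polynomials

-- The Z-polynomial built from an assignment P of polynomials to matroids;
-- zero on matroids with loops.
Z-of : (∀ {n} → Matroid n → Poly) → ∀ {n} → Matroid n → Poly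
Z-of P M = if does (loopless? M)
             then (∑[ F ∈ flats M ] t^ rk M F · P (M / F))
             else 0ₚ

-- These axioms determine P up to _≈_, and klPoly below satisfies them.  The
-- field respects is needed because equal matroids may be distinct as records:
-- M / ⊥ has ground set Fin ∣ ∁ ⊥ ∣ rather than Fin n.
record IsKazhdanLusztig (P : ∀ {n} → Matroid n → Poly) : Set where
  field
    respects    : ∀ {m n} (M : Matroid m) (N : Matroid n) → M ≈ᴹ N → P M ≈ P N
    loops       : ∀ {n} (M : Matroid n) → ¬ Loopless M → P M ≈ 0ₚ
    rank-zero   : ∀ {n} (M : Matroid n) → Loopless M → rank M ≡ 0 → P M ≈ 1ₚ
    degree      : ∀ {n} (M : Matroid n) → Loopless M → 0 < rank M →
                  ∀ i → rank M ≤ 2 * i → coeff (P M) i ≡ 0ℤ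
    palindromic : ∀ {n} (M : Matroid n) → Loopless M → Palindromic (rank M) (Z-of P M)

------------------------------------------------------------------------
-- Existence

-- P is computed from the terms S of Z other than P itself: palindromicity
-- forces the coefficient of tⁱ in P to be S_{r-i} - S_i when 2i < r.
-- The first argument bounds the recursion depth; suc n suffices.
klCoeff : ℕ → Poly → ℕ → ℤ
klCoeff r S i = if does (2 * i <? r) then coeff S (r ∸ i) ℤ.- coeff S i else 0ℤ

mutual
  kl : ℕ → ∀ {n} → Matroid n → Poly
  kl zero    M = 0ₚ
  kl (suc f) M = if does (loopless? M)
                   then (if does (rank M ≟ 0)
                     then 1ₚ
                     else applyUpTo (klCoeff (rank M) (klTail f M)) (rank M))
                   else 0ₚ

  klTail : ℕ → ∀ {n} → Matroid n → Poly
  klTail f M = ∑[ F ∈ filter nonempty? (flats M) ] t^ rk M F · kl f (M / F)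

klPoly : ∀ {n} → Matroid n → Poly
klPoly {n} = kl (suc n)

module Existence where

  coeff-⊕ : ∀ p q i → coeff (p ⊕ q) i ≡ coeff p i ℤ.+ coeff q i
  coeff-⊕ []      q       i       = sym (ℤ.+-identityˡ _)
  coeff-⊕ (a ∷ p) []      i       = sym (ℤ.+-identityʳ _)
  coeff-⊕ (a ∷ p) (b ∷ q) zero    = refl
  coeff-⊕ (a ∷ p) (b ∷ q) (suc i) = coeff-⊕ p q i

  ∑-cong : ∀ {A : Set} {f g : A → Poly} {xs} → All (λ x → f x ≡ g x) xs → ∑ xs f ≡ ∑ xs g
  ∑-cong []       = refl
  ∑-cong (e ∷ es) = cong₂ _⊕_ e (∑-cong es)

  ∑-zero : ∀ {A : Set} {f : A → Poly} xs i → (∀ x → coeff (f x) i ≡ 0ℤ) → coeff (∑ xs f) i ≡ 0ℤ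
  ∑-zero         []       i h = refl
  ∑-zero {f = f} (x ∷ xs) i h =
    trans (coeff-⊕ (f x) _ i) (cong₂ ℤ._+_ (h x) (∑-zero xs i h))

  t^-zero : ∀ {p} k {i d} → (∀ j → d < j → coeff p j ≡ 0ℤ) → k + d < i → coeff (t^ k · p) i ≡ 0ℤ
  t^-zero zero    h lt       = h _ lt
  t^-zero (suc k) h (s≤s lt) = t^-zero k h lt

  coeff-applyUpTo : ∀ f r i → (r ≤ i → f i ≡ 0ℤ) → coeff (applyUpTo f r) i ≡ f i
  coeff-applyUpTo f zero    i       h = sym (h z≤n)
  coeff-applyUpTo f (suc r) zero    h = refl
  coeff-applyUpTo f (suc r) (suc i) h = coeff-applyUpTo (f ∘ suc) r i (h ∘ s≤s)

  if-yes : ∀ {A P : Set} {x y : A} (P? : Dec P) → P → (if does P? then x else y) ≡ x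
  if-yes P? p = cong (if_then _ else _) (dec-true P? p)

  if-no : ∀ {A P : Set} {x y : A} (P? : Dec P) → ¬ P → (if does P? then x else y) ≡ y
  if-no P? ¬p = cong (if_then _ else _) (dec-false P? ¬p)

  klCoeff-high : ∀ r S i → r ≤ 2 * i → klCoeff r S i ≡ 0ℤ
  klCoeff-high r S i le = if-no (2 * i <? r) (≤⇒≯ le)

  klCoeff-low : ∀ r S i → 2 * i < r → klCoeff r S i ≡ coeff S (r ∸ i) ℤ.- coeff S i
  klCoeff-low r S i lt = if-yes (2 * i <? r) lt

  i≤2i : ∀ i → i ≤ 2 * i
  i≤2i i = m≤m+n i _

  high≡0 : ∀ r S i → r ≤ i → klCoeff r S i ≡ 0ℤ
  high≡0 r S i le = klCoeff-high r S i (≤-trans le (i≤2i i))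

  loop⇒kl : ∀ f {n} (M : Matroid n) → ¬ Loopless M → kl f M ≡ 0ₚ
  loop⇒kl zero    M ¬ℓ = refl
  loop⇒kl (suc f) M ¬ℓ = if-no (loopless? M) ¬ℓ

  rank0⇒kl : ∀ f {n} (M : Matroid n) → Loopless M → rank M ≡ 0 → kl (suc f) M ≡ 1ₚ
  rank0⇒kl f M ℓ r≡0 = trans (if-yes (loopless? M) ℓ) (if-yes (rank M ≟ 0) r≡0)

  loopless⇒kl : ∀ f {n} (M : Matroid n) → Loopless M → rank M ≢ 0 → ∀ i →
                coeff (kl (suc f) M) i ≡ klCoeff (rank M) (klTail f M) i
  loopless⇒kl f M ℓ r≢0 i = trans
    (cong (λ p → coeff p i) (trans (if-yes (loopless? M) ℓ) (if-no (rank M ≟ 0) r≢0)))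
    (coeff-applyUpTo _ (rank M) i (high≡0 (rank M) (klTail f M) i))

  kl-degree : ∀ f {n} (M : Matroid n) j → rank M < j → coeff (kl f M) j ≡ 0ℤ
  kl-degree zero    M j lt = refl
  kl-degree (suc f) M j@(suc _) lt with loopless? M
  ... | no ¬ℓ = cong (λ p → coeff p j) (loop⇒kl (suc f) M ¬ℓ)
  ... | yes ℓ with rank M ≟ 0
  ...   | yes r≡0 = cong (λ p → coeff p j) (rank0⇒kl f M ℓ r≡0)
  ...   | no  r≢0 = trans (loopless⇒kl f M ℓ r≢0 j) (high≡0 (rank M) (klTail f M) j (<⇒≤ lt))

  rank-/ : ∀ {n} (M : Matroid n) F → rank (M / F) ≡ rank M ∸ rk M F
  rank-/ M F = cong (λ A → rk M A ∸ rk M F) (embed-∁∪ F)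

  klTail-degree : ∀ f {n} (M : Matroid n) i → rank M < i → coeff (klTail f M) i ≡ 0ℤ
  klTail-degree f M i lt = ∑-zero (filter nonempty? (flats M)) i λ F →
    t^-zero (rk M F) (kl-degree f (M / F))
      (subst (_< i) (sym (trans (cong (rk M F +_) (rank-/ M F)) (m+[n∸m]≡n (rk-mono M (⊆-max F))))) lt)

  subsets-⊥ : ∀ n → ∃[ xs ] subsets n ≡ ⊥ ∷ xs × All Nonempty xs
  subsets-⊥ zero = [] , refl , []
  subsets-⊥ (suc n) with subsets n | subsets-⊥ n
  ... | _ | xs , refl , ne =
    List.map (outside ∷_) xs ++ List.map (inside ∷_) (⊥ ∷ xs) , refl ,
    All.++⁺ (All.map⁺ (All.map (λ (e , e∈) → suc e , there e∈) ne))
            (All.map⁺ (All.universal (λ _ → zero , here) _))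

  rk-⊥ : ∀ {n} (M : Matroid n) → rk M ⊥ ≡ 0
  rk-⊥ {n} M = n≤0⇒n≡0 (subst (rk M ⊥ ≤_) (∣⊥∣≡0 n) (rk-bound M ⊥))

  ⊥-flat : ∀ {n} (M : Matroid n) → Loopless M → IsFlat M ⊥
  ⊥-flat M ℓ e _ = subst₂ _<_ (sym (rk-⊥ M)) (cong (rk M) (sym (∪-identityˡ ⁅ e ⁆))) (n≢0⇒n>0 (ℓ e))

  flats-⊥ : ∀ {n} (M : Matroid n) → Loopless M → flats M ≡ ⊥ ∷ filter nonempty? (flats M)
  flats-⊥ {n} M ℓ with subsets n | subsets-⊥ n
  ... | _ | xs , refl , ne = begin
    filter (flat? M) (⊥ ∷ xs)                           ≡⟨ split ⟩
    ⊥ ∷ filter (flat? M) xs                             ≡⟨ cong (⊥ ∷_) (sym (List.filter-all nonempty? (All.filter⁺ (flat? M) ne))) ⟩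
    ⊥ ∷ filter nonempty? (filter (flat? M) xs)          ≡⟨ cong (⊥ ∷_) (sym (List.filter-reject nonempty? λ (e , e∈) → ∉⊥ e∈)) ⟩
    ⊥ ∷ filter nonempty? (⊥ ∷ filter (flat? M) xs)      ≡⟨ cong (λ ys → ⊥ ∷ filter nonempty? ys) (sym split) ⟩
    ⊥ ∷ filter nonempty? (filter (flat? M) (⊥ ∷ xs))    ∎
    where
    open ≡-Reasoning
    split = List.filter-accept (flat? M) {xs = xs} (⊥-flat M ℓ)

  ∣∁∣<n : ∀ {n} {F : Subset n} → Nonempty F → ∣ ∁ F ∣ < n
  ∣∁∣<n {n} {F} (e , e∈F) = subst (∣ ∁ F ∣ <_) (∣⊤∣≡n n)
    (p⊂q⇒∣p∣<∣q∣ (⊆-max _ , e , ∈⊤ , λ e∈∁ → x∈∁p⇒x∉p e∈∁ e∈F))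

  _≐_ : ∀ {n} → Matroid n → Matroid n → Set
  M ≐ N = ∀ B → rk M B ≡ rk N B

  does-cong : ∀ {P Q : Set} (P? : Dec P) (Q? : Dec Q) → (P → Q) → (Q → P) → does P? ≡ does Q?
  does-cong (yes p) (yes q) f g = refl
  does-cong (yes p) (no ¬q) f g = contradiction (f p) ¬q
  does-cong (no ¬p) (yes q) f g = contradiction (g q) ¬p
  does-cong (no ¬p) (no ¬q) f g = refl

  loopless-≐ : ∀ {n} {M N : Matroid n} → M ≐ N → Loopless M → Loopless N
  loopless-≐ eq ℓ e r = ℓ e (trans (eq _) r)

  flat-≐ : ∀ {n} {M N : Matroid n} → M ≐ N → ∀ {F} → IsFlat M F → IsFlat N F
  flat-≐ eq fl e e∉ = subst₂ _<_ (eq _) (eq _) (fl e e∉)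

  flats-≐ : ∀ {n} {M N : Matroid n} → M ≐ N → flats M ≡ flats N
  flats-≐ {n} {M} {N} eq = List.filter-≐ (flat? M) (flat? N)
    (flat-≐ {M = M} {N} eq , flat-≐ {M = N} {M} (sym ∘ eq)) (subsets n)

  mutual
    kl-≐ : ∀ f g {n} (M N : Matroid n) → n < f → n < g → M ≐ N → kl f M ≡ kl g N
    kl-≐ (suc f) (suc g) {n} M N (s≤s n≤f) (s≤s n≤g) eq
      rewrite does-cong (loopless? M) (loopless? N) (loopless-≐ {M = M} {N} eq) (loopless-≐ {M = N} {M} (sym ∘ eq))
            | eq ⊤ | klTail-≐ f g M N n≤f n≤g eq = refl

    klTail-≐ : ∀ f g {n} (M N : Matroid n) → n ≤ f → n ≤ g → M ≐ N → klTail f M ≡ klTail g N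
    klTail-≐ f g M N n≤f n≤g eq rewrite flats-≐ {M = M} {N} eq =
      ∑-cong (All.map (λ {F} ne → cong₂ t^_·_ (eq F)
          (kl-≐ f g (M / F) (N / F) (<-≤-trans (∣∁∣<n ne) n≤f) (<-≤-trans (∣∁∣<n ne) n≤g)
             (λ B → cong₂ _∸_ (eq _) (eq F))))
        (All.all-filter nonempty? (flats N)))

  kl-≈ᴹ : ∀ {m n} (M : Matroid m) (N : Matroid n) → M ≈ᴹ N → klPoly M ≡ klPoly N
  kl-≈ᴹ {m} M N (refl , eq) = kl-≐ (suc m) (suc m) M N ≤-refl ≤-refl
    (λ B → trans (eq B) (cong (rk N) (cast-is-id refl B)))

  ∣∁⊥∣≡n : ∀ n → ∣ ∁ (⊥ {n}) ∣ ≡ n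
  ∣∁⊥∣≡n zero    = refl
  ∣∁⊥∣≡n (suc n) = cong suc (∣∁⊥∣≡n n)

  embed-∁⊥ : ∀ n .(eq : ∣ ∁ (⊥ {n}) ∣ ≡ n) B → embed (∁ ⊥) B ≡ Vec.cast eq B
  embed-∁⊥ zero    eq []      = refl
  embed-∁⊥ (suc n) eq (b ∷ B) = cong (b ∷_) (embed-∁⊥ n (cong pred eq) B)

  /-⊥ : ∀ {n} (M : Matroid n) → M / ⊥ ≈ᴹ M
  /-⊥ {n} M = ∣∁⊥∣≡n n , λ B → cong₂ _∸_
    (cong (rk M) (trans (∪-identityʳ _) (embed-∁⊥ n (∣∁⊥∣≡n n) B))) (rk-⊥ M)

  kl-Z : ∀ {n} (M : Matroid n) → Loopless M → ∀ i →
         coeff (Z-of klPoly M) i ≡ coeff (klPoly M) i ℤ.+ coeff (klTail n M) i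
  kl-Z {n} M ℓ i = begin
    coeff (Z-of klPoly M) i
      ≡⟨ cong (λ p → coeff p i) (if-yes (loopless? M) ℓ) ⟩
    coeff (∑ (flats M) term) i
      ≡⟨ cong (λ Gs → coeff (∑ Gs term) i) (flats-⊥ M ℓ) ⟩
    coeff (term ⊥ ⊕ ∑ Fs term) i
      ≡⟨ coeff-⊕ (term ⊥) _ i ⟩
    coeff (term ⊥) i ℤ.+ coeff (∑ Fs term) i
      ≡⟨ cong₂ (λ p q → coeff p i ℤ.+ coeff q i) (cong₂ t^_·_ (rk-⊥ M) (kl-≈ᴹ (M / ⊥) M (/-⊥ M))) tail≡ ⟩
    coeff (klPoly M) i ℤ.+ coeff (klTail n M) i ∎
    where
    open ≡-Reasoning
    Fs = filter nonempty? (flats M)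
    term : Subset n → Poly
    term F = t^ rk M F · klPoly (M / F)
    tail≡ : ∑ Fs term ≡ klTail n M
    tail≡ = ∑-cong (All.map (λ {F} ne → cong (t^ rk M F ·_)
        (kl-≐ (suc ∣ ∁ F ∣) n (M / F) (M / F) ≤-refl (∣∁∣<n ne) (λ _ → refl)))
      (All.all-filter nonempty? (flats M)))

  cancel : ∀ x y → (x ℤ.- y) ℤ.+ y ≡ x
  cancel x y = trans (ℤ.+-assoc x _ y) (trans (cong (λ z → x ℤ.+ z) (ℤ.+-inverseˡ y)) (ℤ.+-identityʳ x))

  balanced : ∀ S {i j} → i < j →
             klCoeff (i + j) S j ℤ.+ coeff S j ≡ klCoeff (i + j) S i ℤ.+ coeff S i
  balanced S {i} {j} i<j = begin
    klCoeff (i + j) S j ℤ.+ coeff S j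
      ≡⟨ cong (ℤ._+ coeff S j) (klCoeff-high (i + j) S j
           (subst (λ k → i + j ≤ j + k) (sym (+-identityʳ j)) (+-monoˡ-≤ j (<⇒≤ i<j)))) ⟩
    0ℤ ℤ.+ coeff S j
      ≡⟨ ℤ.+-identityˡ _ ⟩
    coeff S j
      ≡⟨ cong (coeff S) (sym (m+n∸m≡n i j)) ⟩
    coeff S (i + j ∸ i)
      ≡⟨ sym (cancel _ (coeff S i)) ⟩
    (coeff S (i + j ∸ i) ℤ.- coeff S i) ℤ.+ coeff S i
      ≡⟨ cong (ℤ._+ coeff S i) (sym (klCoeff-low (i + j) S i
           (subst (λ k → i + k < i + j) (sym (+-identityʳ i)) (+-monoʳ-< i i<j)))) ⟩
    klCoeff (i + j) S i ℤ.+ coeff S i ∎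
    where open ≡-Reasoning

  symmetric : ∀ S i j → klCoeff (i + j) S j ℤ.+ coeff S j ≡ klCoeff (i + j) S i ℤ.+ coeff S i
  symmetric S i j with <-cmp i j
  ... | tri< i<j _ _  = balanced S i<j
  ... | tri≈ _ refl _ = refl
  ... | tri> _ _ j<i  = sym (subst
    (λ r → klCoeff r S i ℤ.+ coeff S i ≡ klCoeff r S j ℤ.+ coeff S j) (+-comm j i) (balanced S j<i))

  kl-palindromic : ∀ {n} (M : Matroid n) → Loopless M → Palindromic (rank M) (Z-of klPoly M)
  kl-palindromic {n} M ℓ = pal , λ i r<i → trans (kl-Z M ℓ i)
      (cong₂ ℤ._+_ (kl-degree (suc n) M i r<i) (klTail-degree n M i r<i))
    where
    pal : ∀ i → i ≤ rank M → coeff (Z-of klPoly M) (rank M ∸ i) ≡ coeff (Z-of klPoly M) i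
    pal i i≤r with rank M ≟ 0
    ... | yes r≡0 = cong (coeff (Z-of klPoly M)) (trans (cong (_∸ i) r≡0)
                      (trans (0∸n≡0 i) (sym (n≤0⇒n≡0 (subst (i ≤_) r≡0 i≤r)))))
    ... | no  r≢0 = trans (expand (rank M ∸ i)) (trans
        (subst (λ r → klCoeff r S (rank M ∸ i) ℤ.+ coeff S (rank M ∸ i) ≡ klCoeff r S i ℤ.+ coeff S i)
          (m+[n∸m]≡n i≤r) (symmetric S i (rank M ∸ i)))
        (sym (expand i)))
      where
      S = klTail n M
      expand : ∀ j → coeff (Z-of klPoly M) j ≡ klCoeff (rank M) S j ℤ.+ coeff S j
      expand j = trans (kl-Z M ℓ j) (cong (ℤ._+ coeff S j) (loopless⇒kl n M ℓ r≢0 j))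

  ≡⇒≈ : ∀ {p q} → p ≡ q → p ≈ q
  ≡⇒≈ refl i = refl

klPoly-isKazhdanLusztig : IsKazhdanLusztig klPoly
klPoly-isKazhdanLusztig = record
  { respects    = λ M N eq → ≡⇒≈ (kl-≈ᴹ M N eq)
  ; loops       = λ {n} M ¬ℓ i → cong (λ p → coeff p i) (loop⇒kl (suc n) M ¬ℓ)
  ; rank-zero   = λ {n} M ℓ r≡0 → ≡⇒≈ (rank0⇒kl n M ℓ r≡0)
  ; degree      = λ {n} M ℓ 0<r i r≤2i →
      trans (loopless⇒kl n M ℓ (n>0⇒n≢0 0<r) i) (klCoeff-high (rank M) (klTail n M) i r≤2i)
  ; palindromic = kl-palindromic
  }
  where open Existence

{-# OPTIONS --safe #-}

-- The dual of M has rank 2 and no loops, so M is determined by the partition of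
-- its ground set into the parallel classes of the dual: a set is dependent iff
-- its complement lies in a single class, and the stressed circuits are exactly
-- the complements of the classes.  Contracting F restricts the partition to the
-- complement of F.
--
-- Put u n = t² P(U_{n-2,n}) and v n = t P(U_{n-1,n}), both corrected to 1 at
-- n = 0, and let G n s and K n s be t² times the coefficient of λ_r, s = n-r-1,
-- in the formulas for P and for Z.  If ν is the number of classes, capped at 2,
-- then a single formula
--   t^ν P = u n - ∑ G n |S|   (sum over the classes S)
-- covers M and all its contractions.  Summed over all contractions, it gives the
-- formula for Z because of the identity
--   K (s+r) s = ∑ t^(s+r-|A|-|B|) G (|A|+|B|) |A|   (A ⊆ [s], B ⊆ [r]),
-- which holds for arbitrary v.  Hence t² times the difference of the two sides of
-- the formula for P is palindromic with respect to degree n + 2, and its actual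
-- degree is less than (n + 2) / 2, so it vanishes.  If M has a loop, the formula
-- for P is the relation u (m+1) = G (m+1) m between uniform matroids, which is
-- proved in the same way.
module Submission where

open import Defs
open import Algebra.Bundles using (CommutativeRing)
import Algebra.Properties.CommutativeSemigroup as CommutativeSemigroup
open import Data.Bool.Base using (if_then_else_)
import Data.Bool.Properties as Bool
open import Data.Fin.Base using (Fin; zero; suc)
import Data.Fin.Properties as Fin
open import Data.Fin.Subset
  using (Subset; inside; outside; _∈_; _∉_; _⊆_; ⊥; ⊤; ⁅_⁆; ∁; _∩_; _∪_; ∣_∣; Nonempty)
open import Data.Fin.Subset.Properties
open import Data.Integer.Base as ℤ using (ℤ; 0ℤ; 1ℤ; -1ℤ)
import Data.Integer.Properties as ℤ
open import Data.Integer.Tactic.RingSolver using (solve-∀)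
open import Data.List.Base as List using (List; []; _∷_; _++_; filter; length)
open import Data.List.Membership.Propositional using () renaming (_∈_ to _∈ˡ_)
open import Data.List.Membership.Propositional.Properties
  using (∈-filter⁺; ∈-filter⁻; ∈-map⁺; ∈-map⁻; ∈-++⁺ˡ; ∈-++⁺ʳ; ∈-allFin; ∈-applyUpTo⁺)
import Data.List.Properties as List
open import Data.List.Relation.Binary.Permutation.Propositional using (_↭_; ↭-refl; ↭-sym; ↭-trans; prep; swap)
open import Data.List.Relation.Binary.Permutation.Propositional.Properties using (↭-length; filter-↭; All-resp-↭)
open import Data.List.Relation.Unary.All as All using (All; []; _∷_)
open import Data.List.Relation.Unary.All.Properties using (¬All⇒Any¬)
open import Data.List.Relation.Unary.AllPairs using ([]; _∷_)
open import Data.List.Relation.Unary.Any using (here; there)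
open import Data.List.Relation.Unary.Unique.Propositional using (Unique)
import Data.List.Relation.Unary.Unique.Propositional.Properties as Unique
open import Data.Maybe.Base using (Maybe; just; nothing)
open import Data.Nat.Base hiding (_/_)
open import Data.Nat.Properties
open import Data.Product.Base using (∃-syntax; _×_; _,_; proj₁; proj₂)
open import Data.Sum.Base using (_⊎_; inj₁; inj₂)
open import Data.Unit.Base using (tt)
open import Data.Vec.Base as Vec using (Vec; []; _∷_; toList)
open import Data.Vec.Properties as Vec using (cast-is-id; length-toList; lookup∘tabulate; []=⇒lookup; lookup⇒[]=)
open import Function.Base using (_∘_)
open import Level using (0ℓ)
open import Relation.Binary.Definitions using (DecidableEquality)
open import Relation.Binary.PropositionalEquality
  using (_≡_; _≢_; refl; sym; trans; cong; cong₂; subst; subst₂; module ≡-Reasoning)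
open import Relation.Nullary
open import Relation.Nullary.Decidable using (decidable-stable; dec-true; dec-false; map′)
open import Tactic.RingSolver.Core.AlmostCommutativeRing using (fromCommutativeRing)
open Existence using (coeff-⊕)

-- ℤ[t] as a commutative ring

-- The normalisation by t^ν is forced. Since rk F + 2 = |F| + ν(M / F), the factor t² turns the
-- summand of Z at F into t^|F| times t^ν P(M / F), a weight that depends on F only through its
-- size. As P vanishes on matroids with loops, sets F that are not flats may be included, so Z
-- becomes a sum over all subsets of the ground set and can be evaluated one element at a time,
-- without knowing which sets are flats. The price is that the formula must also hold for degenerate
-- contractions: those with loops, with a single class, or on the empty set. There P is 0,
-- P(U_{n-1,n}) or 1. The loop case and the single-class case both come down to u (m+1) = G (m+1) m,
-- which is therefore settled for uniform matroids before any other matroid is treated.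

neg : Poly → Poly
neg p = -1ℤ · p

coeff-· : ∀ c p i → coeff (c · p) i ≡ c ℤ.* coeff p i
coeff-· c []      i       = sym (ℤ.*-zeroʳ c)
coeff-· c (a ∷ p) zero    = refl
coeff-· c (a ∷ p) (suc i) = coeff-· c p i

coeff-neg : ∀ p i → coeff (neg p) i ≡ ℤ.- coeff p i
coeff-neg p i = trans (coeff-· -1ℤ p i) (ℤ.-1*i≡-i _)

-- Coefficient sequences have no lengths to compare, so the laws of `_⊗_` are proved for this Cauchy
-- product and carried over by `coeff-⊗`.
conv : (ℕ → ℤ) → (ℕ → ℤ) → ℕ → ℤ
conv f g zero    = f 0 ℤ.* g 0
conv f g (suc i) = f 0 ℤ.* g (suc i) ℤ.+ conv (f ∘ suc) g i

conv-cong : ∀ {f f′ g g′} → (∀ i → f i ≡ f′ i) → (∀ i → g i ≡ g′ i) → ∀ i → conv f g i ≡ conv f′ g′ i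
conv-cong f≡ g≡ zero    = cong₂ ℤ._*_ (f≡ 0) (g≡ 0)
conv-cong f≡ g≡ (suc i) =
  cong₂ ℤ._+_ (cong₂ ℤ._*_ (f≡ 0) (g≡ (suc i))) (conv-cong (f≡ ∘ suc) g≡ i)

conv-vanishes : ∀ f g i → (∀ j k → j + k ≡ i → f j ℤ.* g k ≡ 0ℤ) → conv f g i ≡ 0ℤ
conv-vanishes f g zero    h = h 0 0 refl
conv-vanishes f g (suc i) h =
  cong₂ ℤ._+_ (h 0 (suc i) refl) (conv-vanishes (f ∘ suc) g i λ j k eq → h (suc j) k (cong suc eq))

coeff-⊗ : ∀ p q i → coeff (p ⊗ q) i ≡ conv (coeff p) (coeff q) i
coeff-⊗ []      q i    = sym (conv-vanishes _ _ i λ j k _ → refl)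
coeff-⊗ (a ∷ p) q zero =
  trans (coeff-⊕ (a · q) _ 0) (trans (ℤ.+-identityʳ _) (coeff-· a q 0))
coeff-⊗ (a ∷ p) q (suc i) =
  trans (coeff-⊕ (a · q) _ (suc i)) (cong₂ ℤ._+_ (coeff-· a q (suc i)) (coeff-⊗ p q i))

-- `conv` splits off the term with first index 0; commutativity requires splitting off the term with
-- second index 0.
conv-sucʳ : ∀ f g i → conv f g (suc i) ≡ conv f (g ∘ suc) i ℤ.+ f (suc i) ℤ.* g 0
conv-sucʳ f g zero    = refl
conv-sucʳ f g (suc i) =
  trans (cong (λ z → f 0 ℤ.* g (2 + i) ℤ.+ z) (conv-sucʳ (f ∘ suc) g i)) (sym (ℤ.+-assoc (f 0 ℤ.* g (2 + i)) _ _))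

conv-comm : ∀ f g i → conv f g i ≡ conv g f i
conv-comm f g zero    = ℤ.*-comm (f 0) (g 0)
conv-comm f g (suc i) = trans (conv-sucʳ f g i)
  (trans (ℤ.+-comm _ (f (suc i) ℤ.* g 0)) (cong₂ ℤ._+_ (ℤ.*-comm (f (suc i)) (g 0)) (conv-comm f (g ∘ suc) i)))

-- The combination has the shape of `conv f g ∘ suc`, namely f 0 times `g ∘ suc` plus
-- `conv (f ∘ suc) g`, which is what `conv-assoc` meets. With c = 1 it gives distributivity.
conv-linearˡ : ∀ c f f′ g i → conv (λ j → c ℤ.* f j ℤ.+ f′ j) g i ≡ c ℤ.* conv f g i ℤ.+ conv f′ g i
conv-linearˡ c f f′ g zero = lemma c (f 0) (f′ 0) (g 0)
  where
  lemma : ∀ c x y z → (c ℤ.* x ℤ.+ y) ℤ.* z ≡ c ℤ.* (x ℤ.* z) ℤ.+ y ℤ.* z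
  lemma = solve-∀
conv-linearˡ c f f′ g (suc i) =
  trans (cong (ℤ._+_ ((c ℤ.* f 0 ℤ.+ f′ 0) ℤ.* g (suc i))) (conv-linearˡ c (f ∘ suc) (f′ ∘ suc) g i)) (lemma c (f 0) (f′ 0) (g (suc i)) (conv (f ∘ suc) g i) (conv (f′ ∘ suc) g i))
  where
  lemma : ∀ c x y z u v → (c ℤ.* x ℤ.+ y) ℤ.* z ℤ.+ (c ℤ.* u ℤ.+ v)
                        ≡ c ℤ.* (x ℤ.* z ℤ.+ u) ℤ.+ (y ℤ.* z ℤ.+ v)
  lemma = solve-∀

conv-assoc : ∀ f g h i → conv (conv f g) h i ≡ conv f (conv g h) i
conv-assoc f g h zero    = ℤ.*-assoc (f 0) (g 0) (h 0)
conv-assoc f g h (suc i) = begin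
  f 0 ℤ.* g 0 ℤ.* h (suc i) ℤ.+ conv (conv f g ∘ suc) h i
    ≡⟨ cong (ℤ._+_ (f 0 ℤ.* g 0 ℤ.* h (suc i))) (conv-linearˡ (f 0) (g ∘ suc) (conv (f ∘ suc) g) h i) ⟩
  f 0 ℤ.* g 0 ℤ.* h (suc i) ℤ.+ (f 0 ℤ.* conv (g ∘ suc) h i ℤ.+ conv (conv (f ∘ suc) g) h i)
    ≡⟨ cong (λ z → f 0 ℤ.* g 0 ℤ.* h (suc i) ℤ.+ (f 0 ℤ.* conv (g ∘ suc) h i ℤ.+ z)) (conv-assoc (f ∘ suc) g h i) ⟩
  f 0 ℤ.* g 0 ℤ.* h (suc i) ℤ.+ (f 0 ℤ.* conv (g ∘ suc) h i ℤ.+ conv (f ∘ suc) (conv g h) i)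
    ≡⟨ lemma (f 0) (g 0) (h (suc i)) (conv (g ∘ suc) h i) (conv (f ∘ suc) (conv g h) i) ⟩
  f 0 ℤ.* (g 0 ℤ.* h (suc i) ℤ.+ conv (g ∘ suc) h i) ℤ.+ conv (f ∘ suc) (conv g h) i ∎
  where
  open ≡-Reasoning
  lemma : ∀ x y z u v → x ℤ.* y ℤ.* z ℤ.+ (x ℤ.* u ℤ.+ v) ≡ x ℤ.* (y ℤ.* z ℤ.+ u) ℤ.+ v
  lemma = solve-∀

⊗-comm : ∀ p q → p ⊗ q ≈ q ⊗ p
⊗-comm p q i = trans (coeff-⊗ p q i) (trans (conv-comm _ _ i) (sym (coeff-⊗ q p i)))

⊗-cong : ∀ {p p′ q q′} → p ≈ p′ → q ≈ q′ → p ⊗ q ≈ p′ ⊗ q′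
⊗-cong {p} {p′} {q} {q′} p≈ q≈ i =
  trans (coeff-⊗ p q i) (trans (conv-cong p≈ q≈ i) (sym (coeff-⊗ p′ q′ i)))

⊗-assoc : ∀ p q r → (p ⊗ q) ⊗ r ≈ p ⊗ (q ⊗ r)
⊗-assoc p q r i = begin
  coeff ((p ⊗ q) ⊗ r) i                             ≡⟨ coeff-⊗ (p ⊗ q) r i ⟩
  conv (coeff (p ⊗ q)) (coeff r) i                  ≡⟨ conv-cong (coeff-⊗ p q) (λ _ → refl) i ⟩
  conv (conv (coeff p) (coeff q)) (coeff r) i       ≡⟨ conv-assoc (coeff p) _ _ i ⟩
  conv (coeff p) (conv (coeff q) (coeff r)) i       ≡⟨ conv-cong {coeff p} (λ _ → refl) (sym ∘ coeff-⊗ q r) i ⟩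
  conv (coeff p) (coeff (q ⊗ r)) i                  ≡⟨ coeff-⊗ p (q ⊗ r) i ⟨
  coeff (p ⊗ (q ⊗ r)) i                             ∎
  where open ≡-Reasoning

⊗-distribʳ-⊕ : ∀ r p q → (p ⊕ q) ⊗ r ≈ p ⊗ r ⊕ q ⊗ r
⊗-distribʳ-⊕ r p q i = begin
  coeff ((p ⊕ q) ⊗ r) i
    ≡⟨ coeff-⊗ (p ⊕ q) r i ⟩
  conv (coeff (p ⊕ q)) (coeff r) i
    ≡⟨ conv-cong (λ j → trans (coeff-⊕ p q j) (cong (ℤ._+ coeff q j) (sym (ℤ.*-identityˡ (coeff p j))))) (λ _ → refl) i ⟩
  conv (λ j → 1ℤ ℤ.* coeff p j ℤ.+ coeff q j) (coeff r) i
    ≡⟨ conv-linearˡ 1ℤ (coeff p) (coeff q) (coeff r) i ⟩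
  1ℤ ℤ.* conv (coeff p) (coeff r) i ℤ.+ conv (coeff q) (coeff r) i
    ≡⟨ cong₂ ℤ._+_ (trans (ℤ.*-identityˡ _) (sym (coeff-⊗ p r i))) (sym (coeff-⊗ q r i)) ⟩
  coeff (p ⊗ r) i ℤ.+ coeff (q ⊗ r) i
    ≡⟨ coeff-⊕ (p ⊗ r) _ i ⟨
  coeff (p ⊗ r ⊕ q ⊗ r) i ∎
  where open ≡-Reasoning

⊗-identityˡ : ∀ p → 1ₚ ⊗ p ≈ p
⊗-identityˡ p zero    = trans (coeff-⊗ 1ₚ p 0) (ℤ.*-identityˡ (coeff p 0))
⊗-identityˡ p (suc i) = trans (coeff-⊗ 1ₚ p (suc i))
  (trans (cong₂ ℤ._+_ (ℤ.*-identityˡ (coeff p (suc i))) (conv-vanishes (λ _ → 0ℤ) (coeff p) i λ _ _ _ → refl))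
         (ℤ.+-identityʳ (coeff p (suc i))))

⊕-cong : ∀ {p p′ q q′} → p ≈ p′ → q ≈ q′ → p ⊕ q ≈ p′ ⊕ q′
⊕-cong {p} {p′} {q} {q′} p≈ q≈ i =
  trans (coeff-⊕ p q i) (trans (cong₂ ℤ._+_ (p≈ i) (q≈ i)) (sym (coeff-⊕ p′ q′ i)))

⊕-assoc : ∀ p q r → (p ⊕ q) ⊕ r ≈ p ⊕ (q ⊕ r)
⊕-assoc p q r i = begin
  coeff ((p ⊕ q) ⊕ r) i                       ≡⟨ trans (coeff-⊕ (p ⊕ q) r i) (cong (ℤ._+ coeff r i) (coeff-⊕ p q i)) ⟩
  coeff p i ℤ.+ coeff q i ℤ.+ coeff r i       ≡⟨ ℤ.+-assoc (coeff p i) _ _ ⟩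
  coeff p i ℤ.+ (coeff q i ℤ.+ coeff r i)     ≡⟨ trans (coeff-⊕ p (q ⊕ r) i) (cong (ℤ._+_ (coeff p i)) (coeff-⊕ q r i)) ⟨
  coeff (p ⊕ (q ⊕ r)) i                       ∎
  where open ≡-Reasoning

⊕-comm : ∀ p q → p ⊕ q ≈ q ⊕ p
⊕-comm p q i = trans (coeff-⊕ p q i) (trans (ℤ.+-comm (coeff p i) _) (sym (coeff-⊕ q p i)))

⊕-identityʳ : ∀ p → p ⊕ 0ₚ ≈ p
⊕-identityʳ p i = trans (coeff-⊕ p 0ₚ i) (ℤ.+-identityʳ _)

neg-inverseˡ : ∀ p → neg p ⊕ p ≈ 0ₚ
neg-inverseˡ p i =
  trans (coeff-⊕ (neg p) p i) (trans (cong (ℤ._+ coeff p i) (coeff-neg p i)) (ℤ.+-inverseˡ (coeff p i)))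

-- _≈_ unfolds to a function type, from which its arguments cannot be
-- inferred; hence this wrapper.
infix 4 _≋_
record _≋_ (p q : Poly) : Set where
  constructor mk
  field at : p ≈ q
open _≋_ public

polyRing : CommutativeRing 0ℓ 0ℓ
polyRing = record
  { Carrier = Poly
  ; _≈_ = _≋_
  ; _+_ = _⊕_
  ; _*_ = _⊗_
  ; -_  = neg
  ; 0#  = 0ₚ
  ; 1#  = 1ₚ
  ; isCommutativeRing = record
    { isRing = record
      { +-isAbelianGroup = record
        { isGroup = record
          { isMonoid = record
            { isSemigroup = record
              { isMagma = record
                { isEquivalence = record
                  { refl  = mk λ _ → refl
                  ; sym   = λ e → mk λ i → sym (at e i)
                  ; trans = λ e f → mk λ i → trans (at e i) (at f i)
                  }
                ; ∙-cong = λ {p} {p′} {q} {q′} e f → mk (⊕-cong {p} {p′} {q} {q′} (at e) (at f))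
                }
              ; assoc = λ p q r → mk (⊕-assoc p q r)
              }
            ; identity = (λ _ → mk λ _ → refl) , λ p → mk (⊕-identityʳ p)
            }
          ; inverse = (λ p → mk (neg-inverseˡ p)) , λ p → mk λ i → trans (⊕-comm p (neg p) i) (neg-inverseˡ p i)
          ; ⁻¹-cong = λ {p} {q} e → mk λ i → trans (coeff-neg p i) (trans (cong ℤ.-_ (at e i)) (sym (coeff-neg q i)))
          }
        ; comm = λ p q → mk (⊕-comm p q)
        }
      ; *-cong = λ {p} {p′} {q} {q′} e f → mk (⊗-cong {p} {p′} {q} {q′} (at e) (at f))
      ; *-assoc = λ p q r → mk (⊗-assoc p q r)
      ; *-identity = (λ p → mk (⊗-identityˡ p)) , λ p → mk λ i → trans (⊗-comm p 1ₚ i) (⊗-identityˡ p i)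
      ; distrib = (λ p q r → mk λ i → trans (⊗-comm p (q ⊕ r) i) (trans (⊗-distribʳ-⊕ p q r i)
                    (⊕-cong {q ⊗ p} {p ⊗ q} {r ⊗ p} {p ⊗ r} (⊗-comm q p) (⊗-comm r p) i)))
                , λ p q r → mk (⊗-distribʳ-⊕ p q r)
      }
    ; *-comm = λ p q → mk (⊗-comm p q)
    }
  }

module ℤ[t] = CommutativeRing polyRing

zero? : ∀ p → Maybe (0ₚ ≋ p)
zero? []      = just ℤ[t].refl
zero? (a ∷ p) with a ℤ.≟ 0ℤ | zero? p
... | yes refl | just 0≋p = just (mk λ { zero → refl ; (suc i) → at 0≋p i })
... | _        | _        = nothing

-- Weighted sums over subsets, in any commutative ring

module SubsetSums (R : CommutativeRing 0ℓ 0ℓ) (𝐭 : CommutativeRing.Carrier R) where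

  open CommutativeRing R
    using (Carrier; 0#; 1#; ring; setoid; commutativeSemiring; +-abelianGroup; reflexive;
           +-cong; +-congˡ; +-congʳ; *-congˡ; *-congʳ; -‿cong; -‿inverseʳ; zeroˡ; zeroʳ; distribˡ)
    renaming (_+_ to _⊞_; _*_ to _⊠_; -_ to ⊟_; _≈_ to _≅_; refl to ≅-refl; sym to ≅-sym; trans to ≅-trans;
              +-assoc to ⊞-assoc; +-comm to ⊞-comm; +-identityˡ to ⊞-identityˡ; +-identityʳ to ⊞-identityʳ;
              *-comm to ⊠-comm; *-identityˡ to ⊠-identityˡ)
  open import Algebra.Properties.Ring ring using (-‿+-comm; -0#≈0#; -1*x≈-x)
  open import Algebra.Properties.AbelianGroup +-abelianGroup using (xyx⁻¹≈y)
  open import Algebra.Solver.Ring.NaturalCoefficients.Default commutativeSemiring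
  open import Relation.Binary.Reasoning.Setoid setoid

  module _ {a} {A : Set a} where

    sum : List A → (A → Carrier) → Carrier
    sum xs f = List.foldr (λ x q → f x ⊞ q) 0# xs

    sum-cong : ∀ {f g} xs → (∀ {x} → x ∈ˡ xs → f x ≅ g x) → sum xs f ≅ sum xs g
    sum-cong []       e = ≅-refl
    sum-cong (x ∷ xs) e = +-cong (e (here refl)) (sum-cong xs (e ∘ there))

    sum-zero : ∀ {f} xs → (∀ {x} → x ∈ˡ xs → f x ≅ 0#) → sum xs f ≅ 0#
    sum-zero []       e = ≅-refl
    sum-zero (x ∷ xs) e = ≅-trans (+-cong (e (here refl)) (sum-zero xs (e ∘ there))) (⊞-identityˡ 0#)

    sum-+ : ∀ xs f g → sum xs (λ x → f x ⊞ g x) ≅ sum xs f ⊞ sum xs g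
    sum-+ []       f g = ≅-sym (⊞-identityˡ 0#)
    sum-+ (x ∷ xs) f g = ≅-trans (+-congˡ (sum-+ xs f g))
      (solve 4 (λ a b c d → (a :+ b) :+ (c :+ d) := (a :+ c) :+ (b :+ d)) ≅-refl _ _ _ _)

    sum-* : ∀ xs q f → sum xs (λ x → q ⊠ f x) ≅ q ⊠ sum xs f
    sum-* []       q f = ≅-sym (zeroʳ q)
    sum-* (x ∷ xs) q f = ≅-trans (+-congˡ (sum-* xs q f)) (≅-sym (distribˡ q _ _))

    sum-neg : ∀ xs f → sum xs (λ x → ⊟ f x) ≅ ⊟ sum xs f
    sum-neg []       f = ≅-sym -0#≈0#
    sum-neg (x ∷ xs) f = ≅-trans (+-congˡ (sum-neg xs f)) (-‿+-comm _ _)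

    sum-++ : ∀ xs ys f → sum (xs ++ ys) f ≅ sum xs f ⊞ sum ys f
    sum-++ []       ys f = ≅-sym (⊞-identityˡ _)
    sum-++ (x ∷ xs) ys f = ≅-trans (+-congˡ (sum-++ xs ys f)) (≅-sym (⊞-assoc _ _ _))

  sum-map : ∀ {a b} {A : Set a} {B : Set b} (g : A → B) xs f → sum (List.map g xs) f ≅ sum xs (f ∘ g)
  sum-map g []       f = ≅-refl
  sum-map g (x ∷ xs) f = +-congˡ (sum-map g xs f)

  sum-swap : ∀ {a b} {A : Set a} {B : Set b} (xs : List A) (ys : List B) (f : A → B → Carrier) →
             sum xs (λ x → sum ys (f x)) ≅ sum ys (λ y → sum xs (λ x → f x y))
  sum-swap []       ys f = ≅-sym (sum-zero ys λ _ → ≅-refl)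
  sum-swap (x ∷ xs) ys f = ≅-trans (+-congˡ (sum-swap xs ys f)) (≅-sym (sum-+ ys _ _))

  -- H n f is the sum of 𝐭^(n - |A|) f |A| over the subsets A of an n-element set.
  H : ℕ → (ℕ → Carrier) → Carrier
  H zero    f = f 0
  H (suc n) f = 𝐭 ⊠ H n f ⊞ H n (f ∘ suc)

  H-cong : ∀ n {f g} → (∀ {a} → a ≤ n → f a ≅ g a) → H n f ≅ H n g
  H-cong zero    e = e ≤-refl
  H-cong (suc n) e = +-cong (*-congˡ (H-cong n (e ∘ m≤n⇒m≤1+n))) (H-cong n (e ∘ s≤s))

  H-+ : ∀ n f g → H n (λ a → f a ⊞ g a) ≅ H n f ⊞ H n g
  H-+ zero    f g = ≅-refl
  H-+ (suc n) f g = ≅-trans (+-cong (*-congˡ (H-+ n f g)) (H-+ n (f ∘ suc) (g ∘ suc)))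
    (solve 5 (λ t a b c d → (t :* (a :+ b)) :+ (c :+ d) := ((t :* a) :+ c) :+ ((t :* b) :+ d)) ≅-refl _ _ _ _ _)

  H-*ˡ : ∀ n q f → H n (λ a → q ⊠ f a) ≅ q ⊠ H n f
  H-*ˡ zero    q f = ≅-refl
  H-*ˡ (suc n) q f = ≅-trans (+-cong (*-congˡ (H-*ˡ n q f)) (H-*ˡ n q (f ∘ suc)))
    (solve 4 (λ t q a b → (t :* (q :* a)) :+ (q :* b) := q :* ((t :* a) :+ b)) ≅-refl _ _ _ _)

  H-*ʳ : ∀ n q f → H n (λ a → f a ⊠ q) ≅ H n f ⊠ q
  H-*ʳ n q f = ≅-trans (H-cong n λ _ → ⊠-comm _ q) (≅-trans (H-*ˡ n q f) (⊠-comm q _))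

  H-neg : ∀ n f → H n (λ a → ⊟ f a) ≅ ⊟ H n f
  H-neg n f = ≅-trans (H-cong n λ _ → ≅-sym (-1*x≈-x _)) (≅-trans (H-*ˡ n (⊟ 1#) f) (-1*x≈-x _))

  H-zero : ∀ n → H n (λ _ → 0#) ≅ 0#
  H-zero n = ≅-trans (H-cong n λ _ → ≅-sym (zeroˡ 0#)) (≅-trans (H-*ˡ n 0# (λ _ → 0#)) (zeroˡ _))

  -- A subset of a disjoint union is a pair of subsets, and the weights multiply.
  H-∘ : ∀ m n f → H m (λ a → H n (λ b → f (a + b))) ≅ H (m + n) f
  H-∘ zero    n f = ≅-refl
  H-∘ (suc m) n f = +-cong (*-congˡ (H-∘ m n f)) (H-∘ m n (f ∘ suc))

  -- Only the full set has size n, and its weight is 1. This isolates a value that is still unknown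
  -- when all smaller ones are known.
  H-top : ∀ n {f g} → (∀ {a} → a < n → f a ≅ g a) → H n f ≅ H n g ⊞ (f n ⊞ ⊟ g n)
  H-top zero    {f} {g} e = ≅-sym (≅-trans (≅-sym (⊞-assoc _ _ _)) (xyx⁻¹≈y (g 0) (f 0)))
  H-top (suc n) {f} {g} e =
    ≅-trans (+-cong (*-congˡ (H-cong n (e ∘ s≤s))) (H-top n (e ∘ s≤s))) (≅-sym (⊞-assoc _ _ _))

  module _ (v : ℕ → Carrier) where

    -- For v a = t P(U_{a-1,a}), Z n is t Z(U_{n-1,n}), and G n s and K n s are t²
    -- times the coefficients of λ_r, s = n - r - 1, in the formulas for P and Z.
    Z : ℕ → Carrier
    Z n = H n v

    G : ℕ → ℕ → Carrier
    G x zero    = 0#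
    G x (suc s) = G x s ⊞ (𝐭 ⊠ v (x ∸ 1) ⊞ ⊟ (v (x ∸ suc s) ⊠ (v (suc s) ⊞ 𝐭 ⊠ v s)))

    K : ℕ → ℕ → Carrier
    K n zero    = 0#
    K n (suc s) = K n s ⊞ (𝐭 ⊠ Z (n ∸ 1) ⊞ ⊟ (Z (n ∸ suc s) ⊠ Z (suc s)))

    private
      HH : ℕ → ℕ → (ℕ → ℕ → Carrier) → Carrier
      HH s r f = H s (λ a → H r (f a))

      HH-cong : ∀ s r {f g} → (∀ a b → f a b ≅ g a b) → HH s r f ≅ HH s r g
      HH-cong s r e = H-cong s λ _ → H-cong r λ _ → e _ _

      HH-+ : ∀ s r f g → HH s r (λ a b → f a b ⊞ g a b) ≅ HH s r f ⊞ HH s r g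
      HH-+ s r f g = ≅-trans (H-cong s λ _ → H-+ r _ _) (H-+ s _ _)

      -- The increments of `G` sum to those of `K`. The first term depends on a + b only. The second
      -- is a product, and `v (suc a) ⊞ 𝐭 ⊠ v a` accounts for one further element, inside or outside
      -- the set, so its sum is `Z (suc s)`.
      HH-step : ∀ s r → HH s r (λ a b → 𝐭 ⊠ v (a + b) ⊞ ⊟ (v b ⊠ (v (suc a) ⊞ 𝐭 ⊠ v a)))
                      ≅ 𝐭 ⊠ Z (s + r) ⊞ ⊟ (Z r ⊠ Z (suc s))
      HH-step s r = begin
        HH s r (λ a b → 𝐭 ⊠ v (a + b) ⊞ ⊟ (v b ⊠ (v (suc a) ⊞ 𝐭 ⊠ v a)))
          ≈⟨ HH-+ s r _ _ ⟩
        HH s r (λ a b → 𝐭 ⊠ v (a + b)) ⊞ HH s r (λ a b → ⊟ (v b ⊠ (v (suc a) ⊞ 𝐭 ⊠ v a)))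
          ≈⟨ +-cong (≅-trans (H-cong s λ _ → H-*ˡ r 𝐭 _) (H-*ˡ s 𝐭 _))
                    (≅-trans (H-cong s λ _ → H-neg r _) (H-neg s _)) ⟩
        𝐭 ⊠ HH s r (λ a b → v (a + b)) ⊞ ⊟ HH s r (λ a b → v b ⊠ (v (suc a) ⊞ 𝐭 ⊠ v a))
          ≈⟨ +-cong (*-congˡ (H-∘ s r v)) (-‿cong product) ⟩
        𝐭 ⊠ Z (s + r) ⊞ ⊟ (Z r ⊠ Z (suc s)) ∎
        where
        product : HH s r (λ a b → v b ⊠ (v (suc a) ⊞ 𝐭 ⊠ v a)) ≅ Z r ⊠ Z (suc s)
        product = begin
          HH s r (λ a b → v b ⊠ (v (suc a) ⊞ 𝐭 ⊠ v a))   ≈⟨ H-cong s (λ _ → H-*ʳ r _ v) ⟩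
          H s (λ a → Z r ⊠ (v (suc a) ⊞ 𝐭 ⊠ v a))        ≈⟨ H-*ˡ s (Z r) _ ⟩
          Z r ⊠ H s (λ a → v (suc a) ⊞ 𝐭 ⊠ v a)          ≈⟨ *-congˡ (H-+ s (v ∘ suc) _) ⟩
          Z r ⊠ (H s (v ∘ suc) ⊞ H s (λ a → 𝐭 ⊠ v a))    ≈⟨ *-congˡ (⊞-comm _ _) ⟩
          Z r ⊠ (H s (λ a → 𝐭 ⊠ v a) ⊞ H s (v ∘ suc))    ≈⟨ *-congˡ (+-congʳ (H-*ˡ s 𝐭 v)) ⟩
          Z r ⊠ Z (suc s)                                ∎

      G-suc : ∀ a b → G (suc (a + b)) (suc a)
                    ≅ G (suc (a + b)) a ⊞ (𝐭 ⊠ v (a + b) ⊞ ⊟ (v b ⊠ (v (suc a) ⊞ 𝐭 ⊠ v a)))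
      G-suc a b = reflexive (cong (λ k → G (suc (a + b)) a ⊞ (𝐭 ⊠ v (a + b) ⊞ ⊟ (v k ⊠ (v (suc a) ⊞ 𝐭 ⊠ v a)))) (m+n∸m≡n a b))

    -- The induction on s moves one element from the block of size r to that of size s. In its old
    -- block a chosen element raises only the first argument of `G`; `step` is the increment that
    -- raises the second as well.
    K≅HHG : ∀ s r → K (s + r) s ≅ H s (λ a → H r (λ b → G (a + b) a))
    K≅HHG zero    r = ≅-sym (H-zero r)
    K≅HHG (suc s) r = begin
      K (suc (s + r)) s ⊞ (𝐭 ⊠ Z (s + r) ⊞ ⊟ (Z (suc (s + r) ∸ suc s) ⊠ Z (suc s)))
        ≡⟨ cong₂ (λ n k → K n s ⊞ (𝐭 ⊠ Z (s + r) ⊞ ⊟ (Z k ⊠ Z (suc s)))) (sym (+-suc s r)) (m+n∸m≡n s r) ⟩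
      K (s + suc r) s ⊞ (𝐭 ⊠ Z (s + r) ⊞ ⊟ (Z r ⊠ Z (suc s)))
        ≈⟨ +-cong (K≅HHG s (suc r)) (≅-sym (HH-step s r)) ⟩
      HH s (suc r) (λ a b → G (a + b) a) ⊞ HH s r step
        ≈⟨ +-congʳ (≅-trans (H-+ s _ _) (+-congʳ (H-*ˡ s 𝐭 _))) ⟩
      (𝐭 ⊠ HH s r (λ a b → G (a + b) a) ⊞ HH s r (λ a b → G (a + suc b) a)) ⊞ HH s r step
        ≈⟨ ⊞-assoc _ _ _ ⟩
      𝐭 ⊠ HH s r (λ a b → G (a + b) a) ⊞ (HH s r (λ a b → G (a + suc b) a) ⊞ HH s r step)
        ≈⟨ +-congˡ (≅-sym (HH-+ s r _ _)) ⟩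
      𝐭 ⊠ HH s r (λ a b → G (a + b) a) ⊞ HH s r (λ a b → G (a + suc b) a ⊞ step a b)
        ≈⟨ +-congˡ (HH-cong s r λ a b → ≅-trans
             (+-congʳ (reflexive (cong (λ n → G n a) (+-suc a b)))) (≅-sym (G-suc a b))) ⟩
      𝐭 ⊠ HH s r (λ a b → G (a + b) a) ⊞ HH s r (λ a b → G (suc (a + b)) (suc a)) ∎
      where
      step : ℕ → ℕ → Carrier
      step a b = 𝐭 ⊠ v (a + b) ⊞ ⊟ (v b ⊠ (v (suc a) ⊞ 𝐭 ⊠ v a))

    module _ (u : ℕ → Carrier) (v₀≅1 : v 0 ≅ 1#) (u₀≅v₀ : u 0 ≅ v 0) where

      -- Because v 0 = 1, the last increment of `G (suc a) (suc a)` reduces to -v (suc a), which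
      -- leaves `G (suc a) a`. This is the formula for a partition with a single class.
      u≅v+G : ∀ {m} → (∀ {a} → a < m → u (suc a) ≅ G (suc a) a) → ∀ {a} → a ≤ m → u a ≅ v a ⊞ G a a
      u≅v+G h {zero}  _  = ≅-trans u₀≅v₀ (≅-sym (⊞-identityʳ _))
      u≅v+G h {suc a} lt = ≅-sym (begin
        v (suc a) ⊞ (G (suc a) a ⊞ (𝐭 ⊠ v a ⊞ ⊟ (v (a ∸ a) ⊠ (v (suc a) ⊞ 𝐭 ⊠ v a))))
          ≈⟨ +-congˡ (+-congˡ (+-congˡ (-‿cong (≅-trans
               (*-congʳ (≅-trans (reflexive (cong v (n∸n≡0 a))) v₀≅1)) (⊠-identityˡ _))))) ⟩
        v (suc a) ⊞ (G (suc a) a ⊞ (𝐭 ⊠ v a ⊞ ⊟ (v (suc a) ⊞ 𝐭 ⊠ v a)))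
          ≈⟨ solve 4 (λ x g y n → x :+ (g :+ (y :+ n)) := g :+ ((x :+ y) :+ n)) ≅-refl _ _ _ _ ⟩
        G (suc a) a ⊞ ((v (suc a) ⊞ 𝐭 ⊠ v a) ⊞ ⊟ (v (suc a) ⊞ 𝐭 ⊠ v a))
          ≈⟨ ≅-trans (+-congˡ (-‿inverseʳ _)) (⊞-identityʳ _) ⟩
        G (suc a) a
          ≈⟨ h lt ⟨
        u (suc a) ∎)

      -- `K≅HHG m 1` describes classes of sizes m and 1. Sets without the extra element contribute
      -- `G a a`, which is u a - v a; sets with it contribute `G (suc a) a`, which is u (suc a) for
      -- a < m. The value at a = m is left open and survives as the final difference.
      Hu-step : ∀ m → (∀ {a} → a < m → u (suc a) ≅ G (suc a) a) →
                H (suc m) u ≅ K (suc m) m ⊞ (𝐭 ⊠ Z m ⊞ (u (suc m) ⊞ ⊟ G (suc m) m))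
      Hu-step m h = begin
        𝐭 ⊠ H m u ⊞ H m (u ∘ suc)
          ≈⟨ +-cong (*-congˡ (≅-trans (H-cong m (u≅v+G h)) (H-+ m v _))) (H-top m h) ⟩
        𝐭 ⊠ (Z m ⊞ H m (λ a → G a a)) ⊞ (H m (λ a → G (suc a) a) ⊞ (u (suc m) ⊞ ⊟ G (suc m) m))
          ≈⟨ solve 5 (λ t z g g′ d → (t :* (z :+ g)) :+ (g′ :+ d) := ((t :* g) :+ g′) :+ ((t :* z) :+ d)) ≅-refl _ _ _ _ _ ⟩
        (𝐭 ⊠ H m (λ a → G a a) ⊞ H m (λ a → G (suc a) a)) ⊞ (𝐭 ⊠ Z m ⊞ (u (suc m) ⊞ ⊟ G (suc m) m))
          ≈⟨ +-congʳ K≅ ⟨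
        K (suc m) m ⊞ (𝐭 ⊠ Z m ⊞ (u (suc m) ⊞ ⊟ G (suc m) m)) ∎
        where
        K≅ : K (suc m) m ≅ 𝐭 ⊠ H m (λ a → G a a) ⊞ H m (λ a → G (suc a) a)
        K≅ = begin
          K (suc m) m
            ≡⟨ cong (λ n → K n m) (+-comm 1 m) ⟩
          K (m + 1) m
            ≈⟨ K≅HHG m 1 ⟩
          H m (λ a → 𝐭 ⊠ G (a + 0) a ⊞ G (a + 1) a)
            ≈⟨ ≅-trans (H-+ m _ _) (+-congʳ (H-*ˡ m 𝐭 _)) ⟩
          𝐭 ⊠ H m (λ a → G (a + 0) a) ⊞ H m (λ a → G (a + 1) a)
            ≈⟨ +-cong (*-congˡ (H-cong m λ {a} _ → reflexive (cong (λ n → G n a) (+-identityʳ a))))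
                      (H-cong m λ {a} _ → reflexive (cong (λ n → G n a) (+-comm a 1))) ⟩
          𝐭 ⊠ H m (λ a → G a a) ⊞ H m (λ a → G (suc a) a) ∎

-- Powers of t, degree bounds and palindromic polynomials

open import Tactic.RingSolver.NonReflective (fromCommutativeRing polyRing zero?)
  using (solve; _⊜_; Κ)
  renaming (_⊕_ to _:+_; _⊗_ to _:*_; ⊝_ to :-_)

-- Were 𝐭 to unfold, the arguments of 𝐭 ⊗ p could not be inferred.
abstract
  𝐭 : Poly
  𝐭 = 0ℤ ∷ 1ₚ

  𝐭⊗ : ∀ p → 𝐭 ⊗ p ≋ 0ℤ ∷ p
  𝐭⊗ p = mk λ where
    zero    → trans (coeff-⊕ (0ℤ · p) _ 0) (trans (ℤ.+-identityʳ _) (coeff-· 0ℤ p 0))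
    (suc i) → trans (coeff-⊕ (0ℤ · p) _ (suc i))
      (trans (cong₂ ℤ._+_ (coeff-· 0ℤ p (suc i)) (⊗-identityˡ p i)) (ℤ.+-identityˡ (coeff p i)))

open SubsetSums polyRing 𝐭 public

∷-cong : ∀ {p q} a → p ≋ q → a ∷ p ≋ a ∷ q
∷-cong a e = mk λ { zero → refl ; (suc i) → at e i }

t^-cong : ∀ k {p q} → p ≋ q → t^ k · p ≋ t^ k · q
t^-cong zero    e = e
t^-cong (suc k) e = ∷-cong 0ℤ (t^-cong k e)

t^-cancel : ∀ k {p q} → t^ k · p ≋ t^ k · q → p ≋ q
t^-cancel zero    e = e
t^-cancel (suc k) e = t^-cancel k (mk λ i → at e (suc i))

t^-+ : ∀ j k p → t^ j · (t^ k · p) ≡ t^ (j + k) · p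
t^-+ zero    k p = refl
t^-+ (suc j) k p = cong (0ℤ ∷_) (t^-+ j k p)

t^-zero : ∀ k {p} → p ≋ 0ₚ → t^ k · p ≋ 0ₚ
t^-zero zero    e = e
t^-zero (suc k) e = mk λ { zero → refl ; (suc i) → at (t^-zero k e) i }

t^-⊕ : ∀ k p q → t^ k · (p ⊕ q) ≋ t^ k · p ⊕ t^ k · q
t^-⊕ zero    p q = ℤ[t].refl
t^-⊕ (suc k) p q = ∷-cong 0ℤ (t^-⊕ k p q)

t^-⊗ : ∀ k p q → (t^ k · p) ⊗ q ≋ t^ k · (p ⊗ q)
t^-⊗ zero    p q = ℤ[t].refl
t^-⊗ (suc k) p q = begin
  (0ℤ ∷ t^ k · p) ⊗ q     ≈⟨ ℤ[t].*-congʳ {q} (𝐭⊗ (t^ k · p)) ⟨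
  (𝐭 ⊗ (t^ k · p)) ⊗ q    ≈⟨ ℤ[t].*-assoc 𝐭 (t^ k · p) q ⟩
  𝐭 ⊗ ((t^ k · p) ⊗ q)    ≈⟨ 𝐭⊗ _ ⟩
  0ℤ ∷ (t^ k · p) ⊗ q     ≈⟨ ∷-cong 0ℤ (t^-⊗ k p q) ⟩
  0ℤ ∷ t^ k · (p ⊗ q)     ∎
  where open import Relation.Binary.Reasoning.Setoid ℤ[t].setoid

t^-∑ : ∀ {a} {A : Set a} k xs (f : A → Poly) → t^ k · ∑ xs f ≋ (∑[ x ∈ xs ] t^ k · f x)
t^-∑ k []       f = t^-zero k ℤ[t].refl
t^-∑ k (x ∷ xs) f = ℤ[t].trans (t^-⊕ k (f x) _) (ℤ[t].+-congˡ {t^ k · f x} (t^-∑ k xs f))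

t^-⊗ʳ : ∀ k p q → p ⊗ (t^ k · q) ≋ t^ k · (p ⊗ q)
t^-⊗ʳ k p q = ℤ[t].trans (ℤ[t].*-comm p _) (ℤ[t].trans (t^-⊗ k q p) (t^-cong k (ℤ[t].*-comm q p)))

·≋⊗ : ∀ a p → a · p ≋ (a ∷ []) ⊗ p
·≋⊗ a p = ℤ[t].sym (ℤ[t].trans
  (ℤ[t].+-congˡ {a · p} {0ℤ ∷ 0ₚ} {0ₚ} (mk λ { zero → refl ; (suc i) → refl })) (ℤ[t].+-identityʳ (a · p)))

t^-· : ∀ k a p → (t^ k · (a · p)) ≋ a · (t^ k · p)
t^-· k a p = ℤ[t].trans (t^-cong k (·≋⊗ a p)) (ℤ[t].trans (ℤ[t].sym (t^-⊗ʳ k (a ∷ []) p)) (ℤ[t].sym (·≋⊗ a _)))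

·-congˡ : ∀ a {p q} → p ≋ q → a · p ≋ a · q
·-congˡ a {p} {q} e = mk λ i → trans (coeff-· a p i) (trans (cong (ℤ._*_ a) (at e i)) (sym (coeff-· a q i)))

-- Polynomials of degree less than d / 2.
record Half (d : ℕ) (p : Poly) : Set where
  constructor half
  field high : ∀ i → d ≤ 2 * i → coeff p i ≡ 0ℤ
open Half

Half-≋ : ∀ {d p q} → p ≋ q → Half d p → Half d q
Half-≋ e h = half λ i le → trans (sym (at e i)) (high h i le)

Half-mono : ∀ {d e p} → d ≤ e → Half d p → Half e p
Half-mono d≤e h = half λ i le → high h i (≤-trans d≤e le)

Half-0 : ∀ {d} → Half d 0ₚ
Half-0 = half λ _ _ → refl

Half-⊕ : ∀ {d p q} → Half d p → Half d q → Half d (p ⊕ q)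
Half-⊕ {p = p} {q} hp hq = half λ i le →
  trans (coeff-⊕ p q i) (cong₂ ℤ._+_ (high hp i le) (high hq i le))

Half-neg : ∀ {d p} → Half d p → Half d (neg p)
Half-neg {p = p} h = half λ i le → trans (coeff-neg p i) (cong ℤ.-_ (high h i le))

Half-∑ : ∀ {a} {A : Set a} {d} {f : A → Poly} xs → (∀ {x} → x ∈ˡ xs → Half d (f x)) → Half d (∑ xs f)
Half-∑ []       h = Half-0
Half-∑ (x ∷ xs) h = Half-⊕ (h (here refl)) (Half-∑ xs (h ∘ there))

Half-t : ∀ {d p} → Half d p → Half (2 + d) (0ℤ ∷ p)
Half-t {d} h = half λ where
  zero    _  → refl
  (suc i) le → high h i (s≤s⁻¹ (s≤s⁻¹ (subst (2 + d ≤_) (cong suc (+-suc i (i + 0))) le)))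

Half-t^ : ∀ k {d p} → Half d p → Half (2 * k + d) (t^ k · p)
Half-t^ zero    h = h
Half-t^ (suc k) {d} {p} h = subst (λ e → Half (e + d) (t^ suc k · p)) (cong suc (sym (+-suc k (k + 0)))) (Half-t (Half-t^ k h))

Half-𝐭 : ∀ {d p} → Half d p → Half (2 + d) (𝐭 ⊗ p)
Half-𝐭 {p = p} h = Half-≋ (ℤ[t].sym (𝐭⊗ p)) (Half-t h)

-- Twice the degrees are at most d and less than e, so one of the two strict inequalities is enough
-- and a unit is saved.
Half-⊗ : ∀ {d e p q} → Half (suc d) p → Half e q → Half (d + e) (p ⊗ q)
Half-⊗ {d} {e} {p} {q} hp hq = half λ i le →
  trans (coeff-⊗ p q i) (conv-vanishes (coeff p) (coeff q) i λ j k eq → vanish i le j k eq)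
  where
  vanish : ∀ i → d + e ≤ 2 * i → ∀ j k → j + k ≡ i → coeff p j ℤ.* coeff q k ≡ 0ℤ
  vanish i le j k refl with suc d ≤? 2 * j | e ≤? 2 * k
  ... | yes dj | _      = trans (cong (ℤ._* coeff q k) (high hp j dj)) (ℤ.*-zeroˡ (coeff q k))
  ... | no _   | yes ek = trans (cong (ℤ._*_ (coeff p j)) (high hq k ek)) (ℤ.*-zeroʳ (coeff p j))
  ... | no ¬dj | no ¬ek = contradiction
    (subst (d + e ≤_) (*-distribˡ-+ 2 j k) le)
    (<⇒≱ (+-mono-≤-< (s≤s⁻¹ (≰⇒> ¬dj)) (≰⇒> ¬ek)))

-- The fields of Palindromic d p without subtraction of indices.
record Pal (d : ℕ) (p : Poly) : Set where
  constructor pal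
  field
    mirror : ∀ i j → i + j ≡ d → coeff p i ≡ coeff p j
    beyond : ∀ i → d < i → coeff p i ≡ 0ℤ
open Pal

Palindromic⇒Pal : ∀ {d p} → Palindromic d p → Pal d p
Palindromic⇒Pal {d} {p} (m , b) = pal
  (λ i j eq → trans (sym (m i (subst (i ≤_) eq (m≤m+n i j)))) (cong (coeff p) (trans (cong (_∸ i) (sym eq)) (m+n∸m≡n i j)))) b

Pal-≋ : ∀ {d p q} → p ≋ q → Pal d p → Pal d q
Pal-≋ e h = pal (λ i j eq → trans (sym (at e i)) (trans (mirror h i j eq) (at e j)))
                (λ i lt → trans (sym (at e i)) (beyond h i lt))

Pal-0 : ∀ {d} → Pal d 0ₚ
Pal-0 = pal (λ _ _ _ → refl) (λ _ _ → refl)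

Pal-⊕ : ∀ {d p q} → Pal d p → Pal d q → Pal d (p ⊕ q)
Pal-⊕ {p = p} {q} hp hq = pal
  (λ i j eq → trans (coeff-⊕ p q i) (trans (cong₂ ℤ._+_ (mirror hp i j eq) (mirror hq i j eq)) (sym (coeff-⊕ p q j))))
  (λ i lt → trans (coeff-⊕ p q i) (cong₂ ℤ._+_ (beyond hp i lt) (beyond hq i lt)))

Pal-· : ∀ {d p} a → Pal d p → Pal d (a · p)
Pal-· {p = p} a h = pal
  (λ i j eq → trans (coeff-· a p i) (trans (cong (ℤ._*_ a) (mirror h i j eq)) (sym (coeff-· a p j))))
  (λ i lt → trans (coeff-· a p i) (trans (cong (ℤ._*_ a) (beyond h i lt)) (ℤ.*-zeroʳ a)))

Pal-neg : ∀ {d p} → Pal d p → Pal d (neg p)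
Pal-neg = Pal-· -1ℤ

Pal-∑ : ∀ {a} {A : Set a} {d} {f : A → Poly} xs → (∀ {x} → x ∈ˡ xs → Pal d (f x)) → Pal d (∑ xs f)
Pal-∑ []       h = Pal-0
Pal-∑ (x ∷ xs) h = Pal-⊕ (h (here refl)) (Pal-∑ xs (h ∘ there))

Pal-t : ∀ {d p} → Pal d p → Pal (2 + d) (0ℤ ∷ p)
Pal-t {d} {p} h = pal mir λ { (suc i) (s≤s lt) → beyond h i (≤-trans (n≤1+n _) lt) }
  where
  mir : ∀ i j → i + j ≡ 2 + d → coeff (0ℤ ∷ p) i ≡ coeff (0ℤ ∷ p) j
  mir zero    zero    eq = refl
  mir zero    (suc j) eq = sym (beyond h j (≤-reflexive (sym (suc-injective eq))))
  mir (suc i) zero    eq = beyond h i (≤-reflexive (sym (trans (sym (+-identityʳ i)) (suc-injective eq))))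
  mir (suc i) (suc j) eq = mirror h i j (suc-injective (trans (sym (+-suc i j)) (suc-injective eq)))

Pal-t^ : ∀ k {d p} → Pal d p → Pal (2 * k + d) (t^ k · p)
Pal-t^ zero    h = h
Pal-t^ (suc k) {d} {p} h = subst (λ e → Pal (e + d) (t^ suc k · p)) (cong suc (sym (+-suc k (k + 0)))) (Pal-t (Pal-t^ k h))

Pal-𝐭 : ∀ {d p} → Pal d p → Pal (2 + d) (𝐭 ⊗ p)
Pal-𝐭 {p = p} h = Pal-≋ (ℤ[t].sym (𝐭⊗ p)) (Pal-t h)

Pal-1 : Pal 0 1ₚ
Pal-1 = pal (λ { zero zero _ → refl }) (λ { (suc i) _ → refl })

-- Reversal with respect to degree d + e cancels the shift by d and reverses q with respect to e.
t^-mirror : ∀ {e q} → Pal e q → ∀ d i j → i + j ≡ d + e → coeff (t^ d · q) i ≡ coeff q j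
t^-mirror h zero    i       j eq = mirror h i j eq
t^-mirror h (suc d) zero    j eq = sym (beyond h j (subst (_ <_) (sym eq) (s≤s (m≤n+m _ d))))
t^-mirror h (suc d) (suc i) j eq = t^-mirror h d i j (suc-injective eq)

-- Reversal exchanges the two summands.
Pal-1+t^ : ∀ d {e q} → Pal e q → Pal (d + e) (q ⊕ t^ d · q)
Pal-1+t^ d {e} {q} h = pal
  (λ i j eq → trans (coeff-⊕ q _ i) (trans (cong₂ ℤ._+_ (sym (t^-mirror h d j i (trans (+-comm j i) eq))) (t^-mirror h d i j eq))
     (trans (ℤ.+-comm (coeff (t^ d · q) j) _) (sym (coeff-⊕ q _ j)))))
  (λ i lt → trans (coeff-⊕ q _ i) (cong₂ ℤ._+_ (beyond h i (≤-<-trans (m≤n+m e d) lt)) (Existence.t^-zero d (beyond h) lt)))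

-- Splitting a (1 + t^(d+1)) off a palindromic polynomial a + t p of degree d + 1
-- leaves t times a palindromic polynomial of degree d - 1.
module _ (a : ℤ) (p : Poly) where

  remainder : ℕ → Poly
  remainder d = p ⊖ a · (t^ d · 1ₚ)

  coeff-remainder : ∀ d i → coeff (remainder d) i ≡ coeff p i ℤ.- a ℤ.* coeff (t^ d · 1ₚ) i
  coeff-remainder d i = trans (coeff-⊕ p _ i) (cong (ℤ._+_ (coeff p i))
    (trans (coeff-neg (a · (t^ d · 1ₚ)) i) (cong ℤ.-_ (coeff-· a (t^ d · 1ₚ) i))))

  remainder-low : ∀ d i j → i + suc j ≡ d → coeff (remainder d) i ≡ coeff p i
  remainder-low d i j eq = trans (coeff-remainder d i)
    (trans (cong (λ c → coeff p i ℤ.- a ℤ.* c) (t^-mirror Pal-1 d i (suc j) (trans eq (sym (+-identityʳ d)))))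
    (trans (cong (λ c → coeff p i ℤ.- c) (ℤ.*-zeroʳ a)) (ℤ.+-identityʳ (coeff p i))))

  remainder-high : ∀ d → Pal (suc d) (a ∷ p) → ∀ i → d ≤ i → coeff (remainder d) i ≡ 0ℤ
  remainder-high d h i d≤i with m≤n⇒m<n∨m≡n d≤i
  ... | inj₁ d<i = trans (coeff-remainder d i)
    (cong₂ ℤ._-_ (beyond h (suc i) (s≤s d<i))
      (trans (cong (ℤ._*_ a) (Existence.t^-zero d (beyond Pal-1) (subst (_< i) (sym (+-identityʳ d)) d<i))) (ℤ.*-zeroʳ a)))
  ... | inj₂ refl = trans (coeff-remainder d d)
    (trans (cong₂ (λ x y → x ℤ.- a ℤ.* y) (mirror h (suc d) 0 (+-identityʳ _)) (t^-mirror Pal-1 d d 0 refl))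
    (trans (cong (ℤ._-_ a) (ℤ.*-identityʳ a)) (ℤ.+-inverseʳ a)))

  split-⊗ : ∀ d q → (a ∷ p) ⊗ q ≋ a · (q ⊕ t^ suc d · q) ⊕ (0ℤ ∷ remainder d ⊗ q)
  split-⊗ d q = begin
    a · q ⊕ (0ℤ ∷ p ⊗ q)
      ≈⟨ ℤ[t].+-cong (·≋⊗ a q) (ℤ[t].sym (𝐭⊗ (p ⊗ q))) ⟩
    A ⊗ q ⊕ 𝐭 ⊗ (p ⊗ q)
      ≈⟨ solve 5 (λ A q t p T →
           ((A :* q) :+ (t :* (p :* q))) ⊜ ((A :* (q :+ (t :* (T :* q)))) :+ (t :* ((p :+ (:- (A :* T))) :* q))))
           ℤ[t].refl A q 𝐭 p (t^ d · 1ₚ) ⟩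
    A ⊗ (q ⊕ 𝐭 ⊗ ((t^ d · 1ₚ) ⊗ q)) ⊕ 𝐭 ⊗ ((p ⊖ A ⊗ (t^ d · 1ₚ)) ⊗ q)
      ≈⟨ ℤ[t].+-cong (ℤ[t].*-congˡ {A} (ℤ[t].+-congˡ {q} (ℤ[t].trans (𝐭⊗ _) (∷-cong 0ℤ (ℤ[t].trans (t^-⊗ d 1ₚ q) (t^-cong d (ℤ[t].*-identityˡ q)))))))
           (ℤ[t].trans (ℤ[t].*-congˡ {𝐭} (ℤ[t].*-congʳ {q} (ℤ[t].+-congˡ {p} (·-congˡ -1ℤ (ℤ[t].sym (·≋⊗ a (t^ d · 1ₚ))))))) (𝐭⊗ _)) ⟩
    A ⊗ (q ⊕ t^ suc d · q) ⊕ (0ℤ ∷ remainder d ⊗ q)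
      ≈⟨ ℤ[t].+-congʳ {0ℤ ∷ remainder d ⊗ q} (ℤ[t].sym (·≋⊗ a (q ⊕ t^ suc d · q))) ⟩
    a · (q ⊕ t^ suc d · q) ⊕ (0ℤ ∷ remainder d ⊗ q) ∎
    where
    open import Relation.Binary.Reasoning.Setoid ℤ[t].setoid
    A : Poly
    A = a ∷ []

-- Induction on d in steps of two, which avoids reversing a convolution: the part a (1 + t^d) of p
-- is handled by `Pal-1+t^`, and the rest is t times a palindromic polynomial for degree d - 2.
Pal-⊗ : ∀ {d e p q} → Pal d p → Pal e q → Pal (d + e) (p ⊗ q)
Pal-⊗ {p = []} hp hq = Pal-0
Pal-⊗ {zero} {p = a ∷ p} {q} hp hq = Pal-≋ (ℤ[t].trans (·≋⊗ a q)
  (ℤ[t].*-congʳ {q} {a ∷ []} {a ∷ p} (mk λ { zero → refl ; (suc i) → sym (beyond hp (suc i) z<s) }))) (Pal-· a hq)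
Pal-⊗ {suc zero} {p = a ∷ p} {q} hp hq = Pal-≋ (ℤ[t].sym (split-⊗ a p 0 q))
  (Pal-⊕ (Pal-· a (Pal-1+t^ 1 hq)) (Pal-≋ (ℤ[t].sym zero′) Pal-0))
  where
  zero′ : 0ℤ ∷ remainder a p 0 ⊗ q ≋ 0ₚ
  zero′ = ℤ[t].trans (∷-cong 0ℤ (ℤ[t].*-congʳ {q} {remainder a p 0} {0ₚ} (mk λ i → remainder-high a p 0 hp i z≤n)))
    (t^-zero 1 ℤ[t].refl)
Pal-⊗ {suc (suc d)} {p = a ∷ p} {q} hp hq = Pal-≋ (ℤ[t].sym (split-⊗ a p (suc d) q))
  (Pal-⊕ (Pal-· a (Pal-1+t^ (2 + d) hq)) (Pal-t (Pal-⊗ hr hq)))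
  where
  hr : Pal d (remainder a p (suc d))
  hr = pal
    (λ i j eq → trans (remainder-low a p (suc d) i j (trans (+-suc i j) (cong suc eq)))
      (trans (mirror hp (suc i) (suc j) (cong suc (trans (+-suc i j) (cong suc eq))))
        (sym (remainder-low a p (suc d) j i (trans (+-suc j i) (cong suc (trans (+-comm j i) eq)))))))
    (remainder-high a p (suc d) hp)

-- One of i and d - i is at least d / 2. There the degree bound gives 0, and symmetry carries it to
-- the other index.
Pal∧Half⇒0 : ∀ {d p} → Pal d p → Half d p → p ≋ 0ₚ
Pal∧Half⇒0 {d} {p} hp hh = mk λ i → go i
  where
  go : ∀ i → coeff p i ≡ 0ℤ
  go i with d ≤? 2 * i
  ... | yes le = high hh i le
  ... | no ¬le = trans (mirror hp i (d ∸ i) eq) (high hh (d ∸ i) (begin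
      d                      ≡⟨ eq ⟨
      i + (d ∸ i)            ≤⟨ +-monoˡ-≤ (d ∸ i) (<⇒≤ i<) ⟩
      (d ∸ i) + (d ∸ i)      ≡⟨ cong (d ∸ i +_) (+-identityʳ (d ∸ i)) ⟨
      2 * (d ∸ i)            ∎))
    where
    open ≤-Reasoning
    2i<d : i + i < d
    2i<d = subst (_< d) (cong (i +_) (+-identityʳ i)) (≰⇒> ¬le)
    eq : i + (d ∸ i) ≡ d
    eq = m+[n∸m]≡n (≤-trans (m≤m+n i i) (<⇒≤ 2i<d))
    i< : i < d ∸ i
    i< = +-cancelˡ-< i i (d ∸ i) (subst (i + i <_) (sym eq) 2i<d)

-- Degree of `G`, symmetry of `K`, and the relation between u and v

module _ {v : ℕ → Poly} (Half-v : ∀ x → Half (suc x) (v x)) where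

  Half-G : ∀ x s → s ≤ x → Half (2 + x) (G v x s)
  Half-G x zero    _   = Half-0
  Half-G x (suc s) s<x = Half-⊕ (Half-G x s (<⇒≤ s<x)) (Half-⊕
    (Half-mono (≤-reflexive (cong (2 +_) (suc-pred x))) (Half-𝐭 (Half-v (x ∸ 1))))
    (Half-neg (Half-mono (≤-reflexive eq) (Half-⊗ (Half-v (x ∸ suc s))
      (Half-⊕ (Half-mono (n≤1+n _) (Half-v (suc s))) (Half-𝐭 (Half-v s)))))))
    where
    instance _ = >-nonZero (≤-<-trans z≤n s<x)
    -- The 3 + s comes from `𝐭 ⊗ v s`; the total is 2 + x only thanks to the unit saved in `Half-⊗`.
    eq : x ∸ suc s + (3 + s) ≡ 2 + x
    eq = trans (trans (+-suc _ _) (cong suc (+-suc _ _))) (cong (2 +_) (m∸n+n≡m s<x))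

module _ {v : ℕ → Poly} (Pal-Z : ∀ a → Pal (2 + a) (Z v (suc a))) where

  Pal-Z′ : ∀ {a} → 0 < a → Pal (suc a) (Z v a)
  Pal-Z′ {suc a} _ = Pal-Z a

  -- Strictness keeps the indices of `Z` positive: `Z v 0` is v 0, whereas the pattern of degrees
  -- would ask for symmetry of degree 1.
  Pal-K : ∀ n s → s < n → Pal (2 + n) (K v n s)
  Pal-K n zero    _    = Pal-0
  Pal-K n (suc s) s+1<n = Pal-⊕ (Pal-K n s (<⇒≤ s+1<n)) (Pal-⊕
    (subst (λ k → Pal (2 + k) (𝐭 ⊗ Z v (n ∸ 1))) (suc-pred n)
      (Pal-𝐭 (Pal-Z′ (m<n⇒0<n∸m (≤-<-trans (s≤s z≤n) s+1<n)))))
    (Pal-neg (subst (λ k → Pal k (Z v (n ∸ suc s) ⊗ Z v (suc s))) eq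
      (Pal-⊗ (Pal-Z′ (m<n⇒0<n∸m s+1<n)) (Pal-Z s)))))
    where
    instance _ = >-nonZero (≤-<-trans z≤n s+1<n)
    eq : suc (n ∸ suc s) + (2 + s) ≡ 2 + n
    eq = cong suc (trans (+-suc _ _) (cong suc (m∸n+n≡m (<⇒≤ s+1<n))))

module _ {u v : ℕ → Poly} (v₀ : v 0 ≋ 1ₚ) (u₀ : u 0 ≋ v 0) (u₁ : u 1 ≋ 0ₚ)
         (Half-u : ∀ x → Half (2 + x) (u x)) (Half-v : ∀ x → Half (suc x) (v x))
         (Pal-Hu : ∀ m → Pal (4 + m) (H (2 + m) u)) (Pal-Z : ∀ a → Pal (2 + a) (Z v (suc a))) where

  u≋G : ∀ m → u (suc m) ≋ G v (suc m) m
  u≋G m = below (suc m) ≤-refl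
    where
    step : ∀ m → (∀ {a} → a < m → u (suc a) ≋ G v (suc a) a) → u (suc m) ≋ G v (suc m) m
    -- Separate because `H 1 u` is t, which is not palindromic for degree 3.
    step zero    _  = u₁
    step (suc m) ih = x∙y⁻¹≈ε⇒x≈y (u (2 + m)) (G v (2 + m) (suc m)) (Pal∧Half⇒0 pal-D
        (Half-⊕ (Half-u (2 + m)) (Half-neg (Half-G Half-v (2 + m) (suc m) (n≤1+n _)))))
      where
      open import Algebra.Properties.AbelianGroup ℤ[t].+-abelianGroup using (x∙y⁻¹≈ε⇒x≈y)
      D : Poly
      D = u (2 + m) ⊖ G v (2 + m) (suc m)
      D≋ : H (2 + m) u ⊖ K v (2 + m) (suc m) ⊖ 𝐭 ⊗ Z v (suc m) ≋ D
      D≋ = ℤ[t].trans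
        (ℤ[t].+-congʳ {neg (𝐭 ⊗ Z v (suc m))} (ℤ[t].+-congʳ {neg (K v (2 + m) (suc m))} (Hu-step v u v₀ u₀ (suc m) ih)))
        (solve 3 (λ k z d → (((k :+ (z :+ d)) :+ (:- k)) :+ (:- z)) ⊜ d) ℤ[t].refl
          (K v (2 + m) (suc m)) (𝐭 ⊗ Z v (suc m)) D)
      pal-D : Pal (4 + m) D
      pal-D = Pal-≋ D≋ (Pal-⊕ (Pal-⊕ (Pal-Hu m) (Pal-neg (Pal-K Pal-Z (2 + m) (suc m) ≤-refl)))
        (Pal-neg (Pal-𝐭 (Pal-Z m))))

    below : ∀ n {m} → m < n → u (suc m) ≋ G v (suc m) m
    below (suc n) {m} (s≤s m≤n) = step m λ a<m → below n (<-≤-trans a<m m≤n)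

-- Colourings of Fin n

-- A list, because `select-restrict` compares selections whose lengths agree only propositionally.
select : ∀ {c n} {C : Set c} → Subset n → Vec C n → List C
select []            []      = []
select (inside  ∷ A) (x ∷ c) = x ∷ select A c
select (outside ∷ A) (x ∷ c) = select A c

restrict : ∀ {c n} {C : Set c} (A : Subset n) → Vec C n → Vec C ∣ A ∣
restrict []            []      = []
restrict (inside  ∷ A) (x ∷ c) = x ∷ restrict A c
restrict (outside ∷ A) (x ∷ c) = restrict A c

toList-restrict : ∀ {c n} {C : Set c} (A : Subset n) (c : Vec C n) → toList (restrict A c) ≡ select A c
toList-restrict []            []      = refl
toList-restrict (inside  ∷ A) (x ∷ c) = cong (x ∷_) (toList-restrict A c)
toList-restrict (outside ∷ A) (x ∷ c) = toList-restrict A c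

select-restrict : ∀ {c n} {C : Set c} (F : Subset n) B (c : Vec C n) →
                  select (∁ B) (restrict (∁ F) c) ≡ select (∁ (embed (∁ F) B ∪ F)) c
select-restrict []            []            []      = refl
select-restrict (inside  ∷ F) B             (x ∷ c) = select-restrict F B c
select-restrict (outside ∷ F) (inside  ∷ B) (x ∷ c) = select-restrict F B c
select-restrict (outside ∷ F) (outside ∷ B) (x ∷ c) = cong (x ∷_) (select-restrict F B c)

length-select : ∀ {c n} {C : Set c} (A : Subset n) (c : Vec C n) → length (select A c) ≡ ∣ A ∣
length-select []            []      = refl
length-select (inside  ∷ A) (x ∷ c) = cong suc (length-select A c)
length-select (outside ∷ A) (x ∷ c) = length-select A c

-- F plays the contracted set, and f sees the colours of the ground set of the contraction.
selectSum : ∀ {c n} {C : Set c} → Vec C n → (List C → Poly) → Poly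
selectSum {n = n} c f = ∑[ F ∈ subsets n ] t^ ∣ F ∣ · f (select (∁ F) c)

module _ {c} {C : Set c} where

  selectSum-cong : ∀ {n} (c : Vec C n) {f g} → (∀ xs → length xs ≤ n → f xs ≋ g xs) → selectSum c f ≋ selectSum c g
  selectSum-cong {n} c e = sum-cong (subsets n) λ {F} _ →
    t^-cong ∣ F ∣ (e (select (∁ F) c) (subst (_≤ n) (sym (length-select (∁ F) c)) (∣p∣≤n (∁ F))))

  selectSum-∷ : ∀ {n} x (c : Vec C n) f →
                selectSum (x ∷ c) f ≋ 𝐭 ⊗ selectSum c f ⊕ selectSum c (f ∘ (x ∷_))
  selectSum-∷ {n} x c f = begin
    ∑ (List.map (outside ∷_) (subsets n) ++ List.map (inside ∷_) (subsets n)) term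
      ≈⟨ sum-++ (List.map (outside ∷_) (subsets n)) _ term ⟩
    ∑ (List.map (outside ∷_) (subsets n)) term ⊕ ∑ (List.map (inside ∷_) (subsets n)) term
      ≈⟨ ℤ[t].+-cong (sum-map (outside ∷_) (subsets n) term) (sum-map (inside ∷_) (subsets n) term) ⟩
    selectSum c (f ∘ (x ∷_)) ⊕ (∑[ F ∈ subsets n ] 0ℤ ∷ t^ ∣ F ∣ · f (select (∁ F) c))
      ≈⟨ ℤ[t].+-congˡ {selectSum c (f ∘ (x ∷_))} (sum-cong (subsets n) λ {F} _ → ℤ[t].sym (𝐭⊗ _)) ⟩
    selectSum c (f ∘ (x ∷_)) ⊕ (∑[ F ∈ subsets n ] 𝐭 ⊗ (t^ ∣ F ∣ · f (select (∁ F) c)))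
      ≈⟨ ℤ[t].+-congˡ {selectSum c (f ∘ (x ∷_))} (sum-* (subsets n) 𝐭 (λ F → t^ ∣ F ∣ · f (select (∁ F) c))) ⟩
    selectSum c (f ∘ (x ∷_)) ⊕ 𝐭 ⊗ selectSum c f
      ≈⟨ ℤ[t].+-comm (selectSum c (f ∘ (x ∷_))) (𝐭 ⊗ selectSum c f) ⟩
    𝐭 ⊗ selectSum c f ⊕ selectSum c (f ∘ (x ∷_)) ∎
    where
    open import Relation.Binary.Reasoning.Setoid ℤ[t].setoid
    term : Subset (suc n) → Poly
    term F = t^ ∣ F ∣ · f (select (∁ F) (x ∷ c))

  selectSum-length : ∀ {n} (c : Vec C n) f → selectSum c (f ∘ length) ≋ H n f
  selectSum-length []      f = ℤ[t].+-identityʳ (f 0)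
  selectSum-length (x ∷ c) f = ℤ[t].trans (selectSum-∷ x c (f ∘ length))
    (ℤ[t].+-cong (ℤ[t].*-congˡ {𝐭} (selectSum-length c f)) (selectSum-length c (f ∘ suc)))

  selectSum-⊖ : ∀ {n} (c : Vec C n) f g → selectSum c (λ xs → f xs ⊖ g xs) ≋ selectSum c f ⊖ selectSum c g
  selectSum-⊖ {n} c f g = begin
    selectSum c (λ xs → f xs ⊖ g xs)
      ≈⟨ sum-cong (subsets n) (λ {F} _ → ℤ[t].trans (t^-⊕ ∣ F ∣ (f (select (∁ F) c)) _)
           (ℤ[t].+-congˡ {t^ ∣ F ∣ · f (select (∁ F) c)} (t^-· ∣ F ∣ -1ℤ (g (select (∁ F) c))))) ⟩
    (∑[ F ∈ subsets n ] t^ ∣ F ∣ · f (select (∁ F) c) ⊖ t^ ∣ F ∣ · g (select (∁ F) c))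
      ≈⟨ sum-+ (subsets n) (λ F → t^ ∣ F ∣ · f (select (∁ F) c)) (λ F → neg (t^ ∣ F ∣ · g (select (∁ F) c))) ⟩
    selectSum c f ⊕ (∑[ F ∈ subsets n ] neg (t^ ∣ F ∣ · g (select (∁ F) c)))
      ≈⟨ ℤ[t].+-congˡ {selectSum c f} (sum-neg (subsets n) (λ F → t^ ∣ F ∣ · g (select (∁ F) c))) ⟩
    selectSum c f ⊖ selectSum c g ∎
    where open import Relation.Binary.Reasoning.Setoid ℤ[t].setoid

  selectSum-∑ : ∀ {a} {A : Set a} {n} (c : Vec C n) ys (f : A → List C → Poly) →
                selectSum c (λ xs → ∑[ y ∈ ys ] f y xs) ≋ (∑[ y ∈ ys ] selectSum c (f y))
  selectSum-∑ {n = n} c ys f = ℤ[t].trans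
    (sum-cong (subsets n) λ {F} _ → t^-∑ ∣ F ∣ ys (λ y → f y (select (∁ F) c)))
    (sum-swap (subsets n) ys (λ F y → t^ ∣ F ∣ · f y (select (∁ F) c)))

module Colours {c} {C : Set c} (_≟_ : DecidableEquality C) where

  hits misses : C → List C → ℕ
  hits   j xs = length (filter (j ≟_) xs)
  misses j xs = length (filter (¬? ∘ (j ≟_)) xs)

  hits+misses : ∀ j xs → hits j xs + misses j xs ≡ length xs
  hits+misses j []       = refl
  hits+misses j (x ∷ xs) with j ≟ x
  ... | yes _ = cong suc (hits+misses j xs)
  ... | no  _ = trans (+-suc _ _) (cong suc (hits+misses j xs))

  -- The elements of colour j and those of other colours are chosen independently.
  selectSum-hits : ∀ {n} j (c : Vec C n) (f : ℕ → ℕ → Poly) →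
    selectSum c (λ xs → f (hits j xs) (misses j xs)) ≋ H (hits j (toList c)) (λ a → H (misses j (toList c)) (f a))
  selectSum-hits j []      f = ℤ[t].+-identityʳ (f 0 0)
  selectSum-hits {suc n} j (x ∷ c) f = ℤ[t].trans (selectSum-∷ x c (λ xs → f (hits j xs) (misses j xs))) head
    where
    h m : ℕ
    h = hits j (toList c)
    m = misses j (toList c)
    head : 𝐭 ⊗ selectSum c (λ xs → f (hits j xs) (misses j xs)) ⊕ selectSum c (λ xs → f (hits j (x ∷ xs)) (misses j (x ∷ xs)))
         ≋ H (hits j (x ∷ toList c)) (λ a → H (misses j (x ∷ toList c)) (f a))
    head with j ≟ x
    ... | yes _ = ℤ[t].+-cong (ℤ[t].*-congˡ {𝐭} (selectSum-hits j c f)) (selectSum-hits j c (λ a → f (suc a)))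
    ... | no  _ = ℤ[t].trans
      (ℤ[t].+-cong (ℤ[t].*-congˡ {𝐭} (selectSum-hits j c f)) (selectSum-hits j c (λ a b → f a (suc b))))
      (ℤ[t].sym (ℤ[t].trans (H-+ h (λ a → 𝐭 ⊗ H m (f a)) (λ a → H m (λ b → f a (suc b))))
        (ℤ[t].+-congʳ {H h (λ a → H m (λ b → f a (suc b)))} (H-*ˡ h 𝐭 (λ a → H m (f a))))))

sum-filter : ∀ {a p} {A : Set a} {Q : A → Set p} (Q? : ∀ x → Dec (Q x)) xs {f} →
             (∀ x → ¬ Q x → f x ≋ 0ₚ) → ∑ (filter Q? xs) f ≋ ∑ xs f
sum-filter Q? []       h = ℤ[t].refl
sum-filter Q? (x ∷ xs) {f} h with Q? x
... | yes _ = ℤ[t].+-congˡ {f x} (sum-filter Q? xs h)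
... | no ¬q = ℤ[t].trans (sum-filter Q? xs h) (ℤ[t].sym (ℤ[t].+-congʳ {∑ xs f} (h x ¬q)))

embed-⊥ : ∀ {n} (A : Subset n) → embed A ⊥ ≡ ⊥
embed-⊥ []            = refl
embed-⊥ (inside  ∷ A) = cong (outside ∷_) (embed-⊥ A)
embed-⊥ (outside ∷ A) = cong (outside ∷_) (embed-⊥ A)

embed-⁅⁆ : ∀ {n} (A : Subset n) {e} → e ∈ A → ∃[ e′ ] embed A ⁅ e′ ⁆ ≡ ⁅ e ⁆
embed-⁅⁆ (inside  ∷ A) Vec.here        = zero , cong (inside ∷_) (embed-⊥ A)
embed-⁅⁆ (inside  ∷ A) (Vec.there e∈A) with e′ , eq ← embed-⁅⁆ A e∈A = suc e′ , cong (outside ∷_) eq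
embed-⁅⁆ (outside ∷ A) (Vec.there e∈A) with e′ , eq ← embed-⁅⁆ A e∈A = e′ , cong (outside ∷_) eq

∣embed∁∪∣ : ∀ {n} (F : Subset n) B → ∣ embed (∁ F) B ∪ F ∣ ≡ ∣ B ∣ + ∣ F ∣
∣embed∁∪∣ []            []            = refl
∣embed∁∪∣ (inside  ∷ F) B             = trans (cong suc (∣embed∁∪∣ F B)) (sym (+-suc ∣ B ∣ ∣ F ∣))
∣embed∁∪∣ (outside ∷ F) (inside  ∷ B) = cong suc (∣embed∁∪∣ F B)
∣embed∁∪∣ (outside ∷ F) (outside ∷ B) = ∣embed∁∪∣ F B

loopless-contraction⇒flat : ∀ {n} (M : Matroid n) F → Loopless (M / F) → IsFlat M F
loopless-contraction⇒flat M F ℓ e e∉F with e′ , eq ← embed-⁅⁆ (∁ F) (x∉p⇒x∈∁p e∉F) =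
  ≰⇒> λ le → ℓ e′ (m≤n⇒m∸n≡0 (subst (λ A → rk M A ≤ rk M F) (trans (∪-comm F ⁅ e ⁆) (cong (_∪ F) (sym eq))) le))

≐⇒≈ᴹ : ∀ {n} (M N : Matroid n) → (∀ B → rk M B ≡ rk N B) → M ≈ᴹ N
≐⇒≈ᴹ M N eq = refl , λ B → trans (eq B) (cong (rk N) (sym (cast-is-id refl B)))

rank-U : ∀ {k n} → k ≤ n → rank (U k n) ≡ k
rank-U {k} {n} k≤n = trans (cong (k ⊓_) (∣⊤∣≡n n)) (m≤n⇒m⊓n≡m k≤n)

U-loopless : ∀ {k n} → 0 < k → Loopless (U k n)
U-loopless {suc k} 0<k e eq with () ← trans (sym (cong (suc k ⊓_) (∣⁅x⁆∣≡1 e))) eq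

U₀-loops : ∀ {n} → ¬ Loopless (U 0 (suc n))
U₀-loops ℓ = ℓ zero refl

U/ : ∀ {n} k (F : Subset n) → U k n / F ≈ᴹ U (k ∸ ∣ F ∣) ∣ ∁ F ∣
U/ {n} k F = ≐⇒≈ᴹ (U k n / F) (U (k ∸ ∣ F ∣) ∣ ∁ F ∣) λ B →
  trans (cong (λ m → k ⊓ m ∸ k ⊓ ∣ F ∣) (∣embed∁∪∣ F B)) (lemma ∣ B ∣ ∣ F ∣)
  where
  lemma : ∀ b f → k ⊓ (b + f) ∸ k ⊓ f ≡ (k ∸ f) ⊓ b
  lemma b f with ≤-total k f
  ... | inj₁ k≤f rewrite m≤n⇒m⊓n≡m k≤f | m≤n⇒m∸n≡0 k≤f = m≤n⇒m∸n≡0 (m⊓n≤m k (b + f))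
  ... | inj₂ f≤k rewrite m≥n⇒m⊓n≡n f≤k =
    trans (∸-distribʳ-⊓ f k (b + f)) (cong ((k ∸ f) ⊓_) (m+n∸n≡m b f))

-- Uniform matroids

module _ (P : ∀ {n} → Matroid n → Poly) (KL : IsKazhdanLusztig P) where

  open IsKazhdanLusztig KL

  contractionTerm : ∀ {n} → Matroid n → Subset n → Poly
  contractionTerm M F = t^ rk M F · P (M / F)

  -- If F is not a flat, then M / F has a loop and its polynomial is 0.
  Z-of≋∑ : ∀ {n} (M : Matroid n) → Loopless M → Z-of P M ≋ ∑ (subsets n) (contractionTerm M)
  Z-of≋∑ {n} M ℓ = ℤ[t].trans (ℤ[t].reflexive (Existence.if-yes (loopless? M) ℓ))
    (sum-filter (flat? M) (subsets n) λ F ¬flat →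
      t^-zero (rk M F) (mk (loops (M / F) (¬flat ∘ loopless-contraction⇒flat M F))))

  Z-of-loops : ∀ {n} (M : Matroid n) → ¬ Loopless M → Z-of P M ≋ 0ₚ
  Z-of-loops M ¬ℓ = ℤ[t].reflexive (Existence.if-no (loopless? M) ¬ℓ)

  -- t^j P(U_{x-j,x}); the value at 0 stands for t^j · t^(-j), which makes
  -- t^j Z(U_{n-j,n}) equal to H n (w j).
  w : ℕ → ℕ → Poly
  w j zero    = 1ₚ
  w j (suc x) = t^ j · P (U (suc x ∸ j) (suc x))

  -- The truncated rank is 0 on a nonempty ground set, so every element is a loop.
  w-zero : ∀ j x → suc x ≤ j → w j (suc x) ≋ 0ₚ
  w-zero j x x<j rewrite m≤n⇒m∸n≡0 x<j = t^-zero j (mk (loops (U 0 (suc x)) U₀-loops))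

  -- The index is positive because of x = 0: the constant 1 has degree less than j / 2 only for j >
  -- 0.
  Half-w : ∀ j x → Half (suc j + x) (w (suc j) x)
  Half-w j zero = half λ { (suc i) _ → refl }
  Half-w j (suc x) with suc x ≤? suc j
  ... | yes x≤j = Half-≋ (ℤ[t].sym (w-zero (suc j) x x≤j)) Half-0
  ... | no  x≰j = subst (λ d → Half d (w (suc j) (suc x))) eq (Half-t^ (suc j) (half λ i le →
          degree (U k (suc x)) (U-loopless 0<k) (subst (0 <_) (sym r≡k) 0<k) i (subst (_≤ 2 * i) (sym r≡k) le)))
    where
    k : ℕ
    k = x ∸ j
    0<k : 0 < k
    0<k = m<n⇒0<n∸m (s≤s⁻¹ (≰⇒> x≰j))
    r≡k : rank (U k (suc x)) ≡ k
    r≡k = rank-U (m∸n≤m (suc x) (suc j))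
    eq : 2 * suc j + k ≡ suc j + suc x
    eq = trans (cong (λ z → suc j + z + k) (+-identityʳ (suc j))) (trans (+-assoc (suc j) (suc j) k)
      (cong (suc j +_) (cong suc (m+[n∸m]≡n {j} {x} (<⇒≤ (s≤s⁻¹ (≰⇒> x≰j)))))))

  -- Let x be the size of the complement of F. For x > j the set F is independent and the exponents
  -- agree. For 0 < x ≤ j both sides vanish. For x = 0 the exponent is j + (n - j) = |F|, which
  -- dictates the value 1 of `w j 0`.
  uniformTerm : ∀ {n} j → j ≤ n → (F : Subset n) →
                t^ j · contractionTerm (U (n ∸ j) n) F ≋ t^ ∣ F ∣ · w j ∣ ∁ F ∣
  uniformTerm {n} j j≤n F = ℤ[t].trans (t^-cong j (t^-cong r (mk (respects _ (U (∣ ∁ F ∣ ∸ j) ∣ ∁ F ∣) U/F))))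
    (ℤ[t].trans (ℤ[t].reflexive (t^-+ j r _)) (go ∣ ∁ F ∣ (∣∁p∣≡n∸∣p∣ F)))
    where
    f r : ℕ
    f = ∣ F ∣
    r = (n ∸ j) ⊓ f
    f≤n : f ≤ n
    f≤n = ∣p∣≤n F
    U/F : U (n ∸ j) n / F ≈ᴹ U (∣ ∁ F ∣ ∸ j) ∣ ∁ F ∣
    U/F = subst (λ k → U (n ∸ j) n / F ≈ᴹ U k ∣ ∁ F ∣)
      (trans (∸-+-assoc n j f) (trans (cong (n ∸_) (+-comm j f)) (trans (sym (∸-+-assoc n f j)) (cong (_∸ j) (sym (∣∁p∣≡n∸∣p∣ F))))))
      (U/ (n ∸ j) F)
    go : ∀ x → x ≡ n ∸ f → t^ (j + r) · P (U (x ∸ j) x) ≋ t^ f · w j x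
    go zero eq = ℤ[t].trans (t^-cong (j + r) (mk (rank-zero (U (0 ∸ j) 0) (λ ()) (n≤0⇒n≡0 (m⊓n≤n (0 ∸ j) 0)))))
        (ℤ[t].reflexive (cong (λ k → t^ k · 1ₚ) (trans (cong (j +_) (m≤n⇒m⊓n≡m (≤-trans (m∸n≤m n j) n≤f)))
          (trans (m+[n∸m]≡n j≤n) (≤-antisym n≤f f≤n)))))
      where
      n≤f : n ≤ f
      n≤f = m∸n≡0⇒m≤n (sym eq)
    go (suc x) eq with suc x ≤? j
    ... | yes x≤j = ℤ[t].trans
      (t^-zero (j + r) (ℤ[t].trans (ℤ[t].reflexive (cong (λ k → P (U k (suc x))) (m≤n⇒m∸n≡0 x≤j))) (mk (loops (U 0 (suc x)) U₀-loops))))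
      (ℤ[t].sym (t^-zero f (w-zero j x x≤j)))
    ... | no  x≰j = ℤ[t].reflexive (trans
        (cong (λ k → t^ k · P (U (suc x ∸ j) (suc x))) (trans (cong (j +_) (m≥n⇒m⊓n≡n f≤n∸j)) (+-comm j f)))
        (sym (t^-+ f j _)))
      where
      f≤n∸j : f ≤ n ∸ j
      f≤n∸j = begin
        f                  ≡⟨ m∸[m∸n]≡n f≤n ⟨
        n ∸ (n ∸ f)        ≤⟨ ∸-monoʳ-≤ n (subst (j ≤_) eq (≰⇒≥ x≰j)) ⟩
        n ∸ j              ∎
        where open ≤-Reasoning

  Z-uniform : ∀ {n} j → j < n → t^ j · Z-of P (U (n ∸ j) n) ≋ H n (w j)
  Z-uniform {n} j j<n = begin
    t^ j · Z-of P (U (n ∸ j) n)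
      ≈⟨ t^-cong j (Z-of≋∑ (U (n ∸ j) n) (U-loopless (m<n⇒0<n∸m j<n))) ⟩
    t^ j · ∑ (subsets n) (contractionTerm (U (n ∸ j) n))
      ≈⟨ t^-∑ j (subsets n) _ ⟩
    (∑[ F ∈ subsets n ] t^ j · contractionTerm (U (n ∸ j) n) F)
      ≈⟨ sum-cong (subsets n) (λ {F} _ → uniformTerm j (<⇒≤ j<n) F) ⟩
    (∑[ F ∈ subsets n ] t^ ∣ F ∣ · w j ∣ ∁ F ∣)
      ≈⟨ sum-cong (subsets n) (λ {F} _ → ℤ[t].reflexive (cong (λ x → t^ ∣ F ∣ · w j x) (sym (length-select (∁ F) c)))) ⟩
    selectSum c (w j ∘ length)
      ≈⟨ selectSum-length c (w j) ⟩
    H n (w j) ∎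
    where
    open import Relation.Binary.Reasoning.Setoid ℤ[t].setoid
    -- A dummy colouring, so that `selectSum-length` applies.
    c = Vec.replicate n tt

  Pal-Hw : ∀ j {n} → j < n → Pal (j + n) (H n (w j))
  Pal-Hw j {n} j<n = subst (λ d → Pal d (H n (w j))) eq (Pal-≋ (Z-uniform j j<n)
    (Pal-t^ j (Palindromic⇒Pal (palindromic (U (n ∸ j) n) (U-loopless (m<n⇒0<n∸m j<n))))))
    where
    eq : 2 * j + rank (U (n ∸ j) n) ≡ j + n
    eq = trans (cong₂ _+_ (cong (j +_) (+-identityʳ j)) (rank-U (m∸n≤m n j)))
      (trans (+-assoc j j (n ∸ j)) (cong (j +_) (m+[n∸m]≡n (<⇒≤ j<n))))

  u v : ℕ → Poly
  u = w 2
  v = w 1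

  Half-v : ∀ x → Half (suc x) (v x)
  Half-v = Half-w 0

  Half-u : ∀ x → Half (2 + x) (u x)
  Half-u = Half-w 1

  v₁≋0 : v 1 ≋ 0ₚ
  v₁≋0 = w-zero 1 0 ≤-refl

  Z₁≋𝐭 : Z v 1 ≋ 𝐭
  Z₁≋𝐭 = ℤ[t].trans (ℤ[t].+-cong (ℤ[t].*-identityʳ 𝐭) v₁≋0) (ℤ[t].+-identityʳ 𝐭)

  -- U_{0,1} has a loop, so a = 0 cannot come from `Pal-Hw`. There the sum is t, palindromic for
  -- degree 2 although the Z-polynomial itself is 0.
  Pal-Z : ∀ a → Pal (2 + a) (Z v (suc a))
  Pal-Z zero    = Pal-⊕ (Pal-𝐭 Pal-1) (Pal-≋ (ℤ[t].sym v₁≋0) Pal-0)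
  Pal-Z (suc a) = Pal-Hw 1 (s≤s (s≤s z≤n))

  Pal-Hu : ∀ m → Pal (4 + m) (H (2 + m) u)
  Pal-Hu zero = Pal-≋ (ℤ[t].sym H₂u) (Pal-𝐭 (Pal-𝐭 Pal-1))
    where
    H₂u : H 2 u ≋ 𝐭 ⊗ (𝐭 ⊗ 1ₚ)
    H₂u = ℤ[t].trans
      (ℤ[t].+-cong
        (ℤ[t].*-congˡ {𝐭} (ℤ[t].+-congˡ {𝐭 ⊗ 1ₚ} (w-zero 2 0 (s≤s z≤n))))
        (ℤ[t].+-cong (ℤ[t].*-congˡ {𝐭} (w-zero 2 0 (s≤s z≤n))) (w-zero 2 1 ≤-refl)))
      (solve 2 (λ t o → ((t :* ((t :* o) :+ Κ 0ₚ)) :+ ((t :* Κ 0ₚ) :+ Κ 0ₚ)) ⊜ (t :* (t :* o))) ℤ[t].refl 𝐭 1ₚ)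
  Pal-Hu (suc m) = Pal-Hw 2 (s≤s (s≤s (s≤s z≤n)))

  u≋Gv : ∀ m → u (suc m) ≋ G v (suc m) m
  u≋Gv = u≋G ℤ[t].refl ℤ[t].refl (w-zero 2 0 (s≤s z≤n)) Half-u Half-v Pal-Hu Pal-Z

  u≋v⊕G : ∀ m → u m ≋ v m ⊕ G v m m
  u≋v⊕G m = u≅v+G v u ℤ[t].refl ℤ[t].refl (λ {a} _ → u≋Gv a) {m} ≤-refl

  -- The sums of the theorem begin at a = 2, while `G` also has a summand for a = 1. It vanishes
  -- since v 1 = 0 and v 0 = 1, which reconciles the s increments of `G` with the factor s - 1 = n -
  -- r - 2.
  G₁≋0 : ∀ x → G v x 1 ≋ 0ₚ
  G₁≋0 x = ℤ[t].trans
    (ℤ[t].+-congˡ {𝐭 ⊗ v (x ∸ 1)} (ℤ[t].-‿cong (ℤ[t].*-congˡ {v (x ∸ 1)} (ℤ[t].+-congʳ {𝐭 ⊗ 1ₚ} v₁≋0))))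
    (solve 2 (λ t z → ((t :* z) :+ (:- (z :* (Κ 0ₚ :+ (t :* Κ 1ₚ))))) ⊜ Κ 0ₚ) ℤ[t].refl 𝐭 (v (x ∸ 1)))

sum-single : ∀ {a} {A : Set a} {xs : List A} {y} {f : A → Poly} → Unique xs → y ∈ˡ xs →
             (∀ {x} → x ≢ y → f x ≋ 0ₚ) → ∑ xs f ≋ f y
sum-single {xs = x ∷ xs} {f = f} (x∉ ∷ _) (here refl) h = ℤ[t].trans
  (ℤ[t].+-congˡ {f x} (sum-zero xs λ z∈ → h λ z≡x → All.lookup x∉ z∈ (sym z≡x)))
  (ℤ[t].+-identityʳ (f x))
sum-single {xs = x ∷ xs} {y} {f} (x∉ ∷ uniq) (there y∈) h =
  ℤ[t].+-cong (h (All.lookup x∉ y∈)) (sum-single {xs = xs} uniq y∈ h)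

select-∁⊥ : ∀ {c n} {C : Set c} (c : Vec C n) → select (∁ ⊥) c ≡ toList c
select-∁⊥ []      = refl
select-∁⊥ (x ∷ c) = cong (x ∷_) (select-∁⊥ c)

select-∁⊤ : ∀ {c n} {C : Set c} (c : Vec C n) → select (∁ ⊤) c ≡ []
select-∁⊤ []      = refl
select-∁⊤ (x ∷ c) = select-∁⊤ c

select-⊆ : ∀ {c n} {C : Set c} A (c : Vec C n) {x} → x ∈ˡ select A c → x ∈ˡ toList c
select-⊆ []            []      ()
select-⊆ (inside  ∷ A) (y ∷ c) (here eq)  = here eq
select-⊆ (inside  ∷ A) (y ∷ c) (there x∈) = there (select-⊆ A c x∈)
select-⊆ (outside ∷ A) (y ∷ c) x∈         = there (select-⊆ A c x∈)

toList-↭-select : ∀ {c n} {C : Set c} (c : Vec C n) e → toList c ↭ Vec.lookup c e ∷ select (∁ ⁅ e ⁆) c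
toList-↭-select (x ∷ c) zero    = prep x (subst (toList c ↭_) (sym (select-∁⊥ c)) ↭-refl)
toList-↭-select (x ∷ c) (suc e) = ↭-trans (prep x (toList-↭-select c e)) (swap x (Vec.lookup c e) ↭-refl)

-- Matroids presented by a colouring

module _ {C : Set} (_≟_ : DecidableEquality C) where

  open Colours _≟_

  -- min 2 (number of colours)
  ν : List C → ℕ
  ν []       = 0
  ν (x ∷ xs) = if does (All.all? (x ≟_) xs) then 1 else 2

  ν-mono : ∀ {x xs} → All (x ≡_) xs → ν (x ∷ xs) ≡ 1
  ν-mono {x} {xs} h = Existence.if-yes (All.all? (x ≟_) xs) h

  ν-poly : ∀ {x xs} → ¬ All (x ≡_) xs → ν (x ∷ xs) ≡ 2
  ν-poly {x} {xs} h = Existence.if-no (All.all? (x ≟_) xs) h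

  ν≡1⇒mono : ∀ xs → ν xs ≡ 1 → ∃[ y ] y ∈ˡ xs × All (y ≡_) xs
  ν≡1⇒mono (x ∷ xs) eq with All.all? (x ≟_) xs
  ... | yes h = x , here refl , refl ∷ h

  mono⇒ν≡1 : ∀ {y x} xs → All (y ≡_) (x ∷ xs) → ν (x ∷ xs) ≡ 1
  mono⇒ν≡1 xs (refl ∷ h) = ν-mono h

  ν≡2⇒¬mono : ∀ {y} xs → ν xs ≡ 2 → ¬ All (y ≡_) xs
  ν≡2⇒¬mono (x ∷ xs) ν≡2 h with () ← trans (sym ν≡2) (mono⇒ν≡1 xs h)

  hits-mono : ∀ {y xs} → All (y ≡_) xs → hits y xs ≡ length xs
  hits-mono {y} h = cong length (List.filter-all (y ≟_) h)

  hits-other : ∀ {y j xs} → All (y ≡_) xs → j ≢ y → hits j xs ≡ 0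
  hits-other {y} {j} h j≢y = cong length (List.filter-none (j ≟_) (All.map (λ y≡x j≡x → j≢y (trans j≡x (sym y≡x))) h))

  hits<length : ∀ j xs → ν xs ≡ 2 → hits j xs < length xs
  hits<length j xs ν≡2 = List.filter-notAll (j ≟_) xs (¬All⇒Any¬ (j ≟_) xs (ν≡2⇒¬mono xs ν≡2))

  -- The nullity of A is ν (c) minus the number of colours, capped at 2, of the
  -- complement of A; for corank 2 this says that the classes of c are the
  -- parallel classes of the dual matroid.
  Presents : ∀ {n} → Vec C n → Matroid n → Set
  Presents c M = ∀ A → rk M A + ν (toList c) ≡ ∣ A ∣ + ν (select (∁ A) c)

  -- This is the defining equation at `embed (∁ F) B ∪ F` minus the one at F.
  Presents-/ : ∀ {n} {c : Vec C n} {M} → Presents c M → ∀ F → Presents (restrict (∁ F) c) (M / F)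
  Presents-/ {c = c} {M} h F B = +-cancelʳ-≡ (y + ν (toList c)) _ _ (begin
    (x ∸ y) + ν (toList (restrict (∁ F) c)) + (y + ν (toList c))
      ≡⟨ cong (λ l → (x ∸ y) + ν l + (y + ν (toList c))) (toList-restrict (∁ F) c) ⟩
    (x ∸ y) + ν (select (∁ F) c) + (y + ν (toList c))
      ≡⟨ interchange (x ∸ y) _ y _ ⟩
    (x ∸ y) + y + (ν (select (∁ F) c) + ν (toList c))
      ≡⟨ cong₂ _+_ (m∸n+n≡m (rk-mono M (q⊆p∪q (embed (∁ F) B) F))) (+-comm (ν (select (∁ F) c)) _) ⟩
    x + (ν (toList c) + ν (select (∁ F) c))
      ≡⟨ sym (+-assoc x _ _) ⟩
    x + ν (toList c) + ν (select (∁ F) c)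
      ≡⟨ cong (_+ ν (select (∁ F) c)) (h (embed (∁ F) B ∪ F)) ⟩
    ∣ embed (∁ F) B ∪ F ∣ + ν (select (∁ (embed (∁ F) B ∪ F)) c) + ν (select (∁ F) c)
      ≡⟨ cong₂ (λ m l → m + ν l + ν (select (∁ F) c)) (∣embed∁∪∣ F B) (sym (select-restrict F B c)) ⟩
    ∣ B ∣ + ∣ F ∣ + ν (select (∁ B) (restrict (∁ F) c)) + ν (select (∁ F) c)
      ≡⟨ +-assoc (∣ B ∣ + ∣ F ∣) _ _ ⟩
    ∣ B ∣ + ∣ F ∣ + (ν (select (∁ B) (restrict (∁ F) c)) + ν (select (∁ F) c))
      ≡⟨ interchange ∣ B ∣ _ _ _ ⟩
    ∣ B ∣ + ν (select (∁ B) (restrict (∁ F) c)) + (∣ F ∣ + ν (select (∁ F) c))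
      ≡⟨ cong (∣ B ∣ + ν (select (∁ B) (restrict (∁ F) c)) +_) (sym (h F)) ⟩
    ∣ B ∣ + ν (select (∁ B) (restrict (∁ F) c)) + (y + ν (toList c)) ∎)
    where
    open ≡-Reasoning
    open CommutativeSemigroup +-commutativeSemigroup using (interchange)
    x y : ℕ
    x = rk M (embed (∁ F) B ∪ F)
    y = rk M F

  module _ {n} {c : Vec C n} {M : Matroid n} (h : Presents c M) where

    rank-Presents : rank M + ν (toList c) ≡ n
    rank-Presents = trans (h ⊤) (trans (cong₂ _+_ (∣⊤∣≡n n) (cong ν (select-∁⊤ c))) (+-identityʳ n))

    -- With one colour, ν is 1 on every nonempty selection, so every proper subset is independent.
    mono⇒uniform : ∀ {x} → All (x ≡_) (toList c) → ∀ A → rk M A ≡ (n ∸ 1) ⊓ ∣ A ∣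
    mono⇒uniform {x} mono A = +-cancelʳ-≡ (1 ⊓ n) _ _ (begin
      rk M A + (1 ⊓ n)
        ≡⟨ cong (rk M A +_) (trans (cong (1 ⊓_) (sym (length-toList c))) (sym (ν≡1⊓length _ (All.lookup mono)))) ⟩
      rk M A + ν (toList c)
        ≡⟨ h A ⟩
      ∣ A ∣ + ν (select (∁ A) c)
        ≡⟨ cong (∣ A ∣ +_) (ν≡1⊓length _ λ y∈ → All.lookup mono (select-⊆ (∁ A) c y∈)) ⟩
      ∣ A ∣ + (1 ⊓ length (select (∁ A) c))
        ≡⟨ cong (λ k → ∣ A ∣ + (1 ⊓ k)) (trans (length-select (∁ A) c) (∣∁p∣≡n∸∣p∣ A)) ⟩
      ∣ A ∣ + (1 ⊓ (n ∸ ∣ A ∣))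
        ≡⟨ lemma n ∣ A ∣ (∣p∣≤n A) ⟩
      (n ∸ 1) ⊓ ∣ A ∣ + (1 ⊓ n) ∎)
      where
      open ≡-Reasoning
      ν≡1⊓length : ∀ xs → (∀ {y} → y ∈ˡ xs → x ≡ y) → ν xs ≡ 1 ⊓ length xs
      ν≡1⊓length []       same = refl
      ν≡1⊓length (z ∷ xs) same = mono⇒ν≡1 xs (All.tabulate same)
      lemma : ∀ n a → a ≤ n → a + (1 ⊓ (n ∸ a)) ≡ (n ∸ 1) ⊓ a + (1 ⊓ n)
      lemma zero    zero a≤n = refl
      lemma (suc n) a    a≤1+n with m≤n⇒m<n∨m≡n a≤1+n
      ... | inj₁ a≤n  = cong₂ _+_ (sym (m≥n⇒m⊓n≡n (s≤s⁻¹ a≤n))) (m≤n⇒m⊓n≡m (m<n⇒0<n∸m a≤n))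
      ... | inj₂ refl = trans (cong (λ k → suc n + (1 ⊓ k)) (n∸n≡0 n))
        (trans (+-identityʳ (suc n)) (trans (+-comm 1 n) (cong (_+ 1) (sym (m≤n⇒m⊓n≡m (n≤1+n n))))))

    module _ (ν≡2 : ν (toList c) ≡ 2) {e} (loop : IsLoop M e) where

      private
        x : C
        x = Vec.lookup c e
        ys : List C
        ys = select (∁ ⁅ e ⁆) c
        ν-ys : ν ys ≡ 1
        ν-ys = suc-injective (trans (sym (cong (_+ ν ys) (∣⁅x⁆∣≡1 e)))
          (trans (sym (h ⁅ e ⁆)) (trans (cong₂ _+_ loop ν≡2) refl)))
        y : C
        y = proj₁ (ν≡1⇒mono ys ν-ys)
        mono : All (y ≡_) ys
        mono = proj₂ (proj₂ (ν≡1⇒mono ys ν-ys))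
        y∈ : y ∈ˡ toList c
        y∈ = select-⊆ (∁ ⁅ e ⁆) c (proj₁ (proj₂ (ν≡1⇒mono ys ν-ys)))

        x≢y : x ≢ y
        x≢y x≡y = ν≡2⇒¬mono (toList c) ν≡2 (All-resp-↭ (↭-sym (toList-↭-select c e)) (sym x≡y ∷ mono))

      -- `Presents` at a loop e says that the other elements have ν = 1. Hence the classes are e
      -- alone and everything else, of sizes 1 and n - 1, and f ignores the first as well as the
      -- absent colours.
      sum-hits-loop : ∀ {cols} → Unique cols → (∀ {z} → z ∈ˡ toList c → z ∈ˡ cols) →
                      ∀ (f : ℕ → Poly) → f 0 ≋ 0ₚ → f 1 ≋ 0ₚ →
                      (∑[ j ∈ cols ] f (hits j (toList c))) ≋ f (n ∸ 1)
      sum-hits-loop {cols} uniq c⊆ f f₀ f₁ = begin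
        (∑[ j ∈ cols ] f (hits j (toList c)))
          ≈⟨ sum-cong cols (λ {j} _ → eq j) ⟩
        (∑[ j ∈ cols ] f (hits j ys))
          ≈⟨ sum-single uniq (c⊆ y∈) (λ j≢y → ℤ[t].trans (ℤ[t].reflexive (cong f (hits-other mono j≢y))) f₀) ⟩
        f (hits y ys)
          ≡⟨ cong f (trans (hits-mono mono) (trans (length-select (∁ ⁅ e ⁆) c)
               (trans (∣∁p∣≡n∸∣p∣ ⁅ e ⁆) (cong (n ∸_) (∣⁅x⁆∣≡1 e))))) ⟩
        f (n ∸ 1) ∎
        where
        open import Relation.Binary.Reasoning.Setoid ℤ[t].setoid
        eq : ∀ j → f (hits j (toList c)) ≋ f (hits j ys)
        eq j = ℤ[t].trans (ℤ[t].reflexive (cong f (↭-length (filter-↭ (j ≟_) (toList-↭-select c e))))) (go (j ≟ x))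
          where
          go : Dec (j ≡ x) → f (hits j (x ∷ ys)) ≋ f (hits j ys)
          go (no j≢x) = ℤ[t].reflexive (cong (f ∘ length) (List.filter-reject (j ≟_) j≢x))
          go (yes refl) = ℤ[t].trans
            (ℤ[t].trans (ℤ[t].reflexive (cong f (trans (cong length (List.filter-accept (j ≟_) refl)) (cong suc (hits-other mono x≢y))))) f₁)
            (ℤ[t].sym (ℤ[t].trans (ℤ[t].reflexive (cong f (hits-other mono x≢y))) f₀))

  module _ {cols : List C} (uniq : Unique cols) (P : ∀ {n} → Matroid n → Poly) (KL : IsKazhdanLusztig P) where

    open IsKazhdanLusztig KL
    private
      u′ v′ : ℕ → Poly
      u′ = u P KL
      v′ = v P KL

    -- Colours of `cols` that do not occur in xs contribute `G _ 0`, which is 0, so the same list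
    -- serves M and all its contractions.
    Φ : List C → Poly
    Φ xs = u′ (length xs) ⊖ (∑[ j ∈ cols ] G v′ (length xs) (hits j xs))

    selectSum-Φ : ∀ {n} (c : Vec C n) →
                  selectSum c Φ ≋ H n u′ ⊖ (∑[ j ∈ cols ] K v′ n (hits j (toList c)))
    selectSum-Φ {n} c = begin
      selectSum c Φ
        ≈⟨ selectSum-⊖ c (u′ ∘ length) (λ xs → ∑[ j ∈ cols ] G v′ (length xs) (hits j xs)) ⟩
      selectSum c (u′ ∘ length) ⊖ selectSum c (λ xs → ∑[ j ∈ cols ] G v′ (length xs) (hits j xs))
        ≈⟨ ℤ[t].+-cong (selectSum-length c u′) (ℤ[t].-‿cong (selectSum-∑ c cols (λ j xs → G v′ (length xs) (hits j xs)))) ⟩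
      H n u′ ⊖ (∑[ j ∈ cols ] selectSum c (λ xs → G v′ (length xs) (hits j xs)))
        ≈⟨ ℤ[t].+-congˡ {H n u′} (ℤ[t].-‿cong (sum-cong cols λ {j} _ → eq j)) ⟩
      H n u′ ⊖ (∑[ j ∈ cols ] K v′ n (hits j (toList c))) ∎
      where
      open import Relation.Binary.Reasoning.Setoid ℤ[t].setoid
      eq : ∀ j → selectSum c (λ xs → G v′ (length xs) (hits j xs)) ≋ K v′ n (hits j (toList c))
      eq j = begin
        selectSum c (λ xs → G v′ (length xs) (hits j xs))
          ≈⟨ selectSum-cong c (λ xs _ → ℤ[t].reflexive (cong (λ m → G v′ m (hits j xs)) (sym (hits+misses j xs)))) ⟩
        selectSum c (λ xs → G v′ (hits j xs + misses j xs) (hits j xs))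
          ≈⟨ selectSum-hits j c (λ a b → G v′ (a + b) a) ⟩
        H (hits j (toList c)) (λ a → H (misses j (toList c)) (λ b → G v′ (a + b) a))
          ≈⟨ K≅HHG v′ (hits j (toList c)) (misses j (toList c)) ⟨
        K v′ (hits j (toList c) + misses j (toList c)) (hits j (toList c))
          ≡⟨ cong (λ m → K v′ m (hits j (toList c))) (trans (hits+misses j (toList c)) (length-toList c)) ⟩
        K v′ n (hits j (toList c)) ∎

positive-rank : ∀ {n} (M : Matroid n) → Loopless M → 0 < n → 0 < rank M
positive-rank {suc n} M ℓ _ = <-≤-trans (n≢0⇒n>0 (ℓ zero)) (rk-mono M (⊆-max ⁅ zero ⁆))

¬loopless⇒loop : ∀ {n} (M : Matroid n) → ¬ Loopless M → ∃[ e ] IsLoop M e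
¬loopless⇒loop {n} M ¬ℓ with e , ¬¬loop ← Fin.¬∀⟶∃¬ n _ (λ e → ¬? (rk M ⁅ e ⁆ ≟ 0)) ¬ℓ =
  e , decidable-stable (rk M ⁅ e ⁆ ≟ 0) ¬¬loop

-- The formulas for matroids presented by a colouring

module _ {C : Set} (_≟ᶜ_ : DecidableEquality C) {cols : List C} (uniq : Unique cols)
         (P : ∀ {n} → Matroid n → Poly) (KL : IsKazhdanLusztig P) where

  open IsKazhdanLusztig KL
  open Colours _≟ᶜ_
  private
    u′ v′ : ℕ → Poly
    u′ = u P KL
    v′ = v P KL
    νᶜ : List C → ℕ
    νᶜ = ν _≟ᶜ_
    Φᶜ : List C → Poly
    Φᶜ = Φ _≟ᶜ_ uniq P KL

  Formula : ∀ {n} → Vec C n → Matroid n → Set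
  Formula c M = t^ νᶜ (toList c) · P M ≋ Φᶜ (toList c)

  formula-∅ : (M : Matroid 0) → Formula [] M
  formula-∅ M = ℤ[t].trans (mk (rank-zero M (λ ()) (n≤0⇒n≡0 (rank≤n M))))
    (ℤ[t].sym (ℤ[t].trans (ℤ[t].+-congˡ {1ₚ} (ℤ[t].-‿cong (sum-zero cols λ _ → ℤ[t].refl))) (ℤ[t].+-identityʳ 1ₚ)))

  -- M is U_{n,n+1}, and `u≋v⊕G` at n + 1 is the claim: the only class is the whole ground set.
  formula-mono : ∀ {n x} {c : Vec C n} (M : Matroid (suc n)) → x ∈ˡ cols → All (x ≡_) (toList c) →
                 Presents _≟ᶜ_ (x ∷ c) M → Formula (x ∷ c) M
  formula-mono {n} {x} {c} M x∈ mono h = begin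
    t^ νᶜ (x ∷ toList c) · P M
      ≡⟨ cong (λ k → t^ k · P M) ν≡1 ⟩
    t^ 1 · P M
      ≈⟨ t^-cong 1 (mk (respects M (U n (suc n)) (≐⇒≈ᴹ M (U n (suc n)) (mono⇒uniform _≟ᶜ_ {c = x ∷ c} {M} h (refl ∷ mono))))) ⟩
    v′ (suc n)
      ≈⟨ solve 2 (λ a b → a ⊜ ((a :+ b) :+ (:- b))) ℤ[t].refl (v′ (suc n)) (G v′ (suc n) (suc n)) ⟩
    v′ (suc n) ⊕ G v′ (suc n) (suc n) ⊖ G v′ (suc n) (suc n)
      ≈⟨ ℤ[t].+-cong (u≋v⊕G P KL (suc n)) (ℤ[t].-‿cong (ℤ[t].reflexive (cong (G v′ (suc n)) hits≡))) ⟨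
    u′ (suc n) ⊖ G v′ (suc n) (hits x (x ∷ toList c))
      ≈⟨ ℤ[t].+-congˡ {u′ (suc n)} (ℤ[t].-‿cong (sum-single uniq x∈ λ {j} j≢x →
           ℤ[t].reflexive (cong (G v′ (suc n)) (hits-other _≟ᶜ_ (refl ∷ mono) j≢x)))) ⟨
    u′ (suc n) ⊖ (∑[ j ∈ cols ] G v′ (suc n) (hits j (x ∷ toList c)))
      ≡⟨ cong (λ m → u′ m ⊖ (∑[ j ∈ cols ] G v′ m (hits j (x ∷ toList c)))) (length-toList (x ∷ c)) ⟨
    Φᶜ (x ∷ toList c) ∎
    where
    open import Relation.Binary.Reasoning.Setoid ℤ[t].setoid
    ν≡1 : νᶜ (x ∷ toList c) ≡ 1
    ν≡1 = ν-mono _≟ᶜ_ mono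
    hits≡ : hits x (x ∷ toList c) ≡ suc n
    hits≡ = trans (hits-mono _≟ᶜ_ (refl ∷ mono)) (length-toList (x ∷ c))

  length-Φ : ∀ {n} (c : Vec C n) → Φᶜ (toList c) ≡ u′ n ⊖ (∑[ j ∈ cols ] G v′ n (hits j (toList c)))
  length-Φ c = cong (λ m → u′ m ⊖ (∑[ j ∈ cols ] G v′ m (hits j (toList c)))) (length-toList c)

  module _ {n} (c : Vec C n) (M : Matroid n) (c⊆ : ∀ {x} → x ∈ˡ toList c → x ∈ˡ cols)
           (h : Presents _≟ᶜ_ c M) (ν≡2 : νᶜ (toList c) ≡ 2) where

    private
      rank+2 : rank M + 2 ≡ n
      rank+2 = trans (cong (rank M +_) (sym ν≡2)) (rank-Presents _≟ᶜ_ {c = c} {M} h)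

      n≡2+rank : n ≡ 2 + rank M
      n≡2+rank = trans (sym rank+2) (+-comm (rank M) 2)

      n>0 : 0 < n
      n>0 = subst (0 <_) (sym n≡2+rank) z<s

      hits<n : ∀ j → hits j (toList c) < n
      hits<n j = subst (hits j (toList c) <_) (length-toList c) (hits<length _≟ᶜ_ j (toList c) ν≡2)

    formula-loop : ¬ Loopless M → Formula c M
    formula-loop ¬ℓ with e , loop ← ¬loopless⇒loop M ¬ℓ = ℤ[t].trans
      (t^-zero (νᶜ (toList c)) (mk (loops M ¬ℓ))) (ℤ[t].sym (ℤ[t].trans (ℤ[t].reflexive (length-Φ c)) (begin
        u′ n ⊖ (∑[ j ∈ cols ] G v′ n (hits j (toList c)))
          ≈⟨ ℤ[t].+-congˡ {u′ n} (ℤ[t].-‿cong (sum-hits-loop _≟ᶜ_ {c = c} {M} h ν≡2 loop uniq c⊆ (G v′ n) ℤ[t].refl (G₁≋0 P KL n))) ⟩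
        u′ n ⊖ G v′ n (n ∸ 1)
          ≡⟨ cong (λ m → u′ m ⊖ G v′ m (n ∸ 1)) (sym (m+[n∸m]≡n n>0)) ⟩
        u′ (suc (n ∸ 1)) ⊖ G v′ (suc (n ∸ 1)) (n ∸ 1)
          ≈⟨ ℤ[t].+-congʳ {neg (G v′ (suc (n ∸ 1)) (n ∸ 1))} (u≋Gv P KL (n ∸ 1)) ⟩
        G v′ (suc (n ∸ 1)) (n ∸ 1) ⊖ G v′ (suc (n ∸ 1)) (n ∸ 1)
          ≈⟨ ℤ[t].-‿inverseʳ (G v′ (suc (n ∸ 1)) (n ∸ 1)) ⟩
        0ₚ ∎)))
      where open import Relation.Binary.Reasoning.Setoid ℤ[t].setoid

    private
      term term′ : Subset n → Poly
      term  F = t^ 2 · contractionTerm P KL M F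
      term′ F = t^ ∣ F ∣ · Φᶜ (select (∁ F) c)

    term≋ : ∀ F → Formula (restrict (∁ F) c) (M / F) → term F ≋ term′ F
    term≋ F formula = begin
      t^ 2 · (t^ rk M F · P (M / F))
        ≡⟨ trans (t^-+ 2 (rk M F) _) (cong (λ k → t^ k · P (M / F)) exponent) ⟩
      t^ (∣ F ∣ + νᶜ (toList (restrict (∁ F) c))) · P (M / F)
        ≡⟨ sym (t^-+ ∣ F ∣ (νᶜ (toList (restrict (∁ F) c))) _) ⟩
      t^ ∣ F ∣ · (t^ νᶜ (toList (restrict (∁ F) c)) · P (M / F))
        ≈⟨ t^-cong ∣ F ∣ formula ⟩
      t^ ∣ F ∣ · Φᶜ (toList (restrict (∁ F) c))
        ≡⟨ cong (λ xs → t^ ∣ F ∣ · Φᶜ xs) (toList-restrict (∁ F) c) ⟩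
      term′ F ∎
      where
      open import Relation.Binary.Reasoning.Setoid ℤ[t].setoid
      exponent : 2 + rk M F ≡ ∣ F ∣ + νᶜ (toList (restrict (∁ F) c))
      exponent = trans (+-comm 2 (rk M F)) (trans (cong (rk M F +_) (sym ν≡2))
        (trans (h F) (cong (λ xs → ∣ F ∣ + νᶜ xs) (sym (toList-restrict (∁ F) c)))))

    Z≋terms : Loopless M → t^ 2 · Z-of P M ≋ ∑ (subsets n) term
    Z≋terms ℓ = ℤ[t].trans (t^-cong 2 (Z-of≋∑ P KL M ℓ)) (t^-∑ 2 (subsets n) (contractionTerm P KL M))

    formula-loopless : Loopless M → (∀ F → Nonempty F → Formula (restrict (∁ F) c) (M / F)) → Formula c M
    formula-loopless ℓ ih = ℤ[t].trans (ℤ[t].reflexive (cong (λ k → t^ k · P M) ν≡2))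
        (x∙y⁻¹≈ε⇒x≈y (t^ 2 · P M) (Φᶜ (toList c)) (Pal∧Half⇒0 pal-D half-D))
      where
      open import Algebra.Properties.AbelianGroup ℤ[t].+-abelianGroup using (x∙y⁻¹≈ε⇒x≈y)
      open import Relation.Binary.Reasoning.Setoid ℤ[t].setoid
      D : Poly
      D = t^ 2 · P M ⊖ Φᶜ (toList c)
      Fs : List (Subset n)
      Fs = proj₁ (Existence.subsets-⊥ n)
      subsets≡ : subsets n ≡ ⊥ ∷ Fs
      subsets≡ = proj₁ (proj₂ (Existence.subsets-⊥ n))
      nonempty : All Nonempty Fs
      nonempty = proj₂ (proj₂ (Existence.subsets-⊥ n))
      term-⊥ : term ⊥ ≋ t^ 2 · P M
      term-⊥ = t^-cong 2 (ℤ[t].trans (ℤ[t].reflexive (cong (λ k → t^ k · P (M / ⊥)) (Existence.rk-⊥ M)))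
        (mk (respects (M / ⊥) M (Existence./-⊥ M))))
      term′-⊥ : term′ ⊥ ≋ Φᶜ (toList c)
      term′-⊥ = ℤ[t].reflexive (cong₂ (λ k xs → t^ k · Φᶜ xs) (∣⊥∣≡0 n) (select-∁⊥ c))
      ∑-Fs : ∑ Fs term ≋ ∑ Fs term′
      ∑-Fs = sum-cong Fs λ {F} F∈ → term≋ F (ih F (All.lookup nonempty F∈))
      -- The summands at nonempty F agree by induction and cancel; what remains is the summand at
      -- `⊥`.
      D≋ : t^ 2 · Z-of P M ⊖ (H n u′ ⊖ (∑[ j ∈ cols ] K v′ n (hits j (toList c)))) ≋ D
      D≋ = begin
        t^ 2 · Z-of P M ⊖ (H n u′ ⊖ (∑[ j ∈ cols ] K v′ n (hits j (toList c))))
          ≈⟨ ℤ[t].+-cong (Z≋terms ℓ) (ℤ[t].-‿cong (ℤ[t].sym (selectSum-Φ _≟ᶜ_ uniq P KL c))) ⟩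
        ∑ (subsets n) term ⊖ ∑ (subsets n) term′
          ≡⟨ cong (λ Gs → ∑ Gs term ⊖ ∑ Gs term′) subsets≡ ⟩
        (term ⊥ ⊕ ∑ Fs term) ⊖ (term′ ⊥ ⊕ ∑ Fs term′)
          ≈⟨ ℤ[t].+-cong (ℤ[t].+-cong term-⊥ ∑-Fs) (ℤ[t].-‿cong (ℤ[t].+-congʳ {∑ Fs term′} term′-⊥)) ⟩
        (t^ 2 · P M ⊕ ∑ Fs term′) ⊖ (Φᶜ (toList c) ⊕ ∑ Fs term′)
          ≈⟨ solve 3 (λ a b r → ((a :+ r) :+ (:- (b :+ r))) ⊜ (a :+ (:- b))) ℤ[t].refl (t^ 2 · P M) (Φᶜ (toList c)) (∑ Fs term′) ⟩
        D ∎
      pal-D : Pal (2 + n) D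
      pal-D = Pal-≋ D≋ (Pal-⊕
        (subst (λ d → Pal d (t^ 2 · Z-of P M)) (cong (2 +_) (sym n≡2+rank))
          (Pal-t^ 2 (Palindromic⇒Pal (palindromic M ℓ))))
        (Pal-neg (Pal-⊕
          (subst (λ m → Pal (2 + m) (H m u′)) (sym n≡2+rank) (Pal-Hu P KL (rank M)))
          -- Two colours occur, so no class is the whole ground set, as `Pal-K` requires.
          (Pal-neg (Pal-∑ cols λ {j} _ → Pal-K (Pal-Z P KL) n (hits j (toList c)) (hits<n j))))))
      half-D : Half (2 + n) D
      half-D = Half-⊕
        (subst (λ d → Half d (t^ 2 · P M)) (cong (2 +_) (sym n≡2+rank))
          (Half-t^ 2 (half (degree M ℓ (positive-rank M ℓ n>0)))))
        (Half-neg (subst (Half (2 + n)) (sym (length-Φ c)) (Half-⊕ (Half-u P KL n)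
          (Half-neg (Half-∑ cols λ {j} _ → Half-G (Half-v P KL) n (hits j (toList c)) (<⇒≤ (hits<n j)))))))

  -- Induction on the size of the ground set, through a bound k because M / F lives on
  -- `Fin ∣ ∁ F ∣`. The contractions of a loopless M fall under all the cases again.
  formula : ∀ {n} (c : Vec C n) (M : Matroid n) → (∀ {x} → x ∈ˡ toList c → x ∈ˡ cols) →
            Presents _≟ᶜ_ c M → Formula c M
  formula {n} c M = below (suc n) c M ≤-refl
    where
    below : ∀ k {n} (c : Vec C n) (M : Matroid n) → n < k → (∀ {x} → x ∈ˡ toList c → x ∈ˡ cols) →
            Presents _≟ᶜ_ c M → Formula c M
    below k [] M _ _ _ = formula-∅ M
    below (suc k) (x ∷ c) M (s≤s n≤k) c⊆ h = cases (All.all? (x ≟ᶜ_) (toList c)) (loopless? M)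
      where
      cases : Dec (All (x ≡_) (toList c)) → Dec (Loopless M) → Formula (x ∷ c) M
      cases (yes mono) _        = formula-mono M (c⊆ (here refl)) mono h
      cases (no ¬mono) (no ¬ℓ)  = formula-loop (x ∷ c) M c⊆ h (ν-poly _≟ᶜ_ ¬mono) ¬ℓ
      cases (no ¬mono) (yes ℓ)  = formula-loopless (x ∷ c) M c⊆ h (ν-poly _≟ᶜ_ ¬mono) ℓ λ F F≠∅ →
        below k (restrict (∁ F) (x ∷ c)) (M / F) (<-≤-trans (Existence.∣∁∣<n F≠∅) n≤k)
          (λ z∈ → c⊆ (select-⊆ (∁ F) (x ∷ c) (subst (_ ∈ˡ_) (toList-restrict (∁ F) (x ∷ c)) z∈)))
          (Presents-/ _≟ᶜ_ {c = x ∷ c} {M} h F)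

  Z-formula : ∀ {n} (c : Vec C n) (M : Matroid n) → (∀ {x} → x ∈ˡ toList c → x ∈ˡ cols) →
              Presents _≟ᶜ_ c M → νᶜ (toList c) ≡ 2 → Loopless M →
              t^ 2 · Z-of P M ≋ H n u′ ⊖ (∑[ j ∈ cols ] K v′ n (hits j (toList c)))
  Z-formula {n} c M c⊆ h ν≡2 ℓ = ℤ[t].trans (Z≋terms c M c⊆ h ν≡2 ℓ) (ℤ[t].trans
    (sum-cong (subsets n) λ {F} _ → term≋ c M c⊆ h ν≡2 F (formula (restrict (∁ F) c) (M / F)
      (λ z∈ → c⊆ (select-⊆ (∁ F) c (subst (_ ∈ˡ_) (toList-restrict (∁ F) c) z∈)))
      (Presents-/ _≟ᶜ_ {c = c} {M} h F)))
    (selectSum-Φ _≟ᶜ_ uniq P KL c))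

-- The parallel classes of the dual matroid

infix 4 _≟ˢ_
_≟ˢ_ : ∀ {n} → DecidableEquality (Subset n)
_≟ˢ_ = Vec.≡-dec Bool._≟_

∈-subsets : ∀ {n} (A : Subset n) → A ∈ˡ subsets n
∈-subsets []            = here refl
∈-subsets (outside ∷ A) = ∈-++⁺ˡ (∈-map⁺ (outside ∷_) (∈-subsets A))
∈-subsets (inside  ∷ A) = ∈-++⁺ʳ (List.map (outside ∷_) (subsets _)) (∈-map⁺ (inside ∷_) (∈-subsets A))

subsets-unique : ∀ n → Unique (subsets n)
subsets-unique zero    = [] ∷ []
subsets-unique (suc n) = Unique.++⁺
  (Unique.map⁺ Vec.∷-injectiveʳ (subsets-unique n)) (Unique.map⁺ Vec.∷-injectiveʳ (subsets-unique n))
  λ (A∈ , A∈′) → disjoint (∈-map⁻ (outside ∷_) A∈) (∈-map⁻ (inside ∷_) A∈′)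
  where
  disjoint : ∀ {A : Subset (suc n)} → (∃[ B ] B ∈ˡ subsets n × A ≡ outside ∷ B) →
             ¬ (∃[ B ] B ∈ˡ subsets n × A ≡ inside ∷ B)
  disjoint (_ , _ , refl) (_ , _ , ())

embed-⊤ : ∀ {n} (A : Subset n) → embed A ⊤ ≡ A
embed-⊤ []            = refl
embed-⊤ (inside  ∷ A) = cong (inside ∷_) (embed-⊤ A)
embed-⊤ (outside ∷ A) = cong (outside ∷_) (embed-⊤ A)

embed⊆ : ∀ {n} (A : Subset n) B → embed A B ⊆ A
embed⊆ A B x∈ = subst (_ ∈_) (embed-⊤ A) (embed-⊆ A (⊆-max B) x∈)

embed-restrict : ∀ {n} (A B : Subset n) → embed A (restrict A B) ≡ A ∩ B
embed-restrict []            []      = refl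
embed-restrict (inside  ∷ A) (b ∷ B) = cong (b ∷_) (embed-restrict A B)
embed-restrict (outside ∷ A) (b ∷ B) = cong (outside ∷_) (embed-restrict A B)

lookup∈select : ∀ {c n} {C : Set c} {A : Subset n} (c : Vec C n) {e} → e ∈ A → Vec.lookup c e ∈ˡ select A c
lookup∈select {A = inside  ∷ A} (x ∷ c) Vec.here       = here refl
lookup∈select {A = inside  ∷ A} (x ∷ c) (Vec.there e∈) = there (lookup∈select c e∈)
lookup∈select {A = outside ∷ A} (x ∷ c) (Vec.there e∈) = lookup∈select c e∈

∈select⇒lookup : ∀ {c n} {C : Set c} (A : Subset n) (c : Vec C n) {x} → x ∈ˡ select A c →
                 ∃[ e ] e ∈ A × x ≡ Vec.lookup c e
∈select⇒lookup []            []      ()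
∈select⇒lookup (inside  ∷ A) (y ∷ c) (here refl) = zero , Vec.here , refl
∈select⇒lookup (inside  ∷ A) (y ∷ c) (there x∈) with e , e∈ , eq ← ∈select⇒lookup A c x∈ = suc e , Vec.there e∈ , eq
∈select⇒lookup (outside ∷ A) (y ∷ c) x∈         with e , e∈ , eq ← ∈select⇒lookup A c x∈ = suc e , Vec.there e∈ , eq

module _ {C : Set} (_≟ᶜ_ : DecidableEquality C) where

  open Colours _≟ᶜ_

  hits≡∣∣ : ∀ {n} j (c : Vec C n) X → (∀ e → e ∈ X → Vec.lookup c e ≡ j) → (∀ e → Vec.lookup c e ≡ j → e ∈ X) →
            hits j (toList c) ≡ ∣ X ∣
  hits≡∣∣ j []      []            to from = refl
  hits≡∣∣ j (x ∷ c) (inside  ∷ X) to from = trans (cong length (List.filter-accept (j ≟ᶜ_) (sym (to zero Vec.here))))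
    (cong suc (hits≡∣∣ j c X (λ e e∈ → to (suc e) (Vec.there e∈)) (λ e eq → drop-there (from (suc e) eq))))
  hits≡∣∣ j (x ∷ c) (outside ∷ X) to from = trans
    (cong length (List.filter-reject (j ≟ᶜ_) λ j≡x → contradiction (from zero (sym j≡x)) λ ()))
    (hits≡∣∣ j c X (λ e e∈ → to (suc e) (Vec.there e∈)) (λ e eq → drop-there (from (suc e) eq)))

  ν≡1 : ∀ {x xs} → x ∈ˡ xs → (∀ {y} → y ∈ˡ xs → x ≡ y) → ν _≟ᶜ_ xs ≡ 1
  ν≡1 {xs = z ∷ zs} _ same = mono⇒ν≡1 _≟ᶜ_ zs (All.tabulate same)

  ν≡2 : ∀ {x y xs} → x ∈ˡ xs → y ∈ˡ xs → x ≢ y → ν _≟ᶜ_ xs ≡ 2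
  ν≡2 {xs = z ∷ zs} x∈ y∈ x≢y = ν-poly _≟ᶜ_ λ mono →
    x≢y (trans (sym (All.lookup (refl ∷ mono) x∈)) (All.lookup (refl ∷ mono) y∈))

-- Matroids of corank 2 without coloops

module _ {n} (M : Matroid n) where

  Dependent : Subset n → Set
  Dependent A = rk M A < ∣ A ∣

  -- Monotonicity of the nullity |A| - rk A, written without subtraction: adding D raises the rank
  -- by at most |D|.
  nullity-mono : ∀ {A B} → A ⊆ B → rk M B + ∣ A ∣ ≤ rk M A + ∣ B ∣
  nullity-mono {A} {B} A⊆B = begin
    rk M B + ∣ A ∣                                 ≡⟨ cong (λ X → rk M X + ∣ A ∣) (sym A∪D≡B) ⟩
    rk M (A ∪ D) + ∣ A ∣                           ≤⟨ +-monoˡ-≤ ∣ A ∣ (≤-trans (m≤m+n _ _) (rk-submod M A D)) ⟩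
    rk M A + rk M D + ∣ A ∣                        ≤⟨ +-monoˡ-≤ ∣ A ∣ (+-monoʳ-≤ (rk M A) (rk-bound M D)) ⟩
    rk M A + ∣ D ∣ + ∣ A ∣                         ≡⟨ +-assoc (rk M A) _ _ ⟩
    rk M A + (∣ D ∣ + ∣ A ∣)                       ≡⟨ cong (rk M A +_) (trans (+-comm ∣ D ∣ _) (sym (∣∪∣+∣∩∣ A D))) ⟩
    rk M A + (∣ A ∪ D ∣ + ∣ A ∩ D ∣)               ≡⟨ cong₂ (λ X k → rk M A + (∣ X ∣ + k)) A∪D≡B ∣A∩D∣≡0 ⟩
    rk M A + (∣ B ∣ + 0)                           ≡⟨ cong (rk M A +_) (+-identityʳ ∣ B ∣) ⟩
    rk M A + ∣ B ∣                                 ∎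
    where
    open ≤-Reasoning
    D : Subset n
    D = B ∩ ∁ A
    A∪D≡B : A ∪ D ≡ B
    A∪D≡B = ⊆-antisym
      (λ x∈ → case⊎ (x∈p∪q⁻ A D x∈))
      (λ {x} x∈B → x∈p∪q⁺ (split x∈B (x ∈? A)))
      where
      case⊎ : ∀ {x} → x ∈ A ⊎ x ∈ D → x ∈ B
      case⊎ (inj₁ x∈A) = A⊆B x∈A
      case⊎ (inj₂ x∈D) = proj₁ (x∈p∩q⁻ B (∁ A) x∈D)
      split : ∀ {x} → x ∈ B → Dec (x ∈ A) → x ∈ A ⊎ x ∈ D
      split x∈B (yes x∈A) = inj₁ x∈A
      split x∈B (no  x∉A) = inj₂ (x∈p∩q⁺ (x∈B , x∉p⇒x∈∁p x∉A))
    ∣A∩D∣≡0 : ∣ A ∩ D ∣ ≡ 0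
    ∣A∩D∣≡0 = n≤0⇒n≡0 (subst (∣ A ∩ D ∣ ≤_) (∣⊥∣≡0 n) (p⊆q⇒∣p∣≤∣q∣ {p = A ∩ D} {⊥} λ x∈ →
      contradiction (proj₁ (x∈p∩q⁻ A D x∈)) (x∈∁p⇒x∉p (proj₂ (x∈p∩q⁻ B (∁ A) (proj₂ (x∈p∩q⁻ A D x∈)))))))

  Dependent-⊆ : ∀ {A B} → A ⊆ B → Dependent A → Dependent B
  Dependent-⊆ {A} {B} A⊆B dep = +-cancelʳ-< (∣ A ∣) (rk M B) (∣ B ∣) (begin-strict
    rk M B + ∣ A ∣     ≤⟨ nullity-mono A⊆B ⟩
    rk M A + ∣ B ∣     <⟨ +-monoˡ-< ∣ B ∣ dep ⟩
    ∣ A ∣ + ∣ B ∣      ≡⟨ +-comm ∣ A ∣ _ ⟩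
    ∣ B ∣ + ∣ A ∣      ∎)
    where open ≤-Reasoning

  independent : ∀ {A} → ¬ Dependent A → rk M A ≡ ∣ A ∣
  independent {A} ¬dep = ≤-antisym (rk-bound M A) (≮⇒≥ ¬dep)

  -- If the complement of e did not span, no basis could avoid e.
  coloop-free⇒spanning : ∀ {e} → ¬ IsColoop M e → rk M (∁ ⁅ e ⁆) ≡ rank M
  coloop-free⇒spanning {e} ¬coloop with rk M (∁ ⁅ e ⁆) ≟ rank M
  ... | yes eq = eq
  ... | no neq = contradiction (λ B (_ , spans) → decidable-stable (e ∈? B) λ e∉B →
      <⇒≱ (≤∧≢⇒< (rk-mono M (⊆-max (∁ ⁅ e ⁆))) neq)
        (subst (_≤ rk M (∁ ⁅ e ⁆)) spans (rk-mono M λ x∈B → x∉p⇒x∈∁p (x≢y⇒x∉⁅y⁆ λ { refl → e∉B x∈B })))) ¬coloop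

  module Corank2 (corank : rank M + 2 ≡ n) (¬coloop : ∀ e → ¬ IsColoop M e) where

    ∣∁e∣ : ∀ e → ∣ ∁ ⁅ e ⁆ ∣ ≡ suc (rk M (∁ ⁅ e ⁆))
    ∣∁e∣ e = trans (∣∁p∣≡n∸∣p∣ ⁅ e ⁆) (trans (cong₂ _∸_ (sym corank) (∣⁅x⁆∣≡1 e))
      (trans (cong (_∸ 1) (+-comm (rank M) 2)) (cong suc (sym (coloop-free⇒spanning (¬coloop e))))))

    -- The complement of e has size n - 1 and rank n - 2, and nullity is monotone.
    nullity≤1 : ∀ {e A} → e ∉ A → ∣ A ∣ ≤ suc (rk M A)
    nullity≤1 {e} {A} e∉A = +-cancelˡ-≤ (rk M (∁ ⁅ e ⁆)) _ _ (begin
      rk M (∁ ⁅ e ⁆) + ∣ A ∣         ≤⟨ nullity-mono A⊆ ⟩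
      rk M A + ∣ ∁ ⁅ e ⁆ ∣           ≡⟨ cong (rk M A +_) (∣∁e∣ e) ⟩
      rk M A + suc (rk M (∁ ⁅ e ⁆))  ≡⟨ +-suc (rk M A) _ ⟩
      suc (rk M A + rk M (∁ ⁅ e ⁆))  ≡⟨ +-comm (suc (rk M A)) _ ⟩
      rk M (∁ ⁅ e ⁆) + suc (rk M A)  ∎)
      where
      open ≤-Reasoning
      A⊆ : A ⊆ ∁ ⁅ e ⁆
      A⊆ x∈A = x∉p⇒x∈∁p (x≢y⇒x∉⁅y⁆ λ { refl → e∉A x∈A })

    circuit : ∀ {e A} → e ∉ A → Dependent A → ∣ A ∣ ≡ suc (rk M A)
    circuit e∉A dep = ≤-antisym (nullity≤1 e∉A) dep

    -- By submodularity the nullities of A ∪ B and A ∩ B add up to at least 2. The union still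
    -- avoids e, so it accounts for at most 1.
    Dependent-∩ : ∀ {e A B} → e ∉ A → e ∉ B → Dependent A → Dependent B → Dependent (A ∩ B)
    Dependent-∩ {e} {A} {B} e∉A e∉B depA depB = +-cancelˡ-≤ (suc (rk M (A ∪ B))) _ _ (begin
      suc (rk M (A ∪ B)) + suc (rk M (A ∩ B))   ≡⟨ cong suc (+-suc (rk M (A ∪ B)) _) ⟩
      suc (suc (rk M (A ∪ B) + rk M (A ∩ B)))   ≤⟨ s≤s (s≤s (rk-submod M A B)) ⟩
      suc (suc (rk M A + rk M B))               ≡⟨ cong suc (sym (+-suc (rk M A) _)) ⟩
      suc (rk M A) + suc (rk M B)               ≤⟨ +-mono-≤ depA depB ⟩
      ∣ A ∣ + ∣ B ∣                             ≡⟨ sym (∣∪∣+∣∩∣ A B) ⟩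
      ∣ A ∪ B ∣ + ∣ A ∩ B ∣                     ≤⟨ +-monoˡ-≤ ∣ A ∩ B ∣ (nullity≤1 e∉A∪B) ⟩
      suc (rk M (A ∪ B)) + ∣ A ∩ B ∣            ∎)
      where
      open ≤-Reasoning
      e∉A∪B : e ∉ A ∪ B
      e∉A∪B e∈ with x∈p∪q⁻ A B e∈
      ... | inj₁ e∈A = e∉A e∈A
      ... | inj₂ e∈B = e∉B e∈B

    -- e and f are parallel in the dual of M.
    infix 4 _∼_ _∼?_
    record _∼_ (e f : Fin n) : Set where
      constructor parallel
      field pair-dependent : Dependent (∁ (⁅ e ⁆ ∪ ⁅ f ⁆))
    open _∼_

    _∼?_ : ∀ e f → Dec (e ∼ f)
    e ∼? f = map′ parallel pair-dependent (rk M (∁ (⁅ e ⁆ ∪ ⁅ f ⁆)) <? ∣ ∁ (⁅ e ⁆ ∪ ⁅ f ⁆) ∣)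

    ∼-refl : ∀ e → e ∼ e
    ∼-refl e = parallel (subst Dependent (cong ∁ (sym (∪-idem ⁅ e ⁆))) (≤-reflexive (sym (∣∁e∣ e))))

    ∼-sym : ∀ {e f} → e ∼ f → f ∼ e
    ∼-sym {e} {f} e∼f = parallel (subst Dependent (cong ∁ (∪-comm ⁅ e ⁆ ⁅ f ⁆)) (pair-dependent e∼f))

    e∉∁ : ∀ (e f : Fin n) → e ∉ ∁ (⁅ e ⁆ ∪ ⁅ f ⁆)
    e∉∁ e f = x∈p⇒x∉∁p {p = ⁅ e ⁆ ∪ ⁅ f ⁆} (x∈p∪q⁺ (inj₁ (x∈⁅x⁆ e)))

    f∉∁ : ∀ (e f : Fin n) → f ∉ ∁ (⁅ e ⁆ ∪ ⁅ f ⁆)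
    f∉∁ e f = x∈p⇒x∉∁p {p = ⁅ e ⁆ ∪ ⁅ f ⁆} (x∈p∪q⁺ {p = ⁅ e ⁆} (inj₂ (x∈⁅x⁆ f)))

    -- A contains the intersection of the complements of the pairs e, f over all f outside A. They
    -- all avoid e, so `Dependent-∩` applies repeatedly.
    dependent : ∀ {e A} → (∀ {f} → f ∉ A → e ∼ f) → Dependent A
    dependent {e} {A} h = Dependent-⊆ avoid⊆A (avoid-dependent fs λ f∈ → h (proj₂ (∈-filter⁻ (λ f → ¬? (f ∈? A)) {xs = List.allFin n} f∈)))
      where
      avoid : List (Fin n) → Subset n
      avoid []       = ∁ ⁅ e ⁆
      avoid (f ∷ fs) = ∁ (⁅ e ⁆ ∪ ⁅ f ⁆) ∩ avoid fs
      e∉avoid : ∀ fs → e ∉ avoid fs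
      e∉avoid []       = x∈p⇒x∉∁p (x∈⁅x⁆ e)
      e∉avoid (f ∷ fs) = e∉avoid fs ∘ proj₂ ∘ x∈p∩q⁻ (∁ (⁅ e ⁆ ∪ ⁅ f ⁆)) (avoid fs)
      f∉avoid : ∀ {f fs} → f ∈ˡ fs → f ∉ avoid fs
      f∉avoid {fs = f ∷ fs} (here refl) = f∉∁ e f ∘ proj₁ ∘ x∈p∩q⁻ (∁ (⁅ e ⁆ ∪ ⁅ f ⁆)) (avoid fs)
      f∉avoid {fs = g ∷ fs} (there f∈)  = f∉avoid f∈ ∘ proj₂ ∘ x∈p∩q⁻ (∁ (⁅ e ⁆ ∪ ⁅ g ⁆)) (avoid fs)
      avoid-dependent : ∀ fs → (∀ {f} → f ∈ˡ fs → e ∼ f) → Dependent (avoid fs)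
      avoid-dependent []       _ = ≤-reflexive (sym (∣∁e∣ e))
      avoid-dependent (f ∷ fs) h = Dependent-∩ (e∉∁ e f) (e∉avoid fs) (pair-dependent (h (here refl))) (avoid-dependent fs (h ∘ there))
      fs : List (Fin n)
      fs = filter (λ f → ¬? (f ∈? A)) (List.allFin n)
      avoid⊆A : avoid fs ⊆ A
      avoid⊆A {x} x∈ = decidable-stable (x ∈? A) λ x∉A →
        f∉avoid (∈-filter⁺ (λ f → ¬? (f ∈? A)) (∈-allFin x) x∉A) x∈

    Dependent⇒∼ : ∀ {e f A} → e ∉ A → f ∉ A → Dependent A → e ∼ f
    Dependent⇒∼ {e} {f} {A} e∉A f∉A dep = parallel (Dependent-⊆ (λ x∈A → x∉p⇒x∈∁p λ x∈ → absurd x∈A (x∈p∪q⁻ ⁅ e ⁆ ⁅ f ⁆ x∈)) dep)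
      where
      absurd : ∀ {x} → x ∈ A → ¬ (x ∈ ⁅ e ⁆ ⊎ x ∈ ⁅ f ⁆)
      absurd x∈A (inj₁ x∈e) with refl ← x∈⁅y⁆⇒x≡y e x∈e = e∉A x∈A
      absurd x∈A (inj₂ x∈f) with refl ← x∈⁅y⁆⇒x≡y f x∈f = f∉A x∈A

    -- Every element outside the complement of e, f, g is parallel to f, so that complement is
    -- dependent, and it avoids both e and g.
    ∼-trans : ∀ {e f g} → e ∼ f → f ∼ g → e ∼ g
    ∼-trans {e} {f} {g} e∼f f∼g = Dependent⇒∼ {A = A} (out (inj₁ refl)) (out (inj₂ (inj₂ refl))) (dependent {f} λ {x} x∉A → near x x∉A)
      where
      E : Subset n
      E = ⁅ e ⁆ ∪ (⁅ f ⁆ ∪ ⁅ g ⁆)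
      A : Subset n
      A = ∁ E
      out : ∀ {x} → x ≡ e ⊎ x ≡ f ⊎ x ≡ g → x ∉ A
      out (inj₁ refl)        = x∈p⇒x∉∁p (x∈p∪q⁺ (inj₁ (x∈⁅x⁆ e)))
      out (inj₂ (inj₁ refl)) = x∈p⇒x∉∁p (x∈p∪q⁺ {p = ⁅ e ⁆} (inj₂ (x∈p∪q⁺ (inj₁ (x∈⁅x⁆ f)))))
      out (inj₂ (inj₂ refl)) = x∈p⇒x∉∁p (x∈p∪q⁺ {p = ⁅ e ⁆} (inj₂ (x∈p∪q⁺ {p = ⁅ f ⁆} (inj₂ (x∈⁅x⁆ g)))))
      near : ∀ x → x ∉ A → f ∼ x
      near x x∉A with x∈p∪q⁻ ⁅ e ⁆ _ (x∉∁p⇒x∈p x∉A)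
      ... | inj₁ x∈e with refl ← x∈⁅y⁆⇒x≡y e x∈e = ∼-sym e∼f
      ... | inj₂ x∈ with x∈p∪q⁻ ⁅ f ⁆ ⁅ g ⁆ x∈
      ...   | inj₁ x∈f with refl ← x∈⁅y⁆⇒x≡y f x∈f = ∼-refl f
      ...   | inj₂ x∈g with refl ← x∈⁅y⁆⇒x≡y g x∈g = f∼g

    -- The complement of the parallel class of e; these are the circuits of M.
    colour : Fin n → Subset n
    colour e = Vec.tabulate λ f → does (¬? (e ∼? f))

    colouring : Vec (Subset n) n
    colouring = Vec.tabulate colour

    lookup-colouring : ∀ e → Vec.lookup colouring e ≡ colour e
    lookup-colouring = lookup∘tabulate colour

    ≁⇒∈colour : ∀ {e f} → ¬ e ∼ f → f ∈ colour e
    ≁⇒∈colour {e} {f} e≁f = lookup⇒[]= f _ (trans (lookup∘tabulate _ f) (dec-true (¬? (e ∼? f)) e≁f))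

    ∈colour⇒≁ : ∀ {e f} → f ∈ colour e → ¬ e ∼ f
    ∈colour⇒≁ {e} {f} f∈ e∼f with () ← trans (sym ([]=⇒lookup f∈)) (trans (lookup∘tabulate _ f) (dec-false (¬? (e ∼? f)) λ e≁f → e≁f e∼f))

    ∉colour⇒∼ : ∀ {e f} → f ∉ colour e → e ∼ f
    ∉colour⇒∼ {e} {f} f∉ = decidable-stable (e ∼? f) (f∉ ∘ ≁⇒∈colour)

    e∉colour : ∀ e → e ∉ colour e
    e∉colour e e∈ = ∈colour⇒≁ e∈ (∼-refl e)

    colour≡⇒∼ : ∀ {e f} → colour e ≡ colour f → e ∼ f
    colour≡⇒∼ {e} {f} eq = ∉colour⇒∼ λ f∈ → e∉colour f (subst (f ∈_) eq f∈)

    ∼⇒colour≡ : ∀ {e f} → e ∼ f → colour e ≡ colour f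
    ∼⇒colour≡ e∼f = ⊆-antisym
      (λ x∈ → ≁⇒∈colour λ f∼x → ∈colour⇒≁ x∈ (∼-trans e∼f f∼x))
      (λ x∈ → ≁⇒∈colour λ e∼x → ∈colour⇒≁ x∈ (∼-trans (∼-sym e∼f) e∼x))

    private
      ν′ : List (Subset n) → ℕ
      ν′ = ν _≟ˢ_

    colour∈select : ∀ {e} A → e ∈ A → colour e ∈ˡ select A colouring
    colour∈select {e} A e∈A = subst (_∈ˡ select A colouring) (lookup-colouring e) (lookup∈select colouring e∈A)

    ∈select⇒colour : ∀ A {x} → x ∈ˡ select A colouring → ∃[ e ] e ∈ A × x ≡ colour e
    ∈select⇒colour A x∈ with e , e∈A , eq ← ∈select⇒lookup A colouring x∈ = e , e∈A , trans eq (lookup-colouring e)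

    -- The nullity of A is 2 if A is everything, 1 if its complement lies in one class (`dependent`,
    -- then `circuit`), and 0 if its complement has two elements that are not parallel
    -- (`Dependent⇒∼`).
    rk+2 : ∀ A → rk M A + 2 ≡ ∣ A ∣ + ν′ (select (∁ A) colouring)
    rk+2 A with nonempty? (∁ A)
    ... | no empty = subst (λ X → rk M X + 2 ≡ ∣ X ∣ + ν′ (select (∁ X) colouring)) ⊤≡A
      (trans corank (sym (trans (cong₂ _+_ (∣⊤∣≡n n) (cong ν′ (select-∁⊤ colouring))) (+-identityʳ n))))
      where
      ⊤≡A : ⊤ ≡ A
      ⊤≡A = ⊆-antisym (λ {x} _ → decidable-stable (x ∈? A) λ x∉A → empty (x , x∉p⇒x∈∁p x∉A)) (⊆-max A)
    ... | yes (e , e∈∁A) with Fin.any? (λ f → ¬? (f ∈? A) ×-dec ¬? (e ∼? f))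
    ...   | yes (f , f∉A , e≁f) = cong₂ _+_ (independent λ dep → e≁f (Dependent⇒∼ (x∈∁p⇒x∉p e∈∁A) f∉A dep))
      (sym (ν≡2 _≟ˢ_ (colour∈select (∁ A) e∈∁A) (colour∈select (∁ A) (x∉p⇒x∈∁p f∉A)) (e≁f ∘ colour≡⇒∼)))
    ...   | no ¬f = begin
      rk M A + 2                                    ≡⟨ +-suc (rk M A) 1 ⟩
      suc (rk M A) + 1                              ≡⟨ cong₂ _+_ (sym (circuit (x∈∁p⇒x∉p e∈∁A) (dependent e∼))) (sym ν≡) ⟩
      ∣ A ∣ + ν′ (select (∁ A) colouring)           ∎
      where
      open ≡-Reasoning
      e∼ : ∀ {f} → f ∉ A → e ∼ f
      e∼ {f} f∉A = decidable-stable (e ∼? f) λ e≁f → ¬f (f , f∉A , e≁f)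
      ν≡ : ν′ (select (∁ A) colouring) ≡ 1
      ν≡ = ν≡1 _≟ˢ_ (colour∈select (∁ A) e∈∁A) λ y∈ → same (∈select⇒colour (∁ A) y∈)
        where
        same : ∀ {y} → ∃[ f ] f ∈ ∁ A × y ≡ colour f → colour e ≡ y
        same (f , f∈∁A , refl) = ∼⇒colour≡ (e∼ (x∈∁p⇒x∉p f∈∁A))

    -- The empty set has nullity 0, so `rk+2` finds two classes in its complement.
    ν-colouring : ν′ (toList colouring) ≡ 2
    ν-colouring = trans (cong ν′ (sym (select-∁⊥ colouring)))
      (trans (sym (trans (rk+2 ⊥) (cong (_+ ν′ (select (∁ ⊥) colouring)) (∣⊥∣≡0 n)))) (cong (_+ 2) (Existence.rk-⊥ M)))

    colouring-presents : Presents _≟ˢ_ colouring M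
    colouring-presents A = trans (cong (rk M A +_) ν-colouring) (rk+2 A)

    IsStressedCircuit : Subset n → Set
    IsStressedCircuit A = IsStressed M A × ∣ A ∣ ≡ suc (rk M A)

    stressedCircuit? : ∀ A → Dec (IsStressedCircuit A)
    stressedCircuit? A = stressed? M A ×-dec (∣ A ∣ ≟ suc (rk M A))

    stressedCircuits : List (Subset n)
    stressedCircuits = filter stressedCircuit? (subsets n)

    stressedCircuits-unique : Unique stressedCircuits
    stressedCircuits-unique = Unique.filter⁺ stressedCircuit? (subsets-unique n)

    colour-circuit : ∀ e → ∣ colour e ∣ ≡ suc (rk M (colour e))
    colour-circuit e = circuit (e∉colour e) (dependent (∉colour⇒∼ {e}))

    -- A proper subset misses e and also some f not parallel to e, hence is independent.
    colour-restriction : ∀ e B → rk (M ∥ colour e) B ≡ rk M (colour e) ⊓ ∣ B ∣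
    colour-restriction e B with Fin.any? (λ f → f ∈? colour e ×-dec ¬? (f ∈? embed (colour e) B))
    ... | yes (f , f∈ , f∉) = trans (trans (independent λ dep →
            ∈colour⇒≁ f∈ (Dependent⇒∼ (e∉colour e ∘ embed⊆ (colour e) B) f∉ dep)) ∣E∣≡∣B∣)
          (sym (m≥n⇒m⊓n≡n (s≤s⁻¹ (subst₂ _<_ ∣E∣≡∣B∣ (colour-circuit e)
            (p⊂q⇒∣p∣<∣q∣ (embed⊆ (colour e) B , f , f∈ , f∉))))))
      where
      ∣E∣≡∣B∣ : ∣ embed (colour e) B ∣ ≡ ∣ B ∣
      ∣E∣≡∣B∣ = ∣embed∣ (colour e) B
    ... | no ¬f = trans (cong (rk M) E≡) (sym (m≤n⇒m⊓n≡m (≤-trans (n≤1+n _)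
            (≤-reflexive (trans (sym (colour-circuit e)) (trans (cong ∣_∣ (sym E≡)) (∣embed∣ (colour e) B)))))))
      where
      E≡ : embed (colour e) B ≡ colour e
      E≡ = ⊆-antisym (embed⊆ (colour e) B) λ {f} f∈ →
        decidable-stable (f ∈? embed (colour e) B) λ f∉ → ¬f (f , f∈ , f∉)

    -- Outside `colour e` only one colour remains.
    colour-contraction : ∀ e B → rk (M / colour e) B ≡ (∣ ∁ (colour e) ∣ ∸ 1) ⊓ ∣ B ∣
    colour-contraction e = mono⇒uniform _≟ˢ_ {M = M / colour e} (Presents-/ _≟ˢ_ {c = colouring} {M} colouring-presents (colour e))
      (All.tabulate λ {x} x∈ → same (∈select⇒colour (∁ (colour e)) (subst (x ∈ˡ_) (toList-restrict (∁ (colour e)) colouring) x∈)))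
      where
      same : ∀ {y} → ∃[ f ] f ∈ ∁ (colour e) × y ≡ colour f → colour e ≡ y
      same (f , f∈ , refl) = ∼⇒colour≡ (∉colour⇒∼ {e} (x∈∁p⇒x∉p f∈))

    colour∈stressedCircuits : ∀ e → colour e ∈ˡ stressedCircuits
    colour∈stressedCircuits e = ∈-filter⁺ stressedCircuit? (∈-subsets (colour e))
      ( ( (rk M (colour e) , rk-bound M (colour e) , colour-restriction e)
        , (∣ ∁ (colour e) ∣ ∸ 1 , m∸n≤m _ 1 , colour-contraction e))
      , colour-circuit e)

    colouring⊆stressedCircuits : ∀ {x} → x ∈ˡ toList colouring → x ∈ˡ stressedCircuits
    colouring⊆stressedCircuits x∈ with e , _ , refl ← ∈select⇒colour (∁ ⊥) (subst (_ ∈ˡ_) (sym (select-∁⊥ colouring)) x∈) =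
      colour∈stressedCircuits e

    -- Uniform of nullity 1 makes every proper subset of A independent. If some f in A were parallel
    -- to e, everything outside A - f would be parallel to e, and A - f would be dependent.
    stressedCircuit⇒colour : ∀ {A e} → IsStressedCircuit A → e ∉ A → colour e ≡ A
    stressedCircuit⇒colour {A} {e} (((k , k≤∣A∣ , uniform) , _) , size) e∉A = ⊆-antisym
      (λ {f} f∈ → decidable-stable (f ∈? A) λ f∉A → ∈colour⇒≁ f∈ (Dependent⇒∼ e∉A f∉A dep))
      (λ {f} f∈A → ≁⇒∈colour λ e∼f → proper f∈A (dependent λ {x} x∉ → near f x e∼f x∉))
      where
      dep : Dependent A
      dep = ≤-reflexive (sym size)
      rk≡k : rk M A ≡ k
      rk≡k = trans (cong (rk M) (sym (embed-⊤ A))) (trans (uniform ⊤)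
        (trans (cong (k ⊓_) (∣⊤∣≡n ∣ A ∣)) (m≤n⇒m⊓n≡m k≤∣A∣)))
      near : ∀ f x → e ∼ f → x ∉ A ∩ ∁ ⁅ f ⁆ → e ∼ x
      near f x e∼f x∉ with x ∈? A
      ... | no  x∉A = Dependent⇒∼ e∉A x∉A dep
      ... | yes x∈A with refl ← x∈⁅y⁆⇒x≡y f (x∉∁p⇒x∈p λ x∈ → x∉ (x∈p∩q⁺ (x∈A , x∈))) = e∼f
      proper : ∀ {f} → f ∈ A → ¬ Dependent (A ∩ ∁ ⁅ f ⁆)
      proper {f} f∈A = ≤⇒≯ (begin
        ∣ A ∩ ∁ ⁅ f ⁆ ∣                       ≡⟨ size′ ⟩
        ∣ B ∣                                 ≡⟨ m≥n⇒m⊓n≡n (s≤s⁻¹ (subst₂ _<_ size′ (trans size (cong suc rk≡k)) smaller)) ⟨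
        k ⊓ ∣ B ∣                             ≡⟨ uniform B ⟨
        rk M (embed A B)                      ≡⟨ cong (rk M) (embed-restrict A (∁ ⁅ f ⁆)) ⟩
        rk M (A ∩ ∁ ⁅ f ⁆)                    ∎)
        where
        open ≤-Reasoning
        B : Subset ∣ A ∣
        B = restrict A (∁ ⁅ f ⁆)
        size′ : ∣ A ∩ ∁ ⁅ f ⁆ ∣ ≡ ∣ B ∣
        size′ = trans (cong ∣_∣ (sym (embed-restrict A (∁ ⁅ f ⁆)))) (∣embed∣ A B)
        smaller : ∣ A ∩ ∁ ⁅ f ⁆ ∣ < ∣ A ∣
        smaller = p⊂q⇒∣p∣<∣q∣ (p∩q⊆p A (∁ ⁅ f ⁆) , f , f∈A , λ f∈ → x∈p⇒x∉∁p (x∈⁅x⁆ f) (proj₂ (x∈p∩q⁻ A (∁ ⁅ f ⁆) f∈)))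

    -- The elements of colour A are those outside A; this is the origin of s = n - r - 1.
    hits-stressedCircuit : ∀ {A} → A ∈ˡ stressedCircuits → Colours.hits _≟ˢ_ A (toList colouring) ≡ n ∸ suc (rk M A)
    hits-stressedCircuit {A} A∈ with _ , stressed ← ∈-filter⁻ stressedCircuit? {xs = subsets n} A∈ = trans
      (hits≡∣∣ _≟ˢ_ A colouring (∁ A)
        (λ e e∈ → trans (lookup-colouring e) (stressedCircuit⇒colour stressed (x∈∁p⇒x∉p e∈)))
        (λ e eq → x∉p⇒x∈∁p (subst (e ∉_) (trans (sym (lookup-colouring e)) eq) (e∉colour e))))
      (trans (∣∁p∣≡n∸∣p∣ A) (cong (n ∸_) (proj₂ stressed)))

open import Data.Integer.Base using (+_)

-- Counting stressed circuits by rank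

0· : ∀ p → (+ 0) · p ≋ 0ₚ
0· p = mk λ i → trans (coeff-· 0ℤ p i) (ℤ.*-zeroˡ (coeff p i))

suc-· : ∀ k p → (+ suc k) · p ≋ p ⊕ (+ k) · p
suc-· k p = mk λ i → trans (coeff-· (+ suc k) p i) (trans (ℤ.*-distribʳ-+ (coeff p i) 1ℤ (+ k))
  (trans (cong₂ ℤ._+_ (ℤ.*-identityˡ (coeff p i)) (sym (coeff-· (+ k) p i))) (sym (coeff-⊕ p _ i))))

module _ {A : Set} {R : A → Set} {Q : ℕ → A → Set} (R? : ∀ x → Dec (R x)) (Q? : ∀ r x → Dec (Q r x)) (key : A → ℕ)
         (Q⇒ : ∀ {r x} → Q r x → R x × key x ≡ r) (⇒Q : ∀ {x} → R x → Q (key x) x) (g : ℕ → Poly) where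

  -- Each x is counted at r = `key x` alone, and the bound keeps that r in the range.
  sum-by-key : ∀ N xs → (∀ x → key x ≤ N) →
               (∑[ r ∈ 0 ⋯ N ] (+ length (filter (Q? r) xs)) · g r) ≋ (∑[ x ∈ filter R? xs ] g (key x))
  sum-by-key N [] bound = sum-zero (0 ⋯ N) λ {r} _ → 0· (g r)
  sum-by-key N (x ∷ xs) bound = begin
    (∑[ r ∈ 0 ⋯ N ] (+ length (filter (Q? r) (x ∷ xs))) · g r)
      ≈⟨ sum-cong (0 ⋯ N) (λ {r} _ → split r) ⟩
    (∑[ r ∈ 0 ⋯ N ] indicator r ⊕ (+ length (filter (Q? r) xs)) · g r)
      ≈⟨ sum-+ (0 ⋯ N) indicator (λ r → (+ length (filter (Q? r) xs)) · g r) ⟩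
    ∑ (0 ⋯ N) indicator ⊕ (∑[ r ∈ 0 ⋯ N ] (+ length (filter (Q? r) xs)) · g r)
      ≈⟨ ℤ[t].+-congˡ {∑ (0 ⋯ N) indicator} (sum-by-key N xs bound) ⟩
    ∑ (0 ⋯ N) indicator ⊕ (∑[ x ∈ filter R? xs ] g (key x))
      ≈⟨ collect (R? x) ⟩
    (∑[ x ∈ filter R? (x ∷ xs) ] g (key x)) ∎
    where
    open import Relation.Binary.Reasoning.Setoid ℤ[t].setoid
    indicator : ℕ → Poly
    indicator r = if does (Q? r x) then g r else 0ₚ
    split : ∀ r → (+ length (filter (Q? r) (x ∷ xs))) · g r ≋ indicator r ⊕ (+ length (filter (Q? r) xs)) · g r
    split r with Q? r x
    ... | yes _ = suc-· (length (filter (Q? r) xs)) (g r)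
    ... | no  _ = ℤ[t].refl
    collect : Dec (R x) → ∑ (0 ⋯ N) indicator ⊕ (∑[ x ∈ filter R? xs ] g (key x)) ≋ (∑[ x ∈ filter R? (x ∷ xs) ] g (key x))
    collect (yes Rx) = ℤ[t].trans
      (ℤ[t].+-congʳ {∑[ x ∈ filter R? xs ] g (key x)} (ℤ[t].trans
        (sum-single (Unique.applyUpTo⁺₁ (λ i → i) (suc N) λ i<j _ → <⇒≢ i<j) (∈-applyUpTo⁺ (λ i → i) (s≤s (bound x)))
          λ {r} r≢ → ℤ[t].reflexive (Existence.if-no (Q? r x) λ q → r≢ (sym (proj₂ (Q⇒ q)))))
        (ℤ[t].reflexive (Existence.if-yes (Q? (key x) x) (⇒Q Rx)))))
      (ℤ[t].reflexive (cong (λ ys → ∑ ys (g ∘ key)) (sym (List.filter-accept R? Rx))))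
    collect (no ¬Rx) = ℤ[t].trans
      (ℤ[t].+-congʳ {∑[ x ∈ filter R? xs ] g (key x)}
        (sum-zero (0 ⋯ N) λ {r} _ → ℤ[t].reflexive (Existence.if-no (Q? r x) λ q → ¬Rx (proj₁ (Q⇒ q)))))
      (ℤ[t].reflexive (cong (λ ys → ∑ ys (g ∘ key)) (sym (List.filter-reject R? ¬Rx))))

-- The shape of the coefficient of λ_r in both formulas, with s = n - r - 1.
bracket : Poly → (ℕ → Poly) → ℕ → Poly
bracket p q s = (+ (s ∸ 1)) · p ⊖ (∑[ a ∈ 2 ⋯ s ] q a)

module _ (p : Poly) (q : ℕ → Poly) where

  bracket₀ : bracket p q 0 ≋ 0ₚ
  bracket₀ = ℤ[t].trans (ℤ[t].+-identityʳ _) (0· p)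

  bracket₁ : bracket p q 1 ≋ 0ₚ
  bracket₁ = ℤ[t].trans (ℤ[t].+-identityʳ _) (0· p)

  -- Starts at 2 because the truncated `s ∸ 1` stays 0 from s = 0 to s = 1.
  bracket-suc : ∀ s → bracket p q (2 + s) ≋ bracket p q (suc s) ⊕ (p ⊖ q (2 + s))
  bracket-suc s = begin
    (+ suc s) · p ⊖ (∑[ a ∈ 2 ⋯ (2 + s) ] q a)
      ≈⟨ ℤ[t].+-cong (suc-· s p) (ℤ[t].-‿cong last) ⟩
    p ⊕ (+ s) · p ⊖ ((∑[ a ∈ 2 ⋯ suc s ] q a) ⊕ q (2 + s))
      ≈⟨ solve 4 (λ p k σ q → ((p :+ k) :+ (:- (σ :+ q))) ⊜ ((k :+ (:- σ)) :+ (p :+ (:- q)))) ℤ[t].refl p ((+ s) · p) (∑[ a ∈ 2 ⋯ suc s ] q a) (q (2 + s)) ⟩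
    bracket p q (suc s) ⊕ (p ⊖ q (2 + s)) ∎
    where
    open import Relation.Binary.Reasoning.Setoid ℤ[t].setoid
    last : (∑[ a ∈ 2 ⋯ (2 + s) ] q a) ≋ (∑[ a ∈ 2 ⋯ suc s ] q a) ⊕ q (2 + s)
    last = ℤ[t].trans (ℤ[t].reflexive (cong (λ as → ∑ as q) (sym (List.applyUpTo-∷ʳ (λ i → 2 + i) s))))
      (ℤ[t].trans (sum-++ (2 ⋯ suc s) (2 + s ∷ []) q) (ℤ[t].+-congˡ {∑[ a ∈ 2 ⋯ suc s ] q a} (ℤ[t].+-identityʳ (q (2 + s)))))

  t²-bracket-suc : ∀ s → t^ 2 · bracket p q (2 + s) ≋ t^ 2 · bracket p q (suc s) ⊕ (t^ 2 · p ⊖ t^ 2 · q (2 + s))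
  t²-bracket-suc s = ℤ[t].trans (t^-cong 2 (bracket-suc s)) (ℤ[t].trans (t^-⊕ 2 (bracket p q (suc s)) _)
    (ℤ[t].+-congˡ {t^ 2 · bracket p q (suc s)} (ℤ[t].trans (t^-⊕ 2 p _) (ℤ[t].+-congˡ {t^ 2 · p} (t^-· 2 -1ℤ (q (2 + s)))))))

  telescope : ∀ (E : ℕ → Poly) s → E 1 ≋ 0ₚ →
              (∀ {a} → a < s → E (2 + a) ≋ E (suc a) ⊕ (t^ 2 · p ⊖ t^ 2 · q (2 + a))) →
              t^ 2 · bracket p q (suc s) ≋ E (suc s)
  telescope E zero    E₁ step = ℤ[t].trans (t^-zero 2 bracket₁) (ℤ[t].sym E₁)
  telescope E (suc s) E₁ step = ℤ[t].trans (t²-bracket-suc s) (ℤ[t].sym (ℤ[t].trans (step ≤-refl)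
    (ℤ[t].+-congʳ {t^ 2 · p ⊖ t^ 2 · q (2 + s)} (ℤ[t].sym (telescope E s E₁ (step ∘ m≤n⇒m≤1+n))))))

t^1≋𝐭⊗ : ∀ p → t^ 1 · p ≋ 𝐭 ⊗ p
t^1≋𝐭⊗ p = ℤ[t].sym (𝐭⊗ p)

t^2≋𝐭⊗𝐭⊗ : ∀ p → t^ 2 · p ≋ 𝐭 ⊗ (𝐭 ⊗ p)
t^2≋𝐭⊗𝐭⊗ p = ℤ[t].trans (∷-cong 0ℤ (t^1≋𝐭⊗ p)) (t^1≋𝐭⊗ _)

-- From `G` and `K` to the coefficients in the theorem

module _ (P : ∀ {n} → Matroid n → Poly) (KL : IsKazhdanLusztig P) (m : ℕ) where

  private
    n : ℕ
    n = 2 + m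
    u′ v′ : ℕ → Poly
    u′ = u P KL
    v′ = v P KL
    Z′ : ∀ {n} → Matroid n → Poly
    Z′ = Z-of P

  qᴾ qᶻ : ℕ → Poly
  qᴾ a = P (U (n ∸ a ∸ 1) (n ∸ a)) ⊗ (P (U (a ∸ 1) a) ⊕ t^ 1 · P (U (a ∸ 2) (a ∸ 1)))
  qᶻ a = Z′ (U (a ∸ 1) a) ⊗ Z′ (U (n ∸ a ∸ 1) (n ∸ a))

  bracketᴾ bracketᶻ : ℕ → Poly
  bracketᴾ = bracket (P (U m (suc m))) qᴾ
  bracketᶻ = bracket (Z′ (U m (suc m))) qᶻ

  bracketᴾ≋G : ∀ s → s ≤ m → t^ 2 · bracketᴾ (suc s) ≋ G v′ n (suc s)
  bracketᴾ≋G s s≤m = telescope (P (U m (suc m))) qᴾ (G v′ n) s (G₁≋0 P KL n) λ {a} a<s →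
    ℤ[t].+-congˡ {G v′ n (suc a)} (ℤ[t].+-cong (𝐭⊗ (v′ (suc m)))
      (ℤ[t].-‿cong (go a (m ∸ a) (m<n⇒0<n∸m (<-≤-trans a<s s≤m)))))
    where
    go : ∀ a x → 0 < x → v′ x ⊗ (v′ (2 + a) ⊕ 𝐭 ⊗ v′ (suc a))
         ≋ t^ 2 · (P (U (x ∸ 1) x) ⊗ (P (U (suc a) (2 + a)) ⊕ t^ 1 · P (U a (suc a))))
    go a (suc x) _ = begin
      t^ 1 · A ⊗ (t^ 1 · B ⊕ 𝐭 ⊗ (t^ 1 · C))
        ≈⟨ ℤ[t].*-cong (t^1≋𝐭⊗ A) (ℤ[t].+-cong (t^1≋𝐭⊗ B) (ℤ[t].*-congˡ {𝐭} (t^1≋𝐭⊗ C))) ⟩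
      𝐭 ⊗ A ⊗ (𝐭 ⊗ B ⊕ 𝐭 ⊗ (𝐭 ⊗ C))
        ≈⟨ solve 4 (λ t a b c → ((t :* a) :* ((t :* b) :+ (t :* (t :* c)))) ⊜ (t :* (t :* (a :* (b :+ (t :* c)))))) ℤ[t].refl 𝐭 A B C ⟩
      𝐭 ⊗ (𝐭 ⊗ (A ⊗ (B ⊕ 𝐭 ⊗ C)))
        ≈⟨ t^2≋𝐭⊗𝐭⊗ (A ⊗ (B ⊕ 𝐭 ⊗ C)) ⟨
      t^ 2 · (A ⊗ (B ⊕ 𝐭 ⊗ C))
        ≈⟨ t^-cong 2 (ℤ[t].*-congˡ {A} (ℤ[t].+-congˡ {B} (t^1≋𝐭⊗ C))) ⟨
      t^ 2 · (A ⊗ (B ⊕ t^ 1 · C)) ∎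
      where
      open import Relation.Binary.Reasoning.Setoid ℤ[t].setoid
      A B C : Poly
      A = P (U x (suc x))
      B = P (U (suc a) (2 + a))
      C = P (U a (suc a))

  Z≋ : ∀ {k} → 1 < k → Z v′ k ≋ t^ 1 · Z′ (U (k ∸ 1) k)
  Z≋ 1<k = ℤ[t].sym (Z-uniform P KL 1 1<k)

  𝐭⊗Z≋ : 0 < m → 𝐭 ⊗ Z v′ (suc m) ≋ t^ 2 · Z′ (U m (suc m))
  𝐭⊗Z≋ 0<m = ℤ[t].trans (𝐭⊗ _) (∷-cong 0ℤ (Z≋ (s≤s 0<m)))

  K₁≋0 : K v′ n 1 ≋ 0ₚ
  K₁≋0 = ℤ[t].trans (ℤ[t].+-congˡ {𝐭 ⊗ Z v′ (suc m)} (ℤ[t].-‿cong (ℤ[t].*-congˡ {Z v′ (suc m)} (Z₁≋𝐭 P KL))))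
    (solve 2 (λ t z → ((t :* z) :+ (:- (z :* t))) ⊜ Κ 0ₚ) ℤ[t].refl 𝐭 (Z v′ (suc m)))

  -- Strict, unlike `bracketᴾ≋G`: at s = m the factor Z(U_{0,1}) = 0 would meet `Z v′ 1`, which is
  -- t. A class of that size n - 1 is the complement of a loop.
  bracketᶻ≋K : ∀ s → s < m → t^ 2 · bracketᶻ (suc s) ≋ K v′ n (suc s)
  bracketᶻ≋K s s<m = telescope (Z′ (U m (suc m))) qᶻ (K v′ n) s K₁≋0 λ {a} a<s →
    ℤ[t].+-congˡ {K v′ n (suc a)} (ℤ[t].+-cong (𝐭⊗Z≋ (≤-<-trans z≤n s<m))
      (ℤ[t].-‿cong (go a (m ∸ a) (m+n≤o⇒m≤o∸n 2 (≤-trans (s≤s a<s) s<m)))))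
    where
    go : ∀ a x → 1 < x → Z v′ x ⊗ Z v′ (2 + a) ≋ t^ 2 · (Z′ (U (suc a) (2 + a)) ⊗ Z′ (U (x ∸ 1) x))
    go a x 1<x = begin
      Z v′ x ⊗ Z v′ (2 + a)
        ≈⟨ ℤ[t].*-cong (ℤ[t].trans (Z≋ 1<x) (t^1≋𝐭⊗ A)) (ℤ[t].trans (Z≋ {2 + a} (s≤s (s≤s z≤n))) (t^1≋𝐭⊗ B)) ⟩
      𝐭 ⊗ A ⊗ (𝐭 ⊗ B)
        ≈⟨ solve 3 (λ t a b → ((t :* a) :* (t :* b)) ⊜ (t :* (t :* (b :* a)))) ℤ[t].refl 𝐭 A B ⟩
      𝐭 ⊗ (𝐭 ⊗ (B ⊗ A))
        ≈⟨ t^2≋𝐭⊗𝐭⊗ (B ⊗ A) ⟨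
      t^ 2 · (B ⊗ A) ∎
      where
      open import Relation.Binary.Reasoning.Setoid ℤ[t].setoid
      A B : Poly
      A = Z′ (U (x ∸ 1) x)
      B = Z′ (U (suc a) (2 + a))

  -- The Z-formula for the matroid U_{0,1} ⊕ U_{n-2,n-1}.
  Z-uniform-loop : 0 < m → t^ 2 · Z′ (U m n) ≋ t^ 2 · bracketᶻ (suc m)
  Z-uniform-loop (s≤s {n = k} z≤n) = begin
    t^ 2 · Z′ (U m n)
      ≈⟨ Z-uniform P KL {n} 2 (s≤s (s≤s (s≤s z≤n))) ⟩
    H n u′
      ≈⟨ Hu-step v′ u′ ℤ[t].refl ℤ[t].refl (suc m) (λ {a} _ → u≋Gv P KL a) ⟩
    K v′ n (suc m) ⊕ (𝐭 ⊗ Z v′ (suc m) ⊕ (u′ n ⊖ G v′ n (suc m)))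
      ≈⟨ ℤ[t].+-cong K≋ (ℤ[t].+-cong (𝐭⊗Z≋ (s≤s z≤n)) (ℤ[t].trans
           (ℤ[t].+-congʳ {neg (G v′ n (suc m))} (u≋Gv P KL (suc m))) (ℤ[t].-‿inverseʳ (G v′ n (suc m))))) ⟩
    t^ 2 · bracketᶻ m ⊕ (t^ 2 · Z′ (U m (suc m)) ⊕ neg 0ₚ)
      ≈⟨ ℤ[t].+-congˡ {t^ 2 · bracketᶻ m} (ℤ[t].+-congˡ {t^ 2 · Z′ (U m (suc m))} (ℤ[t].-‿cong q≋0)) ⟨
    t^ 2 · bracketᶻ m ⊕ (t^ 2 · Z′ (U m (suc m)) ⊖ t^ 2 · qᶻ (suc m))
      ≈⟨ t²-bracket-suc (Z′ (U m (suc m))) qᶻ k ⟨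
    t^ 2 · bracketᶻ (suc m) ∎
    where
    open import Relation.Binary.Reasoning.Setoid ℤ[t].setoid
    1≡ : n ∸ suc m ≡ 1
    1≡ = m+n∸n≡m 1 m
    -- The summand a = n - 1 contains Z(U_{0,1}), so the last increment of the bracket is all of
    -- Z(U_{n-2,n-1}).
    q≋0 : t^ 2 · qᶻ (suc m) ≋ 0ₚ
    q≋0 = t^-zero 2 (ℤ[t].trans (ℤ[t].*-congˡ {Z′ (U m (suc m))} (ℤ[t].trans
      (ℤ[t].reflexive (cong (λ x → Z′ (U (x ∸ 1) x)) 1≡)) (Z-of-loops P KL (U 0 1) U₀-loops)))
      (ℤ[t].zeroʳ (Z′ (U m (suc m)))))
    -- The last increment of `K` is 0, because `Z v′ 1` is t. The Z(U_{n-2,n-1}) that the bracket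
    -- has in addition is the extra term in `Hu-step`.
    K≋ : K v′ n (suc m) ≋ t^ 2 · bracketᶻ m
    K≋ = begin
      K v′ n m ⊕ (𝐭 ⊗ Z v′ (suc m) ⊖ Z v′ (n ∸ suc m) ⊗ Z v′ (suc m))
        ≈⟨ ℤ[t].+-congˡ {K v′ n m} (ℤ[t].+-congˡ {𝐭 ⊗ Z v′ (suc m)} (ℤ[t].-‿cong (ℤ[t].*-congʳ {Z v′ (suc m)}
             (ℤ[t].trans (ℤ[t].reflexive (cong (Z v′) 1≡)) (Z₁≋𝐭 P KL))))) ⟩
      K v′ n m ⊕ (𝐭 ⊗ Z v′ (suc m) ⊖ 𝐭 ⊗ Z v′ (suc m))
        ≈⟨ solve 2 (λ k z → (k :+ (z :+ (:- z))) ⊜ k) ℤ[t].refl (K v′ n m) (𝐭 ⊗ Z v′ (suc m)) ⟩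
      K v′ n m
        ≈⟨ bracketᶻ≋K k ≤-refl ⟨
      t^ 2 · bracketᶻ m ∎

  module _ (M : Matroid n) (corank : rank M + 2 ≡ n) (¬coloop : ∀ e → ¬ IsColoop M e) where

    open Corank2 M corank ¬coloop
    open Colours (_≟ˢ_ {n}) using (hits)

    private
      rank≡m : rank M ≡ m
      rank≡m = +-cancelʳ-≡ 2 (rank M) m (trans corank (+-comm 2 m))

      rk≤m : ∀ A → rk M A ≤ m
      rk≤m A = subst (rk M A ≤_) rank≡m (rk-mono M (⊆-max A))

    sum-stressed : ∀ (p : Poly) (q : ℕ → Poly) (f : ℕ → Poly) →
      (∀ {A} → A ∈ˡ stressedCircuits → t^ 2 · bracket p q (n ∸ suc (rk M A)) ≋ f (n ∸ suc (rk M A))) →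
      t^ 2 · (∑[ r ∈ 0 ⋯ m ] (+ #stressed M r (suc r)) · ((+ (n ∸ r ∸ 2)) · p ⊖ (∑[ a ∈ 2 ⋯ (n ∸ r ∸ 1) ] q a)))
      ≋ (∑[ A ∈ stressedCircuits ] f (hits A (toList colouring)))
    sum-stressed p q f h = begin
      t^ 2 · (∑[ r ∈ 0 ⋯ m ] (+ #stressed M r (suc r)) · g r)
        ≈⟨ t^-cong 2 (sum-by-key stressedCircuit? (λ r A → stressed? M A ×-dec (rk M A ≟ r) ×-dec (∣ A ∣ ≟ suc r)) (rk M)
             (λ { (stressed , refl , size) → (stressed , size) , refl }) (λ (stressed , size) → stressed , refl , size)
             g m (subsets n) rk≤m) ⟩
      t^ 2 · (∑[ A ∈ stressedCircuits ] g (rk M A))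
        ≈⟨ t^-∑ 2 stressedCircuits (λ A → g (rk M A)) ⟩
      (∑[ A ∈ stressedCircuits ] t^ 2 · g (rk M A))
        ≈⟨ sum-cong stressedCircuits (λ {A} A∈ → ℤ[t].trans (ℤ[t].reflexive (cong (t^ 2 ·_) (g≡ (rk M A))))
             (ℤ[t].trans (h A∈) (ℤ[t].reflexive (cong f (sym (hits-stressedCircuit A∈)))))) ⟩
      (∑[ A ∈ stressedCircuits ] f (hits A (toList colouring))) ∎
      where
      open import Relation.Binary.Reasoning.Setoid ℤ[t].setoid
      g : ℕ → Poly
      g r = (+ (n ∸ r ∸ 2)) · p ⊖ (∑[ a ∈ 2 ⋯ (n ∸ r ∸ 1) ] q a)
      g≡ : ∀ r → g r ≡ bracket p q (n ∸ suc r)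
      g≡ r = trans (cong (λ k → (+ k) · p ⊖ (∑[ a ∈ 2 ⋯ (n ∸ r ∸ 1) ] q a)) (sym (∸-+-assoc (n ∸ r) 1 1)))
        (cong (bracket p q) (trans (∸-+-assoc n r 1) (cong (n ∸_) (+-comm r 1))))

    private
      1+s : ∀ A → n ∸ suc (rk M A) ≡ suc (m ∸ rk M A)
      1+s A = +-∸-assoc 1 (rk≤m A)

      t²-⊖ : ∀ p q → t^ 2 · (p ⊖ q) ≋ t^ 2 · p ⊖ t^ 2 · q
      t²-⊖ p q = ℤ[t].trans (t^-⊕ 2 p (neg q)) (ℤ[t].+-congˡ {t^ 2 · p} (t^-· 2 -1ℤ q))

    P-corank2 : P M ≋ P (U m n) ⊖ (∑[ r ∈ 0 ⋯ m ] (+ #stressed M r (suc r)) ·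
      ((+ (n ∸ r ∸ 2)) · P (U m (suc m)) ⊖ (∑[ a ∈ 2 ⋯ (n ∸ r ∸ 1) ] qᴾ a)))
    P-corank2 = t^-cancel 2 (begin
      t^ 2 · P M
        ≡⟨ cong (λ k → t^ k · P M) (sym ν-colouring) ⟩
      t^ ν _≟ˢ_ (toList colouring) · P M
        ≈⟨ formula _≟ˢ_ stressedCircuits-unique P KL colouring M colouring⊆stressedCircuits colouring-presents ⟩
      Φ _≟ˢ_ stressedCircuits-unique P KL (toList colouring)
        ≡⟨ length-Φ _≟ˢ_ stressedCircuits-unique P KL colouring ⟩
      u′ n ⊖ (∑[ A ∈ stressedCircuits ] G v′ n (hits A (toList colouring)))
        ≈⟨ ℤ[t].+-congˡ {u′ n} (ℤ[t].-‿cong (sum-stressed (P (U m (suc m))) qᴾ (G v′ n) λ {A} _ → G≋ A)) ⟨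
      t^ 2 · P (U m n) ⊖ t^ 2 · Σᴾ
        ≈⟨ t²-⊖ (P (U m n)) Σᴾ ⟨
      t^ 2 · (P (U m n) ⊖ Σᴾ) ∎)
      where
      open import Relation.Binary.Reasoning.Setoid ℤ[t].setoid
      Σᴾ : Poly
      Σᴾ = ∑[ r ∈ 0 ⋯ m ] (+ #stressed M r (suc r)) · ((+ (n ∸ r ∸ 2)) · P (U m (suc m)) ⊖ (∑[ a ∈ 2 ⋯ (n ∸ r ∸ 1) ] qᴾ a))
      G≋ : ∀ A → t^ 2 · bracketᴾ (n ∸ suc (rk M A)) ≋ G v′ n (n ∸ suc (rk M A))
      G≋ A = subst (λ k → t^ 2 · bracketᴾ k ≋ G v′ n k) (sym (1+s A)) (bracketᴾ≋G (m ∸ rk M A) (m∸n≤m m (rk M A)))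

    Z-corank2 : Z′ M ≋ Z′ (U m n) ⊖ (∑[ r ∈ 0 ⋯ m ] (+ #stressed M r (suc r)) ·
      ((+ (n ∸ r ∸ 2)) · Z′ (U m (suc m)) ⊖ (∑[ a ∈ 2 ⋯ (n ∸ r ∸ 1) ] qᶻ a)))
    Z-corank2 = t^-cancel 2 (ℤ[t].trans (cases (loopless? M)) (ℤ[t].sym (t²-⊖ (Z′ (U m n)) Σᶻ)))
      where
      open import Relation.Binary.Reasoning.Setoid ℤ[t].setoid
      Σᶻ : Poly
      Σᶻ = ∑[ r ∈ 0 ⋯ m ] (+ #stressed M r (suc r)) · ((+ (n ∸ r ∸ 2)) · Z′ (U m (suc m)) ⊖ (∑[ a ∈ 2 ⋯ (n ∸ r ∸ 1) ] qᶻ a))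
      cases : Dec (Loopless M) → t^ 2 · Z′ M ≋ t^ 2 · Z′ (U m n) ⊖ t^ 2 · Σᶻ
      cases (yes ℓ) = begin
        t^ 2 · Z′ M
          ≈⟨ Z-formula _≟ˢ_ stressedCircuits-unique P KL colouring M colouring⊆stressedCircuits colouring-presents ν-colouring ℓ ⟩
        H n u′ ⊖ (∑[ A ∈ stressedCircuits ] K v′ n (hits A (toList colouring)))
          ≈⟨ ℤ[t].+-cong (Z-uniform P KL 2 (s≤s (s≤s 0<m))) (ℤ[t].-‿cong (sum-stressed (Z′ (U m (suc m))) qᶻ (K v′ n) K≋)) ⟨
        t^ 2 · Z′ (U m n) ⊖ t^ 2 · Σᶻ ∎
        where
        0<m : 0 < m
        0<m = subst (0 <_) rank≡m (positive-rank M ℓ z<s)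
        K≋ : ∀ {A} → A ∈ˡ stressedCircuits → t^ 2 · bracketᶻ (n ∸ suc (rk M A)) ≋ K v′ n (n ∸ suc (rk M A))
        K≋ {A} A∈ with _ , _ , size ← ∈-filter⁻ stressedCircuit? {xs = subsets n} A∈ =
          subst (λ k → t^ 2 · bracketᶻ k ≋ K v′ n k) (sym (1+s A)) (bracketᶻ≋K (m ∸ rk M A) (∸-monoʳ-< 0<rk (rk≤m A)))
          where
          -- Positive rank excludes the class size n - 1 left out by `bracketᶻ≋K`; A is nonempty
          -- because its size is a successor.
          0<rk : 0 < rk M A
          0<rk with nonempty? A
          ... | yes (e , e∈A) = <-≤-trans (n≢0⇒n>0 (ℓ e)) (rk-mono M λ x∈ → subst (_∈ A) (sym (x∈⁅y⁆⇒x≡y e x∈)) e∈A)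
          ... | no empty with () ← trans (sym size) (trans (cong ∣_∣ (Empty-unique empty)) (∣⊥∣≡0 n))
      -- Now the classes have sizes 1 and n - 1. The bracket of the former is 0, and that of the
      -- latter must cancel Z(U_{n-2,n}).
      cases (no ¬ℓ) with e , loop ← ¬loopless⇒loop M ¬ℓ = begin
        t^ 2 · Z′ M
          ≈⟨ t^-zero 2 (Z-of-loops P KL M ¬ℓ) ⟩
        0ₚ
          ≈⟨ ℤ[t].-‿inverseʳ (t^ 2 · bracketᶻ (suc m)) ⟨
        t^ 2 · bracketᶻ (suc m) ⊖ t^ 2 · bracketᶻ (suc m)
          ≈⟨ ℤ[t].+-cong uniform (ℤ[t].-‿cong Σᶻ≋) ⟨
        t^ 2 · Z′ (U m n) ⊖ t^ 2 · Σᶻ ∎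
        where
        uniform : t^ 2 · Z′ (U m n) ≋ t^ 2 · bracketᶻ (suc m)
        uniform with m≤n⇒m<n∨m≡n (z≤n {m})
        ... | inj₁ 0<m  = Z-uniform-loop 0<m
        -- For n = 2 the uniform matroid U_{0,2} consists of loops, and both sides are 0.
        ... | inj₂ refl = ℤ[t].trans (t^-zero 2 (Z-of-loops P KL (U 0 2) U₀-loops))
          (ℤ[t].sym (t^-zero 2 (bracket₁ (Z′ (U 0 1)) qᶻ)))
        Σᶻ≋ : t^ 2 · Σᶻ ≋ t^ 2 · bracketᶻ (suc m)
        Σᶻ≋ = ℤ[t].trans (sum-stressed (Z′ (U m (suc m))) qᶻ (λ s → t^ 2 · bracketᶻ s) λ _ → ℤ[t].refl)
          (sum-hits-loop _≟ˢ_ {c = colouring} {M} colouring-presents ν-colouring loop stressedCircuits-unique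
            colouring⊆stressedCircuits (λ s → t^ 2 · bracketᶻ s)
            (t^-zero 2 (bracket₀ (Z′ (U m (suc m))) qᶻ)) (t^-zero 2 (bracket₁ (Z′ (U m (suc m))) qᶻ)))

theorem9p9 :
  (P : ∀ {n} → Matroid n → Poly) → IsKazhdanLusztig P →
  let Z : ∀ {n} → Matroid n → Poly
      Z = Z-of P
  in
  ∀ {n} (M : Matroid n) → rank M + 2 ≡ n → (∀ e → ¬ IsColoop M e) →
  (P M ≈ P (U (n ∸ 2) n) ⊖
     (∑[ r ∈ 0 ⋯ (n ∸ 2) ] (+ #stressed M r (suc r)) ·
       ((+ (n ∸ r ∸ 2)) · P (U (n ∸ 2) (n ∸ 1)) ⊖
         (∑[ a ∈ 2 ⋯ (n ∸ r ∸ 1) ]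
           P (U (n ∸ a ∸ 1) (n ∸ a)) ⊗
             (P (U (a ∸ 1) a) ⊕ t^ 1 · P (U (a ∸ 2) (a ∸ 1)))))))
  ×
  (Z M ≈ Z (U (n ∸ 2) n) ⊖
     (∑[ r ∈ 0 ⋯ (n ∸ 2) ] (+ #stressed M r (suc r)) ·
       ((+ (n ∸ r ∸ 2)) · Z (U (n ∸ 2) (n ∸ 1)) ⊖
         (∑[ a ∈ 2 ⋯ (n ∸ r ∸ 1) ]
           Z (U (a ∸ 1) a) ⊗ Z (U (n ∸ a ∸ 1) (n ∸ a))))))
theorem9p9 P KL {zero}        M corank _ with () ← trans (+-comm 2 (rank M)) corank
theorem9p9 P KL {suc zero}    M corank _ with () ← trans (+-comm 2 (rank M)) corank
theorem9p9 P KL {suc (suc m)} M corank ¬coloop =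
  at (P-corank2 P KL m M corank ¬coloop) , at (Z-corank2 P KL m M corank ¬coloop)
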